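{- Let $D\ge 1$ and $N>2D$ be integers, let $q$ be a prime power, let $\Gamma=J_q(N,D)$, let $x$ be a vertex of $\Gamma$, and let $A^*=A^*(x)$ be the dual adjacency matrix. For every subspace $\alpha\subseteq x$, with $i=\dim\alpha$, $$A^*\alpha^{\vee}=\theta^*_{D-i}\,\alpha^{\vee}+\frac{q^{ -D+i+1}[N][N-1]}{[D][N-D]}\sum_{\substack{\gamma\subseteq x,\\ \gamma\text{ covers }\alpha}}\gamma^{\vee}.$$
   Context: Let $\mathbb{F}_q$ be a finite field with $q$ elements and $\mathcal{V}$ an $N$-dimensional vector space over $\mathbb{F}_q$. The Grassmann graph $\Gamma=J_q(N,D)$ has vertex set $X$ consisting of the $D$-dimensional subspaces of $\mathcal{V}$; $y,z\in X$ are adjacent iff $\dim(y\cap z)=D-1$. For $N>2D$ it has diameter $D$ and path-length distance $\partial(y,z)=D-\dim(y\cap z)$. $[\ell]=\frac{q^\ell-1}{q-1}$ for integers $\ell$. The adjacency matrix $A$ has distinct eigenvalues $\theta_0>\theta_1>\cdots>\theta_D$; let $E_1$ be the orthogonal projection of $V=\mathbb{C}^X$ onto the $\theta_1$-eigenspace. The dual adjacency matrix $A^*=A^*(x)$ is the diagonal matrix with $(y,y)$-entry $|X|(E_1)_{x,y}$. One has $A^*=\sum_{i=0}^D\theta_i^*E_i^*$, where $E_i^*$ is the diagonal matrix with $(y,y)$-entry $1$ if $\partial(x,y)=i$ and $0$ otherwise, and the dual eigenvalues are $$\theta_i^*=-\frac{q[N-1]([D]+[N-D])}{(q-1)[D][N-D]}+\frac{q[N][N-1]}{(q-1)[D][N-D]}q^{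 -i}\qquad(0\le i\le D).$$ For subspaces $u,v$ of $\mathcal{V}$, $v$ covers $u$ means $u\subseteq v$ and $\dim v=\dim u+1$. For $y\in X$ let $\widehat y\in V$ have $1$ in coordinate $y$ and $0$ elsewhere. For a subspace $\alpha\subseteq x$, $\alpha^{\vee}=\sum_{y\in X,\ \alpha\subseteq y}\widehat y$. -}

module Defs where

open import Algebra.Apartness.Bundles using (HeytingField)
open import Algebra.Bundles using (CommutativeRing)
open import Algebra.Module.Bundles using (Module)
open import Data.Bool.Base using (if_then_else_)
open import Data.Fin.Base using (Fin; zero; suc; finToFun; funToFin; fromℕ<; toℕ)
import Data.Fin.Base as Fin
open import Data.Fin.Properties using (any?; all?; finToFun-funToFin)
import Data.Fin.Properties as Fin
open import Data.Fin.Subset using (Subset; inside; outside; _∈_; _⊆_; _∩_)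
open import Data.Fin.Subset.Properties using (_∈?_; _⊆?_)
open import Data.Integer.Base using (ℤ; +_; -[1+_])
import Data.Integer.Base as ℤ
open import Data.List.Base using (List; []; _∷_; _++_; map; filter; length; lookup)
open import Data.Nat.Base as ℕ using (ℕ; zero; suc; NonZero; s≤s; z≤n)
import Data.Nat.DivMod as ℕ
import Data.Nat.Properties as ℕ
open import Data.Product.Base using (∃; ∃-syntax; _×_; _,_; proj₁; proj₂)
open import Data.Sum.Base using (_⊎_; inj₁; inj₂)
open import Data.Vec.Base using ([]; _∷_)
open import Function.Base using (_∘_)
open import Function.Bundles using (Inverse)
open import Level using (_⊔_) renaming (suc to lsuc)
open import Relation.Binary.Core using (Rel)
open import Relation.Binary.PropositionalEquality.Core as ≡ using (_≡_)
import Relation.Binary.PropositionalEquality.Properties as ≡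
open import Relation.Binary.Structures using (IsStrictPartialOrder)
open import Relation.Nullary using (¬_; Dec; does; contradiction)
open import Relation.Nullary.Decidable using (map′; _×-dec_; _→-dec_)
open import Relation.Unary using (Pred; Decidable)

import Algebra.Properties.AbelianGroup
import Algebra.Properties.CommutativeMonoid.Sum
import Algebra.Properties.Monoid.Mult
import Algebra.Properties.Ring
import Algebra.Solver.Ring.NaturalCoefficients.Default as NaturalSolver

-- The standard library has no real numbers, so they are axiomatised as a
-- Cauchy complete Archimedean ordered field.  Apartness replaces inequality,
-- so that the Bishop reals are a model; classically ℝ is the only model
-- up to isomorphism.
record RealField c ℓ₁ ℓ₂ ℓ₃ : Set (lsuc (c ⊔ ℓ₁ ⊔ ℓ₂ ⊔ ℓ₃)) where
  infix 4 _<_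
  field
    heytingField : HeytingField c ℓ₁ ℓ₂
  open HeytingField heytingField public

  commutativeRing : CommutativeRing c ℓ₁
  commutativeRing = record { isCommutativeRing = isCommutativeRing }

  open Algebra.Properties.Monoid.Mult (CommutativeRing.+-monoid commutativeRing)
    using () renaming (_×_ to _times_)

  fromℕ : ℕ → Carrier
  fromℕ n = n times 1#

  field
    _<_                  : Rel Carrier ℓ₃
    isStrictPartialOrder : IsStrictPartialOrder _≈_ _<_
    <⇒#                  : ∀ {x y} → x < y → x # y
    #⇒<⊎>                : ∀ {x y} → x # y → x < y ⊎ y < x
    +-monoʳ-<            : ∀ z {x y} → x < y → z + x < z + y
    *-pos                : ∀ {x y} → 0# < x → 0# < y → 0# < x * y
    archimedean          : ∀ x → ∃[ n ] x < fromℕ n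
    -- |x| < 1/(k+1) is written as (k+1) x < 1 and (k+1) (- x) < 1; in the
    -- Cauchy condition one inequality is enough, as m and n may be swapped.
    cauchyComplete       : ∀ (s : ℕ → Carrier) →
      (∀ k → ∃[ M ] (∀ m n → M ℕ.≤ m → M ℕ.≤ n → fromℕ (suc k) * (s m - s n) < 1#)) →
      ∃[ l ] (∀ k → ∃[ M ] (∀ m → M ℕ.≤ m →
        fromℕ (suc k) * (s m - l) < 1# × fromℕ (suc k) * (l - s m) < 1#))

  open IsStrictPartialOrder isStrictPartialOrder public
    using () renaming (trans to <-trans; irrefl to <-irrefl; <-respˡ-≈ to <-respˡ; <-respʳ-≈ to <-respʳ)

  private
    open module RingProperties = Algebra.Properties.Ring (CommutativeRing.ring commutativeRing)
      using (-‿distribˡ-*; -‿involutive; -0#≈0#)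

  1#0 : 1# # 0#
  1#0 = invertible⇒# (1# , trans (*-identityˡ _) 1-0≈1 , trans (*-identityʳ _) 1-0≈1)
    where
    1-0≈1 : 1# - 0# ≈ 1#
    1-0≈1 = trans (+-congˡ -0#≈0#) (+-identityʳ 1#)

  0<1 : 0# < 1#
  0<1 with #⇒<⊎> 1#0
  ... | inj₂ 0<1 = 0<1
  ... | inj₁ 1<0 = <-respʳ -1*-1≈1 (*-pos 0<-1 0<-1)
    where
    0<-1 : 0# < - 1#
    0<-1 = <-respˡ (-‿inverseˡ 1#) (<-respʳ (+-identityʳ (- 1#)) (+-monoʳ-< (- 1#) 1<0))
    -1*-1≈1 : - 1# * - 1# ≈ 1#
    -1*-1≈1 = trans (sym (-‿distribˡ-* 1# (- 1#)))
      (trans (-‿cong (*-identityˡ (- 1#))) (-‿involutive 1#))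

  0<fromℕ : ∀ n → 0# < fromℕ (suc n)
  0<fromℕ zero    = <-respʳ (sym (+-identityʳ 1#)) 0<1
  0<fromℕ (suc n) = <-trans 0<1
    (<-respˡ (+-identityʳ 1#) (+-monoʳ-< 1# (0<fromℕ n)))

  fromℕ-# : ∀ n → .{{NonZero n}} → fromℕ n # 0#
  fromℕ-# (suc n) = #-sym (<⇒# (0<fromℕ n))

  fromℕ⁻¹ : (n : ℕ) → .{{NonZero n}} → Carrier
  fromℕ⁻¹ n = proj₁ (#⇒invertible (fromℕ-# n))

module ComplexNumbers {r ℓ₁ ℓ₂ ℓ₃} (ℝ : RealField r ℓ₁ ℓ₂ ℓ₃) where
  private
    module R = RealField ℝ

    open NaturalSolver (CommutativeRing.commutativeSemiring R.commutativeRing)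
      using (solve; _:=_; _:+_; _:*_)
    open Algebra.Properties.Ring (CommutativeRing.ring R.commutativeRing)
      using (-1*x≈-x; -0#≈0#)

  ℂ : Set r
  ℂ = R.Carrier × R.Carrier

  infix 4 _≈_
  _≈_ : Rel ℂ ℓ₁
  (a , b) ≈ (c , d) = a R.≈ c × b R.≈ d

  complexRing : CommutativeRing r ℓ₁
  complexRing = record
    { Carrier = ℂ
    ; _≈_     = _≈_
    ; _+_     = λ (a , b) (c , d) → a R.+ c , b R.+ d
    ; _*_     = λ (a , b) (c , d) → a R.* c R.- b R.* d , a R.* d R.+ b R.* c
    ; -_      = λ (a , b) → R.- a , R.- b
    ; 0#      = R.0# , R.0#
    ; 1#      = R.1# , R.0#
    ; isCommutativeRing = record
      { isRing = record
        { +-isAbelianGroup = record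
          { isGroup = record
            { isMonoid = record
              { isSemigroup = record
                { isMagma = record
                  { isEquivalence = record
                    { refl  = R.refl , R.refl
                    ; sym   = λ (p , q) → R.sym p , R.sym q
                    ; trans = λ (p , q) (s , t) → R.trans p s , R.trans q t
                    }
                  ; ∙-cong = λ (p , q) (s , t) → R.+-cong p s , R.+-cong q t
                  }
                ; assoc = λ _ _ _ → R.+-assoc _ _ _ , R.+-assoc _ _ _
                }
              ; identity = (λ _ → R.+-identityˡ _ , R.+-identityˡ _)
                         , (λ _ → R.+-identityʳ _ , R.+-identityʳ _)
              }
            ; inverse = (λ _ → R.-‿inverseˡ _ , R.-‿inverseˡ _)
                      , (λ _ → R.-‿inverseʳ _ , R.-‿inverseʳ _)
            ; ⁻¹-cong = λ (p , q) → R.-‿cong p , R.-‿cong q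
            }
          ; comm = λ _ _ → R.+-comm _ _ , R.+-comm _ _
          }
        ; *-cong     = times-cong
        ; *-assoc    = *-assoc
        ; *-identity = identityˡ
                     , (λ z → ≈-trans (comm z one) (identityˡ z))
        ; distrib    = distribˡ
                     , (λ z u v → ≈-trans (comm (plus u v) z)
                         (≈-trans (distribˡ z u v) (plus-cong (comm z u) (comm z v))))
        }
      ; *-comm = comm
      }
    }
    where
    one : ℂ
    one = R.1# , R.0#

    plus times times′ : ℂ → ℂ → ℂ
    plus   (a , b) (c , d) = a R.+ c , b R.+ d
    times  (a , b) (c , d) = a R.* c R.- b R.* d , a R.* d R.+ b R.* c
    times′ (a , b) (c , d) = a R.* c R.+ (R.- R.1#) R.* (b R.* d) , a R.* d R.+ b R.* c

    ≈-sym : ∀ {x y} → x ≈ y → y ≈ x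
    ≈-sym (p , q) = R.sym p , R.sym q

    ≈-trans : ∀ {x y z} → x ≈ y → y ≈ z → x ≈ z
    ≈-trans (p , q) (s , t) = R.trans p s , R.trans q t

    plus-cong : ∀ {x y u v} → x ≈ y → u ≈ v → plus x u ≈ plus y v
    plus-cong (p , q) (s , t) = R.+-cong p s , R.+-cong q t

    times-cong : ∀ {x y u v} → x ≈ y → u ≈ v → times x u ≈ times y v
    times-cong (p , q) (s , t) =
        R.+-cong (R.*-cong p s) (R.-‿cong (R.*-cong q t))
      , R.+-cong (R.*-cong p t) (R.*-cong q s)

    times′≈times : ∀ x y → times′ x y ≈ times x y
    times′≈times _ _ = R.+-congˡ (-1*x≈-x _) , R.refl

    comm : ∀ x y → times x y ≈ times y x
    comm (a , b) (c , d) =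
        R.+-cong (R.*-comm a c) (R.-‿cong (R.*-comm b d))
      , R.trans (R.+-comm _ _) (R.+-cong (R.*-comm b c) (R.*-comm a d))

    identityˡ : ∀ z → times one z ≈ z
    identityˡ (a , b) =
        R.trans (R.+-cong (R.*-identityˡ a) (R.trans (R.-‿cong (R.zeroˡ b)) -0#≈0#)) (R.+-identityʳ a)
      , R.trans (R.+-cong (R.*-identityˡ b) (R.zeroˡ a)) (R.+-identityʳ b)

    assoc′ : ∀ x y z → times′ (times′ x y) z ≈ times′ x (times′ y z)
    assoc′ (a , b) (c , d) (e , f) =
        solve 7 (λ n a b c d e f →
          (a :* c :+ n :* (b :* d)) :* e :+ n :* ((a :* d :+ b :* c) :* f)
          := a :* (c :* e :+ n :* (d :* f)) :+ n :* (b :* (c :* f :+ d :* e)))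
          R.refl (R.- R.1#) a b c d e f
      , solve 7 (λ n a b c d e f →
          (a :* c :+ n :* (b :* d)) :* f :+ (a :* d :+ b :* c) :* e
          := a :* (c :* f :+ d :* e) :+ b :* (c :* e :+ n :* (d :* f)))
          R.refl (R.- R.1#) a b c d e f

    distribˡ′ : ∀ x y z → times′ x (plus y z) ≈ plus (times′ x y) (times′ x z)
    distribˡ′ (a , b) (c , d) (e , f) =
        solve 7 (λ n a b c d e f →
          a :* (c :+ e) :+ n :* (b :* (d :+ f))
          := (a :* c :+ n :* (b :* d)) :+ (a :* e :+ n :* (b :* f)))
          R.refl (R.- R.1#) a b c d e f
      , solve 7 (λ n a b c d e f →
          a :* (d :+ f) :+ b :* (c :+ e)
          := (a :* d :+ b :* c) :+ (a :* f :+ b :* e))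
          R.refl (R.- R.1#) a b c d e f

    *-assoc : ∀ x y z → times (times x y) z ≈ times x (times y z)
    *-assoc x y z =
      ≈-trans (times-cong {u = z} (≈-sym (times′≈times x y)) (R.refl , R.refl))
      (≈-trans (≈-sym (times′≈times (times′ x y) z))
      (≈-trans (assoc′ x y z)
      (≈-trans (times′≈times x (times′ y z))
               (times-cong {x} (R.refl , R.refl) (times′≈times y z)))))

    distribˡ : ∀ x y z → times x (plus y z) ≈ plus (times x y) (times x z)
    distribˡ x y z =
      ≈-trans (≈-sym (times′≈times x (plus y z)))
      (≈-trans (distribˡ′ x y z) (plus-cong (times′≈times x y) (times′≈times x z)))

  open CommutativeRing complexRing public
    using (_+_; _*_; _-_; -_; 0#; 1#)

  infix 4 _#_
  _#_ : Rel ℂ ℓ₂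
  (a , b) # (c , d) = a R.# c ⊎ b R.# d

  conj : ℂ → ℂ
  conj (a , b) = a , R.- b

  real : R.Carrier → ℂ
  real a = a , R.0#

  infix 9 ⌜_⌝
  ⌜_⌝ : ℕ → ℂ
  ⌜ n ⌝ = real (R.fromℕ n)

  infixl 7 _÷_
  _÷_ : (a b : ℕ) → .{{NonZero b}} → ℂ
  a ÷ b = real (R.fromℕ a R.* R.fromℕ⁻¹ b)

module ComplexLinearAlgebra {r ℓ₁ ℓ₂ ℓ₃} (ℝ : RealField r ℓ₁ ℓ₂ ℓ₃) where
  open ComplexNumbers ℝ public
  open RealField ℝ using (Carrier; _<_)
  open Algebra.Properties.CommutativeMonoid.Sum
    (CommutativeRing.+-commutativeMonoid complexRing) public using (sum)

  Vector Matrix : ℕ → Set r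
  Vector n = Fin n → ℂ
  Matrix n = Fin n → Fin n → ℂ

  infix 4 _≋_
  _≋_ : ∀ {n} → Rel (Vector n) ℓ₁
  v ≋ w = ∀ y → v y ≈ w y

  infixl 6 _⊞_ _⊟_
  infixr 7 _∙_ _·_

  _⊞_ _⊟_ : ∀ {n} → Vector n → Vector n → Vector n
  (v ⊞ w) y = v y + w y
  (v ⊟ w) y = v y - w y

  _∙_ : ∀ {n} → ℂ → Vector n → Vector n
  (c ∙ v) y = c * v y

  _·_ : ∀ {n} → Matrix n → Vector n → Vector n
  (M · v) y = sum (λ z → M y z * v z)

  sumOver : ∀ {n m p} {P : Pred (Fin m) p} → Decidable P → (Fin m → Vector n) → Vector n
  sumOver P? f y = sum (λ i → if does (P? i) then f i y else 0#)

  unit : ∀ {n} → Fin n → Vector n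
  unit y z = if does (y Fin.≟ z) then 1# else 0#

  ⟨_,_⟩ : ∀ {n} → Vector n → Vector n → ℂ
  ⟨ v , w ⟩ = sum (λ y → conj (v y) * w y)

  Eigenspace : ∀ {n} → Matrix n → ℂ → Pred (Vector n) ℓ₁
  Eigenspace M θ v = M · v ≋ θ ∙ v

  IsEigenvalue : ∀ {n} → Matrix n → ℂ → Set (r ⊔ ℓ₁ ⊔ ℓ₂)
  IsEigenvalue M θ = ∃[ v ] (∃[ y ] v y # 0#) × Eigenspace M θ v

  record DistinctEigenvalues {n} (M : Matrix n) {d} (θ : Fin d → Carrier)
         : Set (r ⊔ ℓ₁ ⊔ ℓ₂ ⊔ ℓ₃) where
    field
      decreasing  : ∀ {i j} → i Fin.< j → θ j < θ i
      eigenvalue  : ∀ i → IsEigenvalue M (real (θ i))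
      exhaustive  : ∀ η → IsEigenvalue M η → ∃[ i ] η ≈ real (θ i)

  record IsOrthogonalProjection {n p} (E : Matrix n) (W : Pred (Vector n) p)
         : Set (r ⊔ ℓ₁ ⊔ p) where
    field
      range      : ∀ v → W (E · v)
      orthogonal : ∀ v w → W w → ⟨ w , v ⊟ E · v ⟩ ≈ 0#

-- That q is a prime power follows from the existence of a field with q elements.
record FiniteField c ℓ (q : ℕ) : Set (lsuc (c ⊔ ℓ)) where
  field
    commutativeRing : CommutativeRing c ℓ
  open CommutativeRing commutativeRing public
  field
    0≉1         : ¬ 0# ≈ 1#
    inverse     : ∀ x → ¬ x ≈ 0# → ∃[ y ] x * y ≈ 1#
    enumeration : Inverse (≡.setoid (Fin q)) setoid

  elem : Fin q → Carrier
  elem = Inverse.to enumeration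

  index : Carrier → Fin q
  index = Inverse.from enumeration

  elem-index : ∀ x → elem (index x) ≈ x
  elem-index x = Inverse.inverseˡ enumeration ≡.refl

  infix 4 _≟_
  _≟_ : ∀ x y → Dec (x ≈ y)
  x ≟ y = map′ (λ e → trans (sym (elem-index x)) (trans (reflexive (≡.cong elem e)) (elem-index y)))
               (Inverse.from-cong enumeration) (index x Fin.≟ index y)

  1<q : 1 ℕ.< q
  1<q = helper (index 0#) (index 1#)
    (λ e → 0≉1 (trans (sym (elem-index 0#)) (trans (reflexive (≡.cong elem e)) (elem-index 1#))))
    where
    helper : ∀ {n} (i j : Fin n) → ¬ i ≡ j → 1 ℕ.< n
    helper {suc zero}    zero zero i≢j = contradiction ≡.refl i≢j
    helper {suc (suc n)} _    _    _   = s≤s (s≤s z≤n)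

module LinearCombinations {c ℓ q m ℓm} (𝔽 : FiniteField c ℓ q)
  (M : Module (FiniteField.commutativeRing 𝔽) m ℓm) where
  open FiniteField 𝔽 using (Carrier; _≈_; 0#)
  open Module M
  private
    open module Sum = Algebra.Properties.CommutativeMonoid.Sum +ᴹ-commutativeMonoid
      using (sum)

  lc : ∀ {d} → (Fin d → Carrier) → (Fin d → Carrierᴹ) → Carrierᴹ
  lc a b = sum (λ j → a j *ₗ b j)

  LinearlyIndependent : ∀ {d} → (Fin d → Carrierᴹ) → Set (c ⊔ ℓ ⊔ ℓm)
  LinearlyIndependent b = ∀ a → lc a b ≈ᴹ 0ᴹ → ∀ j → a j ≈ 0#

  InSpan : ∀ {d} → (Fin d → Carrierᴹ) → Pred Carrierᴹ (c ⊔ ℓm)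
  InSpan b v = ∃[ a ] lc a b ≈ᴹ v

  lc-cong : ∀ {d} {a a′ : Fin d → Carrier} {b b′ : Fin d → Carrierᴹ} →
            (∀ j → a j ≈ a′ j) → (∀ j → b j ≈ᴹ b′ j) → lc a b ≈ᴹ lc a′ b′
  lc-cong p r = Sum.sum-cong-≋ (λ j → *ₗ-cong (p j) (r j))

  lc-zero : ∀ {d} {a : Fin d → Carrier} (b : Fin d → Carrierᴹ) →
            (∀ j → a j ≈ 0#) → lc a b ≈ᴹ 0ᴹ
  lc-zero {d} b p = ≈ᴹ-trans
    (Sum.sum-cong-≋ (λ j → ≈ᴹ-trans (*ₗ-cong (p j) ≈ᴹ-refl) (*ₗ-zeroˡ (b j))))
    (Sum.sum-replicate-zero d)

record VectorSpace {c ℓ q} (𝔽 : FiniteField c ℓ q) (N : ℕ) m ℓm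
       : Set (c ⊔ ℓ ⊔ lsuc (m ⊔ ℓm)) where
  field
    asModule : Module (FiniteField.commutativeRing 𝔽) m ℓm
  open Module asModule public using (Carrierᴹ; _≈ᴹ_; _+ᴹ_; 0ᴹ; -ᴹ_; _*ₗ_)
  open LinearCombinations 𝔽 asModule public
  field
    basis       : Fin N → Carrierᴹ
    independent : LinearlyIndependent basis
    spanning    : ∀ v → InSpan basis v

module Subspaces {c ℓ q N m ℓm} (𝔽 : FiniteField c ℓ q) (𝒱 : VectorSpace 𝔽 N m ℓm) where
  private
    module F = FiniteField 𝔽
  open VectorSpace 𝒱
  open Module asModule using (≈ᴹ-refl; ≈ᴹ-sym; ≈ᴹ-trans; +ᴹ-cong; *ₗ-cong; -ᴹ‿inverseʳ; +ᴹ-abelianGroup)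

  coefficients : ∀ {d} → Fin (q ℕ.^ d) → Fin d → F.Carrier
  coefficients k j = F.elem (finToFun k j)

  -- Each element of 𝒱 occurs exactly once as vec k.  A set of vectors is
  -- represented by the set of the indices of its members.
  vec : Fin (q ℕ.^ N) → Carrierᴹ
  vec k = lc (coefficients k) basis

  VectorSet : Set
  VectorSet = Subset (q ℕ.^ N)

  infix 4 _∈ᵥ_
  _∈ᵥ_ : Carrierᴹ → VectorSet → Set ℓm
  v ∈ᵥ u = ∃[ k ] k ∈ u × vec k ≈ᴹ v

  record IsSubspace (u : VectorSet) : Set (c ⊔ m ⊔ ℓm) where
    field
      0∈       : 0ᴹ ∈ᵥ u
      +-closed : ∀ {v w} → v ∈ᵥ u → w ∈ᵥ u → v +ᴹ w ∈ᵥ u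
      *-closed : ∀ a {v} → v ∈ᵥ u → a *ₗ v ∈ᵥ u

  IsBasis : VectorSet → ∀ {d} → (Fin d → Carrierᴹ) → Set (c ⊔ ℓ ⊔ m ⊔ ℓm)
  IsBasis u b = (∀ j → b j ∈ᵥ u) × LinearlyIndependent b × (∀ v → v ∈ᵥ u → InSpan b v)

  HasDim : VectorSet → ℕ → Set (c ⊔ ℓ ⊔ m ⊔ ℓm)
  HasDim u d = ∃[ b ] IsBasis u {d} b

  -- Here n stands for dim u; the bound n < N loses nothing, as dim v ≤ N.
  _Covers_ : VectorSet → VectorSet → Set (c ⊔ ℓ ⊔ m ⊔ ℓm)
  v Covers u = u ⊆ v × ∃[ n ] HasDim u (toℕ {N} n) × HasDim v (suc (toℕ n))

  coefficients-onto : ∀ {d} (a : Fin d → F.Carrier) j →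
                      coefficients (funToFin (F.index ∘ a)) j F.≈ a j
  coefficients-onto a j = F.trans
    (F.reflexive (≡.cong F.elem (finToFun-funToFin (F.index ∘ a) j))) (F.elem-index (a j))

  vec-onto : ∀ v → ∃[ k ] vec k ≈ᴹ v
  vec-onto v with spanning v
  ... | a , a≈v = funToFin (F.index ∘ a)
                , ≈ᴹ-trans (lc-cong (coefficients-onto a) (λ _ → ≈ᴹ-refl)) a≈v

  _≟ᵥ0 : ∀ v → Dec (v ≈ᴹ 0ᴹ)
  v ≟ᵥ0 with spanning v
  ... | a , a≈v = map′ (λ z → ≈ᴹ-trans (≈ᴹ-sym a≈v) (lc-zero basis z))
                       (λ v≈0 → independent a (≈ᴹ-trans a≈v v≈0))
                       (all? (λ j → a j F.≟ F.0#))

  infix 4 _≟ᵥ_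
  _≟ᵥ_ : ∀ v w → Dec (v ≈ᴹ w)
  v ≟ᵥ w = map′ (λ e → x∙y⁻¹≈ε⇒x≈y v w e)
               (λ e → ≈ᴹ-trans (+ᴹ-cong e ≈ᴹ-refl) (-ᴹ‿inverseʳ w))
               ((v +ᴹ -ᴹ w) ≟ᵥ0)
    where open Algebra.Properties.AbelianGroup +ᴹ-abelianGroup using (x∙y⁻¹≈ε⇒x≈y)

  infix 4 _∈ᵥ?_
  _∈ᵥ?_ : ∀ v u → Dec (v ∈ᵥ u)
  v ∈ᵥ? u = any? (λ k → (k ∈? u) ×-dec (vec k ≟ᵥ v))

  ∈ᵥ-resp : ∀ {u v w} → v ≈ᴹ w → v ∈ᵥ u → w ∈ᵥ u
  ∈ᵥ-resp v≈w (k , k∈u , e) = k , k∈u , ≈ᴹ-trans e v≈w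

  allVec? : ∀ {p} {P : Pred Carrierᴹ p} → (∀ {v w} → v ≈ᴹ w → P v → P w) →
            Decidable P → Dec (∀ v → P v)
  allVec? resp P? = map′ (λ h v → let (k , e) = vec-onto v in resp e (h k))
                         (λ h k → h (vec k)) (all? (P? ∘ vec))

  anyCoeff? : ∀ {d p} {P : Pred (Fin d → F.Carrier) p} →
              (∀ {a b} → (∀ j → a j F.≈ b j) → P a → P b) → Decidable P → Dec (∃ P)
  anyCoeff? resp P? = map′ (λ (k , p) → coefficients k , p)
    (λ (a , p) → funToFin (F.index ∘ a) , resp (λ j → F.sym (coefficients-onto a j)) p)
    (any? (P? ∘ coefficients))

  allCoeff? : ∀ {d p} {P : Pred (Fin d → F.Carrier) p} →
              (∀ {a b} → (∀ j → a j F.≈ b j) → P a → P b) → Decidable P → Dec (∀ a → P a)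
  allCoeff? resp P? = map′ (λ h a → resp (coefficients-onto a) (h _))
    (λ h k → h (coefficients k)) (all? (P? ∘ coefficients))

  independent? : ∀ {d} (b : Fin d → Carrierᴹ) → Dec (LinearlyIndependent b)
  independent? b = allCoeff?
    (λ e h z j → F.trans (F.sym (e j)) (h (≈ᴹ-trans (lc-cong e (λ _ → ≈ᴹ-refl)) z) j))
    (λ a → (lc a b ≟ᵥ 0ᴹ) →-dec all? (λ j → a j F.≟ F.0#))

  inSpan? : ∀ {d} (b : Fin d → Carrierᴹ) v → Dec (InSpan b v)
  inSpan? b v = anyCoeff?
    (λ e z → ≈ᴹ-trans (lc-cong (λ j → F.sym (e j)) (λ _ → ≈ᴹ-refl)) z)
    (λ a → lc a b ≟ᵥ v)

  isBasis? : ∀ u {d} (b : Fin d → Carrierᴹ) → Dec (IsBasis u b)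
  isBasis? u b = all? (λ j → b j ∈ᵥ? u) ×-dec (independent? b ×-dec
    allVec? (λ e h w∈ → let (a , z) = h (∈ᵥ-resp (≈ᴹ-sym e) w∈) in a , ≈ᴹ-trans z e)
            (λ v → (v ∈ᵥ? u) →-dec inSpan? b v))

  isBasis-resp : ∀ {u d} {b b′ : Fin d → Carrierᴹ} → (∀ j → b j ≈ᴹ b′ j) →
                 IsBasis u b → IsBasis u b′
  isBasis-resp e (b∈ , ind , span)
    = (λ j → ∈ᵥ-resp (e j) (b∈ j))
    , (λ a z → ind a (≈ᴹ-trans (lc-cong (λ _ → F.refl) e) z))
    , (λ v v∈ → let (a , z) = span v v∈ in
        a , ≈ᴹ-trans (lc-cong (λ _ → F.refl) (λ j → ≈ᴹ-sym (e j))) z)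

  hasDim? : ∀ u d → Dec (HasDim u d)
  hasDim? u d = map′ (λ (k , p) → vec ∘ finToFun k , p) from
                     (any? {n = (q ℕ.^ N) ℕ.^ d} (λ k → isBasis? u (vec ∘ finToFun k)))
    where
    from : HasDim u d → ∃[ k ] IsBasis u (vec ∘ finToFun k)
    from (b , isB) = funToFin i , isBasis-resp
        (λ j → ≈ᴹ-sym (≈ᴹ-trans (≡⇒≈ (finToFun-funToFin i j)) (proj₂ (vec-onto (b j))))) isB
      where
      i : Fin d → Fin (q ℕ.^ N)
      i j = proj₁ (vec-onto (b j))
      ≡⇒≈ : ∀ {k l} → k ≡ l → vec k ≈ᴹ vec l
      ≡⇒≈ ≡.refl = ≈ᴹ-refl

  isSubspace? : Decidable IsSubspace
  isSubspace? u = map′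
    (λ (z , p , s) → record { 0∈ = z ; +-closed = λ {v} {w} → p v w ; *-closed = λ a {v} → s v (λ _ → a) })
    (λ h → let open IsSubspace h in
           0∈ , (λ _ _ → +-closed) , (λ _ a → *-closed (a zero)))
    ((0ᴹ ∈ᵥ? u) ×-dec
     (allVec? (λ e h w v∈ w∈ → ∈ᵥ-resp (+ᴹ-cong e ≈ᴹ-refl) (h w (∈ᵥ-resp (≈ᴹ-sym e) v∈) w∈))
       (λ v → allVec? (λ e h v∈ w∈ → ∈ᵥ-resp (+ᴹ-cong ≈ᴹ-refl e) (h v∈ (∈ᵥ-resp (≈ᴹ-sym e) w∈)))
         (λ w → (v ∈ᵥ? u) →-dec ((w ∈ᵥ? u) →-dec ((v +ᴹ w) ∈ᵥ? u)))) ×-dec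
      allVec? (λ e h a v∈ → ∈ᵥ-resp (*ₗ-cong F.refl e) (h a (∈ᵥ-resp (≈ᴹ-sym e) v∈)))
       (λ v → allCoeff? {d = 1} (λ e h v∈ → ∈ᵥ-resp (*ₗ-cong (e zero) ≈ᴹ-refl) (h v∈))
         (λ a → (v ∈ᵥ? u) →-dec ((a zero *ₗ v) ∈ᵥ? u)))))

  _covers?_ : ∀ v u → Dec (v Covers u)
  v covers? u = (u ⊆? v) ×-dec any? (λ n → hasDim? u (toℕ n) ×-dec hasDim? v (suc (toℕ n)))

  allSubsets : ∀ n → List (Subset n)
  allSubsets zero    = [] ∷ []
  allSubsets (suc n) = map (outside ∷_) (allSubsets n) ++ map (inside ∷_) (allSubsets n)

  subspaces : List VectorSet
  subspaces = filter isSubspace? (allSubsets (q ℕ.^ N))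

module GrassmannGraph {c ℓ q N m ℓm r ℓ₁ ℓ₂ ℓ₃}
  (ℝ : RealField r ℓ₁ ℓ₂ ℓ₃)
  (𝔽 : FiniteField c ℓ q) (𝒱 : VectorSpace 𝔽 N m ℓm)
  (D : ℕ) (1≤D : 1 ℕ.≤ D) (2D<N : 2 ℕ.* D ℕ.< N) where
  open ComplexLinearAlgebra ℝ public
  open Subspaces 𝔽 𝒱 public

  vertices : List VectorSet
  vertices = filter (λ u → hasDim? u D) subspaces

  ∣X∣ : ℕ
  ∣X∣ = length vertices

  X : Set
  X = Fin ∣X∣

  ⟦_⟧ : X → VectorSet
  ⟦ y ⟧ = lookup vertices y

  Adjacent : Rel X (c ⊔ ℓ ⊔ m ⊔ ℓm)
  Adjacent y z = HasDim (⟦ y ⟧ ∩ ⟦ z ⟧) (D ℕ.∸ 1)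

  adjacent? : ∀ y z → Dec (Adjacent y z)
  adjacent? y z = hasDim? (⟦ y ⟧ ∩ ⟦ z ⟧) (D ℕ.∸ 1)

  adjacencyMatrix : Matrix ∣X∣
  adjacencyMatrix y z = if does (adjacent? y z) then 1# else 0#

  -- the index of θ₁ in θ₀ > θ₁ > ⋯ > θ_D
  first : Fin (suc D)
  first = fromℕ< (s≤s 1≤D)

  dualAdjacencyMatrix : (E₁ : Matrix ∣X∣) (x : X) → Matrix ∣X∣
  dualAdjacencyMatrix E₁ x y z = if does (y Fin.≟ z) then ⌜ ∣X∣ ⌝ * E₁ x y else 0#

  infix 10 _^∨
  _^∨ : VectorSet → Vector ∣X∣
  α ^∨ = sumOver (λ y → α ⊆? ⟦ y ⟧) unit

  coverSum : (x : X) (α : VectorSet) → Vector ∣X∣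
  coverSum x α = sumOver (λ g → (γ g ⊆? ⟦ x ⟧) ×-dec (γ g covers? α)) (λ g → γ g ^∨)
    where
    γ : Fin (length subspaces) → VectorSet
    γ = lookup subspaces

  instance
    q≢0 : NonZero q
    q≢0 = ℕ.>-nonZero (ℕ.<-trans (s≤s z≤n) (FiniteField.1<q 𝔽))

    q∸1≢0 : NonZero (q ℕ.∸ 1)
    q∸1≢0 = ℕ.>-nonZero (ℕ.m<n⇒0<n∸m (FiniteField.1<q 𝔽))

  -- (q^n - 1)/(q - 1) is a natural number, so the truncated operations are exact.
  [_] : ℕ → ℕ
  [ n ] = (q ℕ.^ n ℕ.∸ 1) ℕ./ (q ℕ.∸ 1)

  []≢0 : ∀ {n} → 1 ℕ.≤ n → NonZero [ n ]
  []≢0 {suc n} _ = ℕ.>-nonZero (ℕ.m≥n⇒m/n>0 (ℕ.∸-monoˡ-≤ 1 (ℕ.m≤m*n q (q ℕ.^ n) {{ℕ.m^n≢0 q n}})))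

  D<N : D ℕ.< N
  D<N = ℕ.≤-<-trans (ℕ.m≤m+n D (D ℕ.+ 0)) 2D<N

  instance
    [D]≢0 : NonZero [ D ]
    [D]≢0 = []≢0 1≤D

    [N∸D]≢0 : NonZero [ N ℕ.∸ D ]
    [N∸D]≢0 = []≢0 (ℕ.m<n⇒0<n∸m D<N)

    [D][N∸D]≢0 : NonZero ([ D ] ℕ.* [ N ℕ.∸ D ])
    [D][N∸D]≢0 = ℕ.m*n≢0 [ D ] [ N ℕ.∸ D ]

    denominator≢0 : NonZero ((q ℕ.∸ 1) ℕ.* ([ D ] ℕ.* [ N ℕ.∸ D ]))
    denominator≢0 = ℕ.m*n≢0 (q ℕ.∸ 1) ([ D ] ℕ.* [ N ℕ.∸ D ])

  infix 9 q^_
  q^_ : ℤ → ℂ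
  q^ (+ n)    = ⌜ q ℕ.^ n ⌝
  q^ -[1+ n ] = (1 ÷ (q ℕ.^ suc n)) {{ℕ.m^n≢0 q (suc n)}}

  dualEigenvalue : ℕ → ℂ
  dualEigenvalue i =
    - ((q ℕ.* [ N ℕ.∸ 1 ] ℕ.* ([ D ] ℕ.+ [ N ℕ.∸ D ])) ÷ ((q ℕ.∸ 1) ℕ.* ([ D ] ℕ.* [ N ℕ.∸ D ])))
    + ((q ℕ.* [ N ] ℕ.* [ N ℕ.∸ 1 ]) ÷ ((q ℕ.∸ 1) ℕ.* ([ D ] ℕ.* [ N ℕ.∸ D ]))) * q^ (ℤ.- (+ i))

  coverCoefficient : ℕ → ℂ
  coverCoefficient i =
    q^ (ℤ.- (+ D) ℤ.+ + i ℤ.+ + 1) * (([ N ] ℕ.* [ N ℕ.∸ 1 ]) ÷ ([ D ] ℕ.* [ N ℕ.∸ D ]))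

{-# OPTIONS --safe #-}

-- The vectors α^∨ make sense for all subspaces α, and for a vector v let v^∨ be the sum of the ŷ
-- with v ∈ y.  Counting the neighbours of z that contain α gives, for dim α = k,
--   A α^∨ = μ_k α^∨ + [D − k + 1] Σ β^∨   (β a hyperplane of α),
--   μ_k = q [D − k] [N − D] − [k] [D − k + 1].
-- Hence an eigenvector of A for θ that is orthogonal to all β^∨ with dim β = k − 1 is orthogonal to
-- all α^∨ with dim α = k, unless θ = μ_k; for k = D it then vanishes.  Starting at k = 0, this
-- shows that no eigenvalue other than μ_0 exceeds μ_1, so θ₁ = μ_1.  The matrix with entries
-- [N] |y ∩ z| − q^D ([D] + [N − D]), a combination of the Gram matrix of the v^∨ and the all-ones
-- matrix, maps into the eigenspace of θ₁.  A multiple P of it agrees with the identity on every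
-- eigenvector e, because e − P e is orthogonal to 1 and to all α^∨ with dim α = 1.  Thus E₁ = P,
-- the (y , y)-entry of A* depends only on dim (x ∩ y), and the statement is the count
-- [dim (x ∩ y) − dim α] of the γ ⊆ x ∩ y that cover α.
module Submission where

-- Equality in ℝ is undecidable, so "θ ≠ μ_k" is used as a cancellation property of θ - μ_k. It is
-- obtained either from the invertibility of positive integers or from the inverse of a difference
-- of apart reals. To keep those integers visible, μ_k is carried as a pair of naturals `main k`,
-- `shift k`, and the counting identities are written with every negative term moved to the other
-- side. For the combinatorics, a subspace of dimension d is a flat set with q ^ d elements. All
-- counts then take place among finite sets, and linear algebra enters through intersections and
-- joins with a single vector. The equality E₁ = P comes from evaluating P E₁ twice. P is real and
-- symmetric with columns in the eigenspace, so orthogonality gives P E₁ = P; and P fixes the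
-- eigenspace, so P E₁ = E₁.

-- Counting in finite index sets

module Counting where

  import Algebra.Properties.Semiring.Sum as SemiringSum
  open import Data.Bool.Base using (if_then_else_)
  open import Data.Fin.Base using (Fin; zero; suc)
  import Data.Fin.Properties as Fin
  open import Data.Nat.Base
  open import Data.Nat.Properties
  open import Data.Product.Base using (_×_; _,_; proj₁; proj₂)
  open import Data.Unit.Base using (tt)
  open import Function.Base using (_∘_)
  open import Level using (Level)
  open import Relation.Binary.PropositionalEquality
  open import Relation.Nullary using (¬_; Dec; yes; no; does; contradiction; ¬?)
  open import Relation.Nullary.Decidable using (_×-dec_; dec-true; dec-false)
  open import Relation.Unary using (Pred; Decidable)

  open SemiringSum +-*-semiring public
    using (sum; sum-cong-≗; ∑-distrib-+; ∑-comm; *-distribˡ-sum; *-distribʳ-sum; sum-replicate-zero)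

  private variable
    a b p r s : Level
    m n : ℕ

  𝟙 : {A : Set a} → Dec A → ℕ
  𝟙 A? = if does A? then 1 else 0

  𝟙-yes : {A : Set a} (A? : Dec A) → A → 𝟙 A? ≡ 1
  𝟙-yes A? x rewrite dec-true A? x = refl

  𝟙-no : {A : Set a} (A? : Dec A) → ¬ A → 𝟙 A? ≡ 0
  𝟙-no A? ¬x rewrite dec-false A? ¬x = refl

  𝟙-cong : {A : Set a} {B : Set b} (A? : Dec A) (B? : Dec B) → (A → B) → (B → A) → 𝟙 A? ≡ 𝟙 B?
  𝟙-cong (yes x) B? to from = sym (𝟙-yes B? (to x))
  𝟙-cong (no ¬x) B? to from = sym (𝟙-no B? (¬x ∘ from))

  𝟙-× : {A : Set a} {B : Set b} (A? : Dec A) (B? : Dec B) → 𝟙 (A? ×-dec B?) ≡ 𝟙 A? * 𝟙 B?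
  𝟙-× (yes _) (yes _) = refl
  𝟙-× (yes _) (no _)  = refl
  𝟙-× (no _)  _       = refl

  ∑0≡0 : (f : Fin n → ℕ) → (∀ i → f i ≡ 0) → sum f ≡ 0
  ∑0≡0 {n} f f≡0 = trans (sum-cong-≗ f≡0) (sum-replicate-zero n)

  count : {P : Pred (Fin n) p} → Decidable P → ℕ
  count P? = sum (λ i → 𝟙 (P? i))

  module _ {P : Pred (Fin n) p} {Q : Pred (Fin n) r} (P? : Decidable P) (Q? : Decidable Q) where

    count-cong : (∀ i → P i → Q i) → (∀ i → Q i → P i) → count P? ≡ count Q?
    count-cong to from = sum-cong-≗ (λ i → 𝟙-cong (P? i) (Q? i) (to i) (from i))

    count-⊎ : {R : Pred (Fin n) s} (R? : Decidable R) →
              (∀ i → R i → ¬ P i → Q i) → (∀ i → P i → R i × ¬ Q i) → (∀ i → Q i → R i) →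
              count R? ≡ count P? + count Q?
    count-⊎ R? split P⇒ Q⇒ = trans (sum-cong-≗ pointwise) (∑-distrib-+ (λ i → 𝟙 (P? i)) (λ i → 𝟙 (Q? i)))
      where
      pointwise : ∀ i → 𝟙 (R? i) ≡ 𝟙 (P? i) + 𝟙 (Q? i)
      pointwise i with P? i | Q? i
      ... | yes x | yes y = contradiction y (proj₂ (P⇒ i x))
      ... | yes x | no _  = 𝟙-yes (R? i) (proj₁ (P⇒ i x))
      ... | no _  | yes y = 𝟙-yes (R? i) (Q⇒ i y)
      ... | no ¬x | no ¬y = 𝟙-no (R? i) (λ z → ¬y (split i z ¬x))

  count-none : {P : Pred (Fin n) p} (P? : Decidable P) → (∀ i → ¬ P i) → count P? ≡ 0
  count-none P? none = ∑0≡0 _ (λ i → 𝟙-no (P? i) (none i))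

  count-all : ∀ n → count {n} (λ _ → yes tt) ≡ n
  count-all zero    = refl
  count-all (suc n) = cong suc (count-all n)

  count-≡ : (i : Fin n) → count (λ j → j Fin.≟ i) ≡ 1
  count-≡ {suc n} zero = cong suc (∑0≡0 {n} _ (λ i → refl))
  count-≡ (suc i) = trans (sum-cong-≗ (λ j → 𝟙-cong (suc j Fin.≟ suc i) (j Fin.≟ i) Fin.suc-injective (cong suc)))
                          (count-≡ i)

  count-unique : {P : Pred (Fin n) p} (P? : Decidable P) (i : Fin n) → P i → (∀ j → P j → j ≡ i) →
                 count P? ≡ 1
  count-unique P? i Pi uniq = trans (count-cong P? (λ j → j Fin.≟ i) uniq (λ { _ refl → Pi })) (count-≡ i)

  count≡0⇒none : {P : Pred (Fin n) p} (P? : Decidable P) → count P? ≡ 0 → ∀ i → ¬ P i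
  count≡0⇒none {n = suc n} P? c≡0 zero    Pi with P? zero
  ... | no ¬Pi = ¬Pi Pi
  count≡0⇒none {n = suc n} P? c≡0 (suc i) Pi = count≡0⇒none (P? ∘ suc) (m+n≡0⇒n≡0 (𝟙 (P? zero)) c≡0) i Pi

  module _ {P : Pred (Fin n) p} {Q : Pred (Fin n) r} (P? : Decidable P) (Q? : Decidable Q) where

    count-∸ : (∀ i → P i → Q i) → count (λ i → Q? i ×-dec ¬? (P? i)) ≡ count Q? ∸ count P?
    count-∸ P⊆Q = sym (trans
      (cong (_∸ count P?) (count-⊎ P? (λ i → Q? i ×-dec ¬? (P? i)) Q?
        (λ i y ¬x → y , ¬x) (λ i x → P⊆Q i x , λ (_ , ¬x) → ¬x x) (λ _ → proj₁)))
      (m+n∸m≡n (count P?) _))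

    count-mono-≤ : (∀ i → P i → Q i) → count P? ≤ count Q?
    count-mono-≤ P⊆Q = subst (count P? ≤_)
      (sym (count-⊎ P? (λ i → Q? i ×-dec ¬? (P? i)) Q?
        (λ i y ¬x → y , ¬x) (λ i x → P⊆Q i x , λ (_ , ¬x) → ¬x x) (λ _ → proj₁)))
      (m≤m+n (count P?) _)

    count-⊇ : (∀ i → P i → Q i) → count P? ≡ count Q? → ∀ i → Q i → P i
    count-⊇ P⊆Q eq i Qi with P? i
    ... | yes Pi = Pi
    ... | no ¬Pi = contradiction (Qi , ¬Pi)
      (count≡0⇒none (λ i → Q? i ×-dec ¬? (P? i))
        (trans (count-∸ P⊆Q) (m≤n⇒m∸n≡0 (≤-reflexive (sym eq)))) i)

  -- Both products are the total number of related pairs: as `R` holds only on P × Q, rows outside P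
  -- and columns outside Q are empty. The indices can therefore range over all of `Fin m` and
  -- `Fin n`, without subtypes.
  double-count : ∀ {P : Pred (Fin m) p} {Q : Pred (Fin n) r} {R : Fin m → Pred (Fin n) s}
    (P? : Decidable P) (Q? : Decidable Q) (R? : ∀ i → Decidable (R i)) (a b : ℕ) →
    (∀ i j → R i j → P i × Q j) →
    (∀ i → P i → count (R? i) ≡ a) → (∀ j → Q j → count (λ i → R? i j) ≡ b) →
    count P? * a ≡ count Q? * b
  double-count {m = m} {n = n} {P = P} {Q = Q} P? Q? R? a b R⇒ rows columns = begin
    count P? * a                            ≡⟨ *-distribʳ-sum a (λ i → 𝟙 (P? i)) ⟩
    sum (λ i → 𝟙 (P? i) * a)                ≡⟨ sum-cong-≗ row ⟩
    sum (λ i → count (R? i))                ≡⟨ ∑-comm (λ i j → 𝟙 (R? i j)) ⟩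
    sum (λ j → count (λ i → R? i j))        ≡⟨ sum-cong-≗ column ⟨
    sum (λ j → 𝟙 (Q? j) * b)                ≡⟨ *-distribʳ-sum b (λ j → 𝟙 (Q? j)) ⟨
    count Q? * b                            ∎
    where
    open ≡-Reasoning
    row : ∀ i → 𝟙 (P? i) * a ≡ count (R? i)
    row i with P? i
    ... | yes x = trans (*-identityˡ a) (sym (rows i x))
    ... | no ¬x = sym (count-none (R? i) (λ j z → ¬x (proj₁ (R⇒ i j z))))
    column : ∀ j → 𝟙 (Q? j) * b ≡ count (λ i → R? i j)
    column j with Q? j
    ... | yes y = trans (*-identityˡ b) (sym (columns j y))
    ... | no ¬y = sym (count-none (λ i → R? i j) (λ i z → ¬y (proj₂ (R⇒ i j z))))

  -- The bijection is given by its graph `R`, with one partner in each row and in each column; this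
  -- is `double-count` with both constants equal to 1.
  bijection-count : ∀ {P : Pred (Fin m) p} {Q : Pred (Fin n) r} {R : Fin m → Pred (Fin n) s}
    (P? : Decidable P) (Q? : Decidable Q) (R? : ∀ i → Decidable (R i)) →
    (∀ i j → R i j → P i × Q j) →
    (∀ i → P i → count (R? i) ≡ 1) → (∀ j → Q j → count (λ i → R? i j) ≡ 1) →
    count P? ≡ count Q?
  bijection-count P? Q? R? R⇒ rows columns = begin
    count P?     ≡⟨ *-identityʳ _ ⟨
    count P? * 1 ≡⟨ double-count P? Q? R? 1 1 R⇒ rows columns ⟩
    count Q? * 1 ≡⟨ *-identityʳ _ ⟩
    count Q?     ∎
    where open ≡-Reasoning

-- Counting subspaces between two given subspaces

module SubspaceCounts where

  import Data.Bool.Properties as Bool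
  open import Data.Fin.Base using (Fin)
  import Data.Fin.Properties as Fin
  open import Data.Fin.Subset using (Subset; _∈_; _∉_; _⊆_; _∩_; ⊤)
  open import Data.Fin.Subset.Properties using (_∈?_; _⊆?_; ⊆⊤; ⊆-antisym; ⊆-refl; ⊆-trans; p∩q⊆p; p∩q⊆q; x∈p∩q⁺; ∩-comm; ∩-idem)
  open import Data.Nat.Base
  open import Data.Nat.DivMod using (_/_; m*n/n≡m)
  open import Data.Nat.Properties
  open import Data.Nat.Tactic.RingSolver using (solve-∀)
  open import Data.Product.Base using (∃-syntax; _×_; _,_; proj₁; proj₂)
  open import Data.Sum.Base using (inj₁; inj₂)
  import Data.Vec.Properties as Vec
  open import Function.Base using (_∘_)
  open import Level using (Level) renaming (suc to lsuc)
  open import Relation.Binary.Definitions using (tri<; tri≈; tri>)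
  open import Relation.Binary.PropositionalEquality
  open import Relation.Nullary using (¬_; Dec; yes; no; contradiction; ¬?)
  open import Relation.Nullary.Decidable using (_×-dec_; decidable-stable)
  open import Relation.Unary using (Pred; Decidable)
  open Counting

  infix 4 _≟ˢ_
  _≟ˢ_ : ∀ {n} (u w : Subset n) → Dec (u ≡ w)
  _≟ˢ_ = Vec.≡-dec Bool._≟_

  ∥_∥ : ∀ {n} → Subset n → ℕ
  ∥ u ∥ = count (_∈? u)

  ∩-greatest : ∀ {n} {u v w : Subset n} → u ⊆ v → u ⊆ w → u ⊆ v ∩ w
  ∩-greatest u⊆v u⊆w k∈u = x∈p∩q⁺ (u⊆v k∈u , u⊆w k∈u)

  ⊆⇒∩≡ : ∀ {n} {u w : Subset n} → u ⊆ w → u ∩ w ≡ u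
  ⊆⇒∩≡ {u = u} {w} u⊆w = ⊆-antisym (p∩q⊆p u w) (∩-greatest ⊆-refl u⊆w)

  ⊈⇒∃ : ∀ {n} {u w : Subset n} → ¬ u ⊆ w → ∃[ k ] k ∈ u × k ∉ w
  ⊈⇒∃ {u = u} {w} u⊈w with Fin.any? (λ k → (k ∈? u) ×-dec ¬? (k ∈? w))
  ... | yes found = found
  ... | no none = contradiction (λ {k} k∈u → decidable-stable (k ∈? w) (λ k∉w → none (k , k∈u , k∉w))) u⊈w

  ∥∥-mono-≤ : ∀ {n} {u w : Subset n} → u ⊆ w → ∥ u ∥ ≤ ∥ w ∥
  ∥∥-mono-≤ {u = u} {w} u⊆w = count-mono-≤ (_∈? u) (_∈? w) (λ _ → u⊆w)

  ⊆∧∥∥≡⇒≡ : ∀ {n} {u w : Subset n} → u ⊆ w → ∥ u ∥ ≡ ∥ w ∥ → u ≡ w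
  ⊆∧∥∥≡⇒≡ {u = u} {w} u⊆w eq =
    ⊆-antisym u⊆w (λ {k} → count-⊇ (_∈? u) (_∈? w) (λ _ → u⊆w) eq k)

  -- The q-integer (q^n - 1)/(q - 1) in Horner form, free of subtraction and division.
  bracket : ℕ → ℕ → ℕ
  bracket q zero    = 0
  bracket q (suc n) = 1 + q * bracket q n

  bracket-+ : ∀ q m n → bracket q (m + n) ≡ bracket q m + q ^ m * bracket q n
  bracket-+ q zero    n = sym (+-identityʳ _)
  bracket-+ q (suc m) n = begin
    1 + q * bracket q (m + n)                         ≡⟨ cong (λ t → 1 + q * t) (bracket-+ q m n) ⟩
    1 + q * (bracket q m + q ^ m * bracket q n)       ≡⟨ lemma q (bracket q m) (q ^ m) (bracket q n) ⟩
    1 + q * bracket q m + q * q ^ m * bracket q n     ∎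
    where
    open ≡-Reasoning
    lemma : ∀ q a b c → 1 + q * (a + b * c) ≡ 1 + q * a + q * b * c
    lemma = solve-∀

  bracket-suc : ∀ q n → bracket q (suc n) ≡ bracket q n + q ^ n
  bracket-suc q n = begin
    bracket q (suc n)                   ≡⟨ cong (bracket q) (+-comm 1 n) ⟩
    bracket q (n + 1)                   ≡⟨ bracket-+ q n 1 ⟩
    bracket q n + q ^ n * bracket q 1   ≡⟨ cong (λ t → bracket q n + q ^ n * suc t) (*-zeroʳ q) ⟩
    bracket q n + q ^ n * 1             ≡⟨ cong (bracket q n +_) (*-identityʳ (q ^ n)) ⟩
    bracket q n + q ^ n                 ∎
    where open ≡-Reasoning

  [q-1]*bracket : ∀ p n → p * bracket (suc p) n + 1 ≡ suc p ^ n
  [q-1]*bracket p zero    = cong (_+ 1) (*-zeroʳ p)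
  [q-1]*bracket p (suc n) = trans (lemma p (bracket (suc p) n)) (cong (suc p *_) ([q-1]*bracket p n))
    where
    lemma : ∀ p b → p * (1 + suc p * b) + 1 ≡ suc p * (p * b + 1)
    lemma = solve-∀

  -- With q = `suc p`, this evaluates the number of vectors of a (k + j)-dimensional space that lie
  -- outside a given k-dimensional subspace.
  ^-∸ : ∀ p k j → suc p ^ (k + j) ∸ suc p ^ k ≡ suc p ^ k * p * bracket (suc p) j
  ^-∸ p k j = begin
    suc p ^ (k + j) ∸ suc p ^ k                                        ≡⟨ cong (_∸ suc p ^ k) (^-distribˡ-+-* (suc p) k j) ⟩
    suc p ^ k * suc p ^ j ∸ suc p ^ k                                  ≡⟨ cong (λ t → suc p ^ k * t ∸ suc p ^ k) ([q-1]*bracket p j) ⟨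
    suc p ^ k * (p * bracket (suc p) j + 1) ∸ suc p ^ k                ≡⟨ cong (_∸ suc p ^ k) (lemma (suc p ^ k) p _) ⟩
    suc p ^ k * p * bracket (suc p) j + suc p ^ k ∸ suc p ^ k          ≡⟨ m+n∸n≡m _ (suc p ^ k) ⟩
    suc p ^ k * p * bracket (suc p) j                                  ∎
    where
    open ≡-Reasoning
    lemma : ∀ a p b → a * (p * b + 1) ≡ a * p * b + a
    lemma = solve-∀

  ^-injectiveʳ : ∀ {q m n} → 1 < q → q ^ m ≡ q ^ n → m ≡ n
  ^-injectiveʳ {q} {m} {n} 1<q eq with <-cmp m n
  ... | tri< m<n _ _ = contradiction eq (<⇒≢ (^-monoʳ-< q 1<q m<n))
  ... | tri≈ _ m≡n _ = m≡n
  ... | tri> _ _ n<m = contradiction (sym eq) (<⇒≢ (^-monoʳ-< q 1<q n<m))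

  ^-cancelʳ-≤ : ∀ {q m n} → 1 < q → q ^ m ≤ q ^ n → m ≤ n
  ^-cancelʳ-≤ {q} {m} {n} 1<q le with m ≤? n
  ... | yes m≤n = m≤n
  ... | no m≰n = contradiction le (<⇒≱ (^-monoʳ-< q 1<q (≰⇒> m≰n)))

  -- The subspaces of a vector space of dimension N over a field with q elements,
  -- seen as subsets of the set of its V = q ^ N vectors.
  record SubspaceGeometry (σ : Level) (q N V : ℕ) : Set (lsuc σ) where
    field
      1<q          : 1 < q
      Flat         : Pred (Subset V) σ
      𝟎            : Subset V
      𝟎-flat       : Flat 𝟎
      ∥𝟎∥≡1        : ∥ 𝟎 ∥ ≡ 1
      𝟎⊆           : ∀ {u} → Flat u → 𝟎 ⊆ u
      ⊤-flat       : Flat ⊤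
      ∥⊤∥          : ∥ ⊤ {V} ∥ ≡ q ^ N
      ∩-flat       : ∀ {u w} → Flat u → Flat w → Flat (u ∩ w)
      cardinality  : ∀ {u} → Flat u → ∃[ d ] ∥ u ∥ ≡ q ^ d
      join         : Subset V → Fin V → Subset V
      join-flat    : ∀ {u k} → Flat u → Flat (join u k)
      ⊆-join       : ∀ {u k} → Flat u → u ⊆ join u k
      ∈-join       : ∀ {u k} → Flat u → k ∈ join u k
      join-least   : ∀ {u k w} → Flat w → u ⊆ w → k ∈ w → join u k ⊆ w
      ∥join∥       : ∀ {u k} → Flat u → k ∉ u → ∥ join u k ∥ ≡ q * ∥ u ∥
      join-modular : ∀ {u k w} → Flat u → Flat w → k ∈ w → w ⊆ join u k → w ⊆ join (w ∩ u) k
      s            : ℕ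
      γ            : Fin s → Subset V
      γ-flat       : ∀ g → Flat (γ g)
      γ-injective  : ∀ {g h} → γ g ≡ γ h → g ≡ h
      γ-onto       : ∀ {u} → Flat u → ∃[ g ] γ g ≡ u

  module Counts {σ} {p N V} (G : SubspaceGeometry σ (suc p) N V) where
    open SubspaceGeometry G public

    q : ℕ
    q = suc p

    br : ℕ → ℕ
    br = bracket q

    instance
      p≢0 : NonZero p
      p≢0 = >-nonZero (s≤s⁻¹ 1<q)

      q^≢0 : ∀ {k} → NonZero (q ^ k)
      q^≢0 {k} = m^n≢0 q k

      q^*p≢0 : ∀ {k} → NonZero (q ^ k * p)
      q^*p≢0 {k} = m*n≢0 (q ^ k) p {{q^≢0 {k}}}

    -- Dimension is encoded by cardinality: it can be tested by an equality in ℕ, and an inclusion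
    -- between spaces of equal dimension becomes an equality by counting. For actual vector spaces,
    -- `HasDim⇒∥∥` and `∥∥⇒HasDim` relate it to bases.
    record Dim (u : Subset V) (d : ℕ) : Set σ where
      constructor isDim
      field
        flat : Flat u
        card : ∥ u ∥ ≡ q ^ d
    open Dim public

    Dim-≤ : ∀ {u w a b} → Dim u a → Dim w b → u ⊆ w → a ≤ b
    Dim-≤ (isDim _ eq) (isDim _ eq′) u⊆w = ^-cancelʳ-≤ 1<q (subst₂ _≤_ eq eq′ (∥∥-mono-≤ u⊆w))

    Dim-≡ : ∀ {u w d} → Dim u d → Dim w d → u ⊆ w → u ≡ w
    Dim-≡ (isDim _ eq) (isDim _ eq′) u⊆w = ⊆∧∥∥≡⇒≡ u⊆w (trans eq (sym eq′))

    join-dim : ∀ {u d k} → Dim u d → k ∉ u → Dim (join u k) (suc d)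
    join-dim (isDim U eq) k∉u = isDim (join-flat U) (trans (∥join∥ U k∉u) (cong (q *_) eq))

    𝟎-dim : Dim 𝟎 0
    𝟎-dim = isDim 𝟎-flat ∥𝟎∥≡1

    ⊤-dim : Dim ⊤ N
    ⊤-dim = isDim ⊤-flat ∥⊤∥

    count-γ≡ : ∀ {u} → Flat u → count (λ g → γ g ≟ˢ u) ≡ 1
    count-γ≡ U with γ-onto U
    ... | g , refl = count-unique (λ h → γ h ≟ˢ γ g) g refl (λ _ → γ-injective)

    Between : Subset V → Subset V → ℕ → Pred (Fin s) _
    Between α z d g = α ⊆ γ g × γ g ⊆ z × ∥ γ g ∥ ≡ q ^ d

    between? : ∀ α z d → Decidable (Between α z d)
    between? α z d g = (α ⊆? γ g) ×-dec (γ g ⊆? z) ×-dec (∥ γ g ∥ ≟ q ^ d)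

    count-between : Subset V → Subset V → ℕ → ℕ
    count-between α z d = count (between? α z d)

    between-self : ∀ {α z k} → Dim α k → α ⊆ z → count-between α z k ≡ 1
    between-self {α} {z} {k} A@(isDim F eq) α⊆z = trans
      (count-cong (between? α z k) (λ g → γ g ≟ˢ α)
        (λ g (α⊆ , _ , e) → sym (Dim-≡ A (isDim (γ-flat g) e) α⊆))
        (λ { g refl → ⊆-refl , α⊆z , eq }))
      (count-γ≡ F)

    count-∖ : ∀ {u w k j} → Dim u k → Dim w (k + j) → u ⊆ w →
              count (λ v → (v ∈? w) ×-dec ¬? (v ∈? u)) ≡ q ^ k * p * br j
    count-∖ {u} {w} {k} {j} (isDim _ eq) (isDim _ eq′) u⊆w = begin
      count (λ v → (v ∈? w) ×-dec ¬? (v ∈? u)) ≡⟨ count-∸ (_∈? u) (_∈? w) (λ _ → u⊆w) ⟩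
      ∥ w ∥ ∸ ∥ u ∥                            ≡⟨ cong₂ _∸_ eq′ eq ⟩
      q ^ (k + j) ∸ q ^ k                      ≡⟨ ^-∸ p k j ⟩
      q ^ k * p * br j                         ∎
      where open ≡-Reasoning

    -- Count in two ways the pairs (y , v) with α ⊆ y ⊆ z, dim y = k + j and v ∈ y ∖ α.
    between-step : ∀ {α z k l} j c → Dim α k → Dim z (k + l) → α ⊆ z →
      (∀ β → Dim β (suc k) → β ⊆ z → count-between β z (k + j) ≡ c) →
      count-between α z (k + j) * br j ≡ br l * c
    between-step {α} {z} {k} {l} j c A Z α⊆z above = *-cancelˡ-≡ _ _ (q ^ k * p) {{q^*p≢0 {k}}} (begin
      q ^ k * p * (count-between α z (k + j) * br j) ≡⟨ lemma₁ (q ^ k * p) (count-between α z (k + j)) (br j) ⟩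
      count-between α z (k + j) * (q ^ k * p * br j) ≡⟨ double-count (between? α z (k + j)) z∖α? R? _ c R⇒ rows columns ⟩
      count z∖α? * c                                 ≡⟨ cong (_* c) (count-∖ A Z α⊆z) ⟩
      q ^ k * p * br l * c                           ≡⟨ *-assoc (q ^ k * p) (br l) c ⟩
      q ^ k * p * (br l * c)                         ∎)
      where
      open ≡-Reasoning
      lemma₁ : ∀ a b c → a * (b * c) ≡ b * (a * c)
      lemma₁ = solve-∀
      z∖α? : Decidable (λ v → v ∈ z × v ∉ α)
      z∖α? v = (v ∈? z) ×-dec ¬? (v ∈? α)
      R? : ∀ g v → Dec (Between α z (k + j) g × v ∈ γ g × v ∉ α)
      R? g v = between? α z (k + j) g ×-dec (v ∈? γ g) ×-dec ¬? (v ∈? α)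
      R⇒ : ∀ g v → Between α z (k + j) g × v ∈ γ g × v ∉ α → Between α z (k + j) g × v ∈ z × v ∉ α
      R⇒ g v (b@(_ , ⊆z , _) , v∈ , v∉) = b , ⊆z v∈ , v∉
      rows : ∀ g → Between α z (k + j) g → count (R? g) ≡ q ^ k * p * br j
      rows g b@(α⊆ , _ , e) = trans
        (count-cong (R? g) (λ v → (v ∈? γ g) ×-dec ¬? (v ∈? α)) (λ _ → proj₂) (λ _ → b ,_))
        (count-∖ A (isDim (γ-flat g) e) α⊆)
      columns : ∀ v → v ∈ z × v ∉ α → count (λ g → R? g v) ≡ c
      columns v (v∈z , v∉α) = trans
        (count-cong (λ g → R? g v) (between? (join α v) z (k + j))
          (λ { g ((α⊆ , ⊆z , e) , v∈ , _) → join-least (γ-flat g) α⊆ v∈ , ⊆z , e })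
          (λ { g (⊇join , ⊆z , e) → (⊆-trans (⊆-join (flat A)) ⊇join , ⊆z , e) , ⊇join (∈-join (flat A)) , v∉α }))
        (above (join α v) (join-dim A v∉α) (join-least (flat Z) α⊆z v∈z))

    -- The case j = 1 of `between-step`: a cover of α is the join of α with any one of its vectors
    -- outside α, so the constant c is 1.
    count-covers : ∀ {α z k l} → Dim α k → Dim z (k + l) → α ⊆ z → count-between α z (suc k) ≡ br l
    count-covers {α} {z} {k} {l} A Z α⊆z = begin
      count-between α z (suc k)         ≡⟨ cong (count-between α z) (+-comm 1 k) ⟩
      count-between α z (k + 1)         ≡⟨ *-identityʳ _ ⟨
      count-between α z (k + 1) * 1     ≡⟨ cong (λ t → count-between α z (k + 1) * suc t) (*-zeroʳ q) ⟨
      count-between α z (k + 1) * br 1  ≡⟨ between-step 1 1 A Z α⊆z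
        (λ β B β⊆z → trans (cong (count-between β z) (+-comm k 1)) (between-self B β⊆z)) ⟩
      br l * 1                          ≡⟨ *-identityʳ _ ⟩
      br l                              ∎
      where open ≡-Reasoning

    -- Induction on `j`, with α replaced by its join with one vector. The induction hypothesis
    -- supplies the constant `br (suc j)` in `between-step`, which is also the multiplier on the
    -- left and cancels.
    count-hyperplanes : ∀ {α z k} j → Dim α k → Dim z (suc (k + j)) → α ⊆ z → count-between α z (k + j) ≡ br (suc j)
    count-hyperplanes {α} {z} {k} zero A Z α⊆z = begin
      count-between α z (k + 0) ≡⟨ cong (count-between α z) (+-identityʳ k) ⟩
      count-between α z k       ≡⟨ between-self A α⊆z ⟩
      1                         ≡⟨ cong suc (*-zeroʳ q) ⟨
      br 1                      ∎
      where open ≡-Reasoning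
    count-hyperplanes {α} {z} {k} (suc j) A Z α⊆z = *-cancelʳ-≡ _ _ (br (suc j))
      (between-step (suc j) (br (suc j)) A (subst (Dim z) (sym (+-suc k (suc j))) Z) α⊆z
        (λ β B β⊆z → trans (cong (count-between β z) (+-suc k j))
                           (count-hyperplanes j B (subst (λ t → Dim z (suc t)) (+-suc k j) Z) β⊆z)))

    -- The constant is a Gaussian binomial coefficient, built up by `between-step`. It is quantified
    -- before α because a constant independent of α is what the next `between-step` asks for. The
    -- division is exact as soon as some α exists: the numerator is then the count times
    -- `br (suc j)`.
    containing : ∀ k j l → N ≡ k + l →
      ∃[ c ] (∀ {α} → Dim α k → count-between α ⊤ (k + j) ≡ c)
    containing k zero    l N≡ = 1 , λ {α} A → trans (cong (count-between α ⊤) (+-identityʳ k)) (between-self A ⊆⊤)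
    containing k (suc j) zero N≡ = 0 , λ {α} A →
      count-none (between? α ⊤ (k + suc j)) (λ g (_ , _ , e) → <⇒≱
        (subst (_< k + suc j) (sym (trans N≡ (+-identityʳ k))) (m<m+n k z<s))
        (Dim-≤ (isDim (γ-flat g) e) ⊤-dim ⊆⊤))
    containing k (suc j) (suc l) N≡ with containing (suc k) j l (trans N≡ (+-suc k l))
    ... | c , above = br (suc l) * c / br (suc j) , λ {α} A → begin
      count-between α ⊤ (k + suc j)                               ≡⟨ m*n/n≡m _ (br (suc j)) ⟨
      count-between α ⊤ (k + suc j) * br (suc j) / br (suc j)     ≡⟨ cong (_/ br (suc j)) (containing-step A above) ⟩
      br (suc l) * c / br (suc j)                                 ∎
      where
      open ≡-Reasoning
      containing-step : ∀ {α} → Dim α k → (∀ {β} → Dim β (suc k) → count-between β ⊤ (suc k + j) ≡ c) →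
        count-between α ⊤ (k + suc j) * br (suc j) ≡ br (suc l) * c
      containing-step A above = between-step (suc j) c A (subst (Dim ⊤) N≡ ⊤-dim) ⊆⊤
        (λ β B _ → trans (cong (count-between β ⊤) (+-suc k j)) (above B))

  -- Neighbours of a vertex that contain a given subspace; here D = `suc d` and N - D = `l`

  module Neighbours {σ} {p N V} (G : SubspaceGeometry σ (suc p) N V)
    (d l : ℕ) (N≡ : N ≡ d + suc l) where
    open Counts G public

    ∩-dim : ∀ {u w} → Flat u → Flat w → ∃[ e ] Dim (u ∩ w) e
    ∩-dim U W with cardinality (∩-flat U W)
    ... | e , eq = e , isDim (∩-flat U W) eq

    ∩-dim-< : ∀ {u w k} → Dim u (suc k) → Flat w → ¬ u ⊆ w → ∃[ e ] Dim (u ∩ w) e × e ≤ k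
    ∩-dim-< {u} {w} U W u⊈w with ∩-dim (flat U) W
    ... | e , E = e , E , s≤s⁻¹ (≤∧≢⇒< (Dim-≤ E U (p∩q⊆p u w))
      (λ { refl → u⊈w (subst (_⊆ w) (Dim-≡ E U (p∩q⊆p u w)) (p∩q⊆q u w)) }))

    -- Distinct spaces of dimension D meet in dimension at most `d`, so a common hyperplane is
    -- already the whole intersection.
    meet-in-hyperplane : ∀ {y z h} → Dim y (suc d) → Dim z (suc d) → y ≢ z → Dim h d → h ⊆ y → h ⊆ z →
      y ∩ z ≡ h
    meet-in-hyperplane {y} {z} Y Z y≢z H h⊆y h⊆z
      with ∩-dim-< Y (flat Z) (λ y⊆z → y≢z (Dim-≡ Y Z y⊆z))
    ... | e , E , e≤d with ≤-antisym e≤d (Dim-≤ H E (∩-greatest h⊆y h⊆z))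
    ... | refl = sym (Dim-≡ H E (∩-greatest h⊆y h⊆z))

    Neighbour : Subset V → Subset V → Pred (Fin s) _
    Neighbour z α g = ∥ γ g ∥ ≡ q ^ suc d × ∥ γ g ∩ z ∥ ≡ q ^ d × α ⊆ γ g

    neighbour? : ∀ z α → Decidable (Neighbour z α)
    neighbour? z α g = (∥ γ g ∥ ≟ q ^ suc d) ×-dec (∥ γ g ∩ z ∥ ≟ q ^ d) ×-dec (α ⊆? γ g)

    neighbours : Subset V → Subset V → ℕ
    neighbours z α = count (neighbour? z α)

    module _ {z} (Z : Dim z (suc d)) where

      meets? : ∀ h → Decidable (λ g → ∥ γ g ∥ ≡ q ^ suc d × γ g ∩ z ≡ h)
      meets? h g = (∥ γ g ∥ ≟ q ^ suc d) ×-dec (γ g ∩ z ≟ˢ h)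

      -- By `count-covers` there are `br (suc l)` spaces of dimension D above h. One of them is z,
      -- and every other one meets z exactly in h, which leaves q [N - D].
      count-meets : ∀ {h} → Dim h d → h ⊆ z → count (meets? h) ≡ q * br l
      count-meets {h} H h⊆z = suc-injective (begin
        1 + count (meets? h)                             ≡⟨ cong (_+ count (meets? h)) (count-γ≡ (flat Z)) ⟨
        count (λ g → γ g ≟ˢ z) + count (meets? h)        ≡⟨ count-⊎ (λ g → γ g ≟ˢ z) (meets? h) (between? h ⊤ (suc d))
          (λ { g (h⊆ , _ , e) γ≢z → e , meet-in-hyperplane (isDim (γ-flat g) e) Z γ≢z H h⊆ h⊆z })
          (λ { g refl → (h⊆z , ⊆⊤ , card Z) , λ (_ , e) →
               contradiction (Dim-≤ Z H (subst (γ g ⊆_) e (∩-greatest ⊆-refl ⊆-refl))) 1+n≰n })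
          (λ { g (e , refl) → p∩q⊆p (γ g) z , ⊆⊤ , e }) ⟨
        count-between h ⊤ (suc d)                        ≡⟨ count-covers H (subst (Dim ⊤) N≡ ⊤-dim) ⊆⊤ ⟩
        br (suc l)                                       ∎)
        where open ≡-Reasoning

      neighbour-meet? : ∀ α g h → Dec (Neighbour z α g × γ h ≡ γ g ∩ z)
      neighbour-meet? α g h = neighbour? z α g ×-dec (γ h ≟ˢ (γ g ∩ z))

      neighbour-meet-rows : ∀ α g → Neighbour z α g → count (neighbour-meet? α g) ≡ 1
      neighbour-meet-rows α g n = trans
        (count-cong (neighbour-meet? α g) (λ h → γ h ≟ˢ (γ g ∩ z)) (λ _ → proj₂) (λ _ → n ,_))
        (count-γ≡ (∩-flat (γ-flat g) (flat Z)))

      -- Group the neighbours y by h = y ∩ z. There are `br j` hyperplanes h of z that contain α,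
      -- and `count-meets` gives the size of each group. For j = 0 the space α is z itself, and no
      -- neighbour contains z.
      neighbours-⊆ : ∀ {α k} j → Dim α k → suc d ≡ k + j → α ⊆ z → neighbours z α ≡ br j * (q * br l)
      neighbours-⊆ {α} {k} zero A d≡ α⊆z = count-none (neighbour? z α) (λ g (_ , e , α⊆) →
        contradiction (Dim-≤ (subst (Dim α) (sym (trans d≡ (+-identityʳ k))) A)
                             (isDim (∩-flat (γ-flat g) (flat Z)) e) (∩-greatest α⊆ α⊆z)) 1+n≰n)
      neighbours-⊆ {α} {k} (suc i) A d≡ α⊆z = begin
        neighbours z α                     ≡⟨ *-identityʳ _ ⟨
        neighbours z α * 1                 ≡⟨ double-count (neighbour? z α) (between? α z d) (neighbour-meet? α) 1 (q * br l)
          (λ g h (n@(_ , e , α⊆) , eq) → n ,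
            subst (α ⊆_) (sym eq) (∩-greatest α⊆ α⊆z) , subst (_⊆ z) (sym eq) (p∩q⊆q (γ g) z) , trans (cong ∥_∥ eq) e)
          (neighbour-meet-rows α) columns ⟩
        count-between α z d * (q * br l)   ≡⟨ cong (λ t → count-between α z t * (q * br l)) d≡k+i ⟩
        count-between α z (k + i) * (q * br l) ≡⟨ cong (_* (q * br l))
          (count-hyperplanes i A (subst (λ t → Dim z (suc t)) d≡k+i Z) α⊆z) ⟩
        br (suc i) * (q * br l)            ∎
        where
        open ≡-Reasoning
        d≡k+i : d ≡ k + i
        d≡k+i = suc-injective (trans d≡ (+-suc k i))
        columns : ∀ h → Between α z d h → count (λ g → neighbour-meet? α g h) ≡ q * br l
        columns h (α⊆ , h⊆z , e) = trans
          (count-cong (λ g → neighbour-meet? α g h) (meets? (γ h))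
            (λ { g ((eg , _) , eq) → eg , sym eq })
            (λ { g (eg , eq) → (eg , trans (cong ∥_∥ eq) e ,
                                 ⊆-trans α⊆ (subst (_⊆ γ g) eq (p∩q⊆p (γ g) z))) , sym eq }))
          (count-meets (isDim (γ-flat h) e) h⊆z)

      -- A neighbour y containing α is recovered from h = y ∩ z as the join of h with a vector of α
      -- outside z. Such y therefore correspond to the hyperplanes of z that contain α ∩ z.
      neighbours-∩ : ∀ {α k} i → Dim α (suc k) → Dim (α ∩ z) k → d ≡ k + i → neighbours z α ≡ br (suc i)
      neighbours-∩ {α} {k} i A A∩Z d≡ = begin
        neighbours z α                ≡⟨ bijection-count (neighbour? z α) (between? (α ∩ z) z d) (neighbour-meet? α)
          (λ g h (n@(_ , e , α⊆) , eq) → n ,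
            subst (α ∩ z ⊆_) (sym eq) (∩-greatest (⊆-trans (p∩q⊆p α z) α⊆) (p∩q⊆q α z)) ,
            subst (_⊆ z) (sym eq) (p∩q⊆q (γ g) z) , trans (cong ∥_∥ eq) e)
          (neighbour-meet-rows α) columns ⟩
        count-between (α ∩ z) z d     ≡⟨ cong (count-between (α ∩ z) z) d≡ ⟩
        count-between (α ∩ z) z (k + i) ≡⟨ count-hyperplanes i A∩Z (subst (λ t → Dim z (suc t)) d≡ Z) (p∩q⊆q α z) ⟩
        br (suc i)                    ∎
        where
        open ≡-Reasoning
        α⊈z : ¬ α ⊆ z
        α⊈z α⊆z = 1+n≰n (Dim-≤ A A∩Z (∩-greatest ⊆-refl α⊆z))
        columns : ∀ h → Between (α ∩ z) z d h → count (λ g → neighbour-meet? α g h) ≡ 1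
        columns h (α∩z⊆h , h⊆z , e) with ⊈⇒∃ α⊈z
        ... | v , v∈α , v∉z = unique (γ-onto (flat Y))
          where
          H : Dim (γ h) d
          H = isDim (γ-flat h) e
          Y : Dim (join (γ h) v) (suc d)
          Y = join-dim H (v∉z ∘ h⊆z)
          v∉α∩z : v ∉ α ∩ z
          v∉α∩z = v∉z ∘ p∩q⊆q α z
          α≡join : join (α ∩ z) v ≡ α
          α≡join = Dim-≡ (join-dim A∩Z v∉α∩z) A (join-least (flat A) (p∩q⊆p α z) v∈α)
          α⊆Y : α ⊆ join (γ h) v
          α⊆Y = subst (_⊆ join (γ h) v) α≡join
            (join-least (flat Y) (⊆-trans α∩z⊆h (⊆-join (flat H))) (∈-join (flat H)))
          Y∩z : join (γ h) v ∩ z ≡ γ h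
          Y∩z = meet-in-hyperplane Y Z (λ eq → v∉z (subst (v ∈_) eq (∈-join (flat H)))) H (⊆-join (flat H)) h⊆z
          unique : ∃[ g ] γ g ≡ join (γ h) v → count (λ g → neighbour-meet? α g h) ≡ 1
          unique (g , γg≡) = count-unique (λ g → neighbour-meet? α g h) g
            (subst (λ y → (∥ y ∥ ≡ q ^ suc d × ∥ y ∩ z ∥ ≡ q ^ d × α ⊆ y) × γ h ≡ y ∩ z) (sym γg≡)
              ((card Y , trans (cong ∥_∥ Y∩z) e , α⊆Y) , sym Y∩z))
            (λ { g′ ((eg , _ , α⊆) , eq) → γ-injective (trans (sym (Dim-≡ Y (isDim (γ-flat g′) eg)
              (join-least (γ-flat g′) (subst (_⊆ γ g′) (sym eq) (p∩q⊆p (γ g′) z)) (α⊆ v∈α)))) (sym γg≡)) })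

      -- A neighbour y containing α is the join of H = y ∩ z with any v ∈ α outside z. The modular
      -- law puts α inside the join of α ∩ H with v, and α ∩ H = α ∩ z, so the codimension of α ∩ z
      -- in α is at most 1.
      neighbour⇒∩-dim : ∀ {α k g} → Dim α (suc k) → ¬ α ⊆ z → Neighbour z α g → Dim (α ∩ z) k
      neighbour⇒∩-dim {α} {k} {g} A α⊈z (eg , e , α⊆) with ⊈⇒∃ α⊈z | ∩-dim-< A (flat Z) α⊈z
      ... | v , v∈α , v∉z | k′ , A∩Z , k′≤k
        with ≤-antisym k′≤k (s≤s⁻¹ (Dim-≤ A (join-dim A∩Z (v∉z ∘ p∩q⊆q α z)) α⊆join))
        where
        H : Dim (γ g ∩ z) d
        H = isDim (∩-flat (γ-flat g) (flat Z)) e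
        v∉H : v ∉ γ g ∩ z
        v∉H = v∉z ∘ p∩q⊆q (γ g) z
        α⊆join-H : α ⊆ join (γ g ∩ z) v
        α⊆join-H = subst (α ⊆_) (sym (Dim-≡ (join-dim H v∉H) (isDim (γ-flat g) eg)
          (join-least (γ-flat g) (p∩q⊆p (γ g) z) (α⊆ v∈α)))) α⊆
        α∩H≡α∩z : α ∩ (γ g ∩ z) ≡ α ∩ z
        α∩H≡α∩z = ⊆-antisym
          (∩-greatest (p∩q⊆p α _) (⊆-trans (p∩q⊆q α _) (p∩q⊆q (γ g) z)))
          (∩-greatest (p∩q⊆p α z) (∩-greatest (⊆-trans (p∩q⊆p α z) α⊆) (p∩q⊆q α z)))
        α⊆join : α ⊆ join (α ∩ z) v
        α⊆join = subst (λ w → α ⊆ join w v) α∩H≡α∩z (join-modular (flat H) (flat A) v∈α α⊆join-H)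
      ... | refl = A∩Z

      -- The number of these g is the value at z of the sum of β^∨ over the hyperplanes β of α.
      facet? : ∀ α k → Decidable (λ g → γ g ⊆ α × γ g ⊆ z × ∥ γ g ∥ ≡ q ^ k)
      facet? α k g = (γ g ⊆? α) ×-dec (γ g ⊆? z) ×-dec (∥ γ g ∥ ≟ q ^ k)

      -- The case distinction is on the codimension 0, 1 or ≥ 2 of α ∩ z in α.
      neighbours-formula : ∀ {α k} i → Dim α (suc k) → d ≡ k + i →
        neighbours z α + br (suc k) * br (suc i) * 𝟙 (α ⊆? z)
          ≡ q * br i * br l * 𝟙 (α ⊆? z) + br (suc i) * count (facet? α k)
      neighbours-formula {α} {k} i A d≡ with α ⊆? z
      ... | yes α⊆z = begin
        neighbours z α + br (suc k) * br (suc i) * 1                    ≡⟨ cong (_+ br (suc k) * br (suc i) * 1) (neighbours-⊆ i A (cong suc d≡) α⊆z) ⟩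
        br i * (q * br l) + br (suc k) * br (suc i) * 1                 ≡⟨ rearrange q (br i) (br l) (br (suc k)) (br (suc i)) ⟩
        q * br i * br l * 1 + br (suc i) * br (suc k)                   ≡⟨ cong (λ t → q * br i * br l * 1 + br (suc i) * t) facets ⟨
        q * br i * br l * 1 + br (suc i) * count (facet? α k)           ∎
        where
        open ≡-Reasoning
        rearrange : ∀ q a b c e → a * (q * b) + c * e * 1 ≡ q * a * b * 1 + e * c
        rearrange = solve-∀
        facets : count (facet? α k) ≡ br (suc k)
        facets = trans (count-cong (facet? α k) (between? 𝟎 α k)
          (λ { g (⊆α , _ , e) → 𝟎⊆ (γ-flat g) , ⊆α , e })
          (λ { g (_ , ⊆α , e) → ⊆α , ⊆-trans ⊆α α⊆z , e }))
          (count-hyperplanes k 𝟎-dim A (𝟎⊆ (flat A)))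
      ... | no α⊈z with ∥ α ∩ z ∥ ≟ q ^ k
      ... | yes e = begin
        neighbours z α + br (suc k) * br (suc i) * 0                    ≡⟨ cong (neighbours z α +_) (*-zeroʳ (br (suc k) * br (suc i))) ⟩
        neighbours z α + 0                                              ≡⟨ +-identityʳ _ ⟩
        neighbours z α                                                  ≡⟨ neighbours-∩ i A A∩Z d≡ ⟩
        br (suc i)                                                      ≡⟨ *-identityʳ _ ⟨
        br (suc i) * 1                                                  ≡⟨ cong (br (suc i) *_) facets ⟨
        br (suc i) * count (facet? α k)                                 ≡⟨ cong (_+ br (suc i) * count (facet? α k)) (*-zeroʳ (q * br i * br l)) ⟨
        q * br i * br l * 0 + br (suc i) * count (facet? α k)           ∎
        where
        open ≡-Reasoning
        A∩Z : Dim (α ∩ z) k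
        A∩Z = isDim (∩-flat (flat A) (flat Z)) e
        facets : count (facet? α k) ≡ 1
        facets = trans (count-cong (facet? α k) (λ g → γ g ≟ˢ (α ∩ z))
          (λ { g (⊆α , ⊆z , e) → Dim-≡ (isDim (γ-flat g) e) A∩Z (∩-greatest ⊆α ⊆z) })
          (λ g eq → subst (λ u → u ⊆ α × u ⊆ z × ∥ u ∥ ≡ q ^ k) (sym eq) (p∩q⊆p α z , p∩q⊆q α z , e)))
          (count-γ≡ (flat A∩Z))
      ... | no ¬e = begin
        neighbours z α + br (suc k) * br (suc i) * 0                    ≡⟨ cong₂ _+_ none (*-zeroʳ (br (suc k) * br (suc i))) ⟩
        0                                                               ≡⟨ cong₂ _+_ (*-zeroʳ (q * br i * br l)) (*-zeroʳ (br (suc i))) ⟨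
        q * br i * br l * 0 + br (suc i) * 0                            ≡⟨ cong (λ t → q * br i * br l * 0 + br (suc i) * t) facets ⟨
        q * br i * br l * 0 + br (suc i) * count (facet? α k)           ∎
        where
        open ≡-Reasoning
        none : neighbours z α ≡ 0
        none = count-none (neighbour? z α) (λ g n → ¬e (card (neighbour⇒∩-dim A α⊈z n)))
        facets : count (facet? α k) ≡ 0
        facets = count-none (facet? α k) λ g (⊆α , ⊆z , e) → low (∩-dim-< A (flat Z) α⊈z) g ⊆α ⊆z e
          where
          -- A hyperplane of α inside z would lie in α ∩ z and give it dimension k, which `¬e`
          -- excludes.
          low : ∃[ k′ ] Dim (α ∩ z) k′ × k′ ≤ k → ∀ g → γ g ⊆ α → γ g ⊆ z → ¬ ∥ γ g ∥ ≡ q ^ k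
          low (k′ , A∩Z , k′≤k) g ⊆α ⊆z e
            with ≤-antisym k′≤k (Dim-≤ (isDim (γ-flat g) e) A∩Z (∩-greatest ⊆α ⊆z))
          ... | refl = ¬e (card A∩Z)

  -- Vertices through a vector, and the Gram matrix |y ∩ z|

  module Points {σ} {p N V} (G : SubspaceGeometry σ (suc p) N V)
    (d l : ℕ) (N≡ : N ≡ d + suc l) where
    open Neighbours G d l N≡ public

    line : Fin V → Subset V
    line v = join 𝟎 v

    line-dim : ∀ {v} → v ∉ 𝟎 → Dim (line v) 1
    line-dim = join-dim 𝟎-dim

    ∈-line : ∀ v → v ∈ line v
    ∈-line v = ∈-join 𝟎-flat

    line⊆ : ∀ {v u} → Flat u → v ∈ u → line v ⊆ u
    line⊆ U = join-least U (𝟎⊆ U)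

    neighbourThrough? : ∀ z v → Decidable (λ g → ∥ γ g ∥ ≡ q ^ suc d × ∥ γ g ∩ z ∥ ≡ q ^ d × v ∈ γ g)
    neighbourThrough? z v g = (∥ γ g ∥ ≟ q ^ suc d) ×-dec (∥ γ g ∩ z ∥ ≟ q ^ d) ×-dec (v ∈? γ g)

    module _ {z} (Z : Dim z (suc d)) where

      -- For v outside 𝟎 this is `neighbours-formula` for the line of v. The zero vector lies in all
      -- q [D] [N - D] neighbours, which exceeds q [D - 1] [N - D] by q^D [N - D]; hence the last
      -- term.
      neighboursThrough : ∀ v →
        count (neighbourThrough? z v) + br (suc d) * 𝟙 (v ∈? z)
          ≡ q * br d * br l * 𝟙 (v ∈? z) + br (suc d) + q ^ suc d * br l * 𝟙 (v ∈? 𝟎)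
      neighboursThrough v with v ∈? 𝟎
      ... | yes v∈𝟎 = begin
        count (neighbourThrough? z v) + br (suc d) * 𝟙 (v ∈? z)           ≡⟨ cong₂ _+_ all (cong (br (suc d) *_) v∈z) ⟩
        br (suc d) * (q * br l) + br (suc d) * 1                          ≡⟨ cong (λ t → t * (q * br l) + br (suc d) * 1) (bracket-suc q d) ⟩
        (br d + q ^ d) * (q * br l) + br (suc d) * 1                      ≡⟨ rearrange q (br d) (q ^ d) (br l) (br (suc d)) ⟩
        q * br d * br l * 1 + br (suc d) + q ^ suc d * br l * 1           ≡⟨ cong (λ t → q * br d * br l * t + br (suc d) + q ^ suc d * br l * 1) v∈z ⟨
        q * br d * br l * 𝟙 (v ∈? z) + br (suc d) + q ^ suc d * br l * 1  ∎
        where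
        open ≡-Reasoning
        rearrange : ∀ q a b c e → (a + b) * (q * c) + e * 1 ≡ q * a * c * 1 + e + q * b * c * 1
        rearrange = solve-∀
        v∈z : 𝟙 (v ∈? z) ≡ 1
        v∈z = 𝟙-yes (v ∈? z) (𝟎⊆ (flat Z) v∈𝟎)
        all : count (neighbourThrough? z v) ≡ br (suc d) * (q * br l)
        all = trans (count-cong (neighbourThrough? z v) (neighbour? z 𝟎)
          (λ g (eg , e , _) → eg , e , 𝟎⊆ (γ-flat g))
          (λ g (eg , e , _) → eg , e , 𝟎⊆ (γ-flat g) v∈𝟎))
          (neighbours-⊆ Z (suc d) 𝟎-dim refl (𝟎⊆ (flat Z)))
      ... | no v∉𝟎 = begin
        count (neighbourThrough? z v) + br (suc d) * 𝟙 (v ∈? z)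
          ≡⟨ cong₂ _+_ neighbours-line (cong (br (suc d) *_) ∈⇔⊆) ⟩
        neighbours z (line v) + br (suc d) * 𝟙 (line v ⊆? z)
          ≡⟨ cong (neighbours z (line v) +_) (rearrange₁ q (br (suc d)) (𝟙 (line v ⊆? z))) ⟩
        neighbours z (line v) + br 1 * br (suc d) * 𝟙 (line v ⊆? z)
          ≡⟨ neighbours-formula Z d (line-dim v∉𝟎) refl ⟩
        q * br d * br l * 𝟙 (line v ⊆? z) + br (suc d) * count (facet? Z (line v) 0)
          ≡⟨ cong₂ _+_ (cong (q * br d * br l *_) (sym ∈⇔⊆)) (cong (br (suc d) *_) facets) ⟩
        q * br d * br l * 𝟙 (v ∈? z) + br (suc d) * 1
          ≡⟨ rearrange₂ (q * br d * br l * 𝟙 (v ∈? z)) (br (suc d)) (q ^ suc d * br l) ⟩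
        q * br d * br l * 𝟙 (v ∈? z) + br (suc d) + q ^ suc d * br l * 0 ∎
        where
        open ≡-Reasoning
        rearrange₁ : ∀ q b t → b * t ≡ (1 + q * 0) * b * t
        rearrange₁ = solve-∀
        rearrange₂ : ∀ a b c → a + b * 1 ≡ a + b + c * 0
        rearrange₂ = solve-∀
        neighbours-line : count (neighbourThrough? z v) ≡ neighbours z (line v)
        neighbours-line = count-cong (neighbourThrough? z v) (neighbour? z (line v))
          (λ { g (eg , e , v∈) → eg , e , line⊆ (γ-flat g) v∈ })
          (λ { g (eg , e , ⊆g) → eg , e , ⊆g (∈-line v) })
        ∈⇔⊆ : 𝟙 (v ∈? z) ≡ 𝟙 (line v ⊆? z)
        ∈⇔⊆ = 𝟙-cong (v ∈? z) (line v ⊆? z) (λ v∈z → line⊆ (flat Z) v∈z) (λ ⊆z → ⊆z (∈-line v))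
        facets : count (facet? Z (line v) 0) ≡ 1
        facets = trans (count-cong (facet? Z (line v) 0) (λ g → γ g ≟ˢ 𝟎)
          (λ { g (_ , _ , e) → sym (Dim-≡ 𝟎-dim (isDim (γ-flat g) e) (𝟎⊆ (γ-flat g))) })
          (λ g eq → subst (λ u → u ⊆ line v × u ⊆ z × ∥ u ∥ ≡ 1) (sym eq)
            (𝟎⊆ (flat (line-dim v∉𝟎)) , 𝟎⊆ (flat Z) , ∥𝟎∥≡1)))
          (count-γ≡ 𝟎-flat)

    ∑ᴰ : (Subset V → ℕ) → ℕ
    ∑ᴰ f = sum (λ g → 𝟙 (∥ γ g ∥ ≟ q ^ suc d) * f (γ g))

    ∥∩∥-sum : ∀ (u x : Subset V) → ∥ u ∩ x ∥ ≡ sum (λ v → 𝟙 (v ∈? x) * 𝟙 (v ∈? u))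
    ∥∩∥-sum u x = sum-cong-≗ (λ v → trans
      (𝟙-cong (v ∈? (u ∩ x)) ((v ∈? x) ×-dec (v ∈? u))
        (λ v∈ → p∩q⊆q u x v∈ , p∩q⊆p u x v∈) (λ (v∈x , v∈u) → x∈p∩q⁺ (v∈u , v∈x)))
      (𝟙-× (v ∈? x) (v ∈? u)))

    ∑ᴰ-∥∩∥ : ∀ (f : Subset V → ℕ) x → ∑ᴰ (λ u → f u * ∥ u ∩ x ∥) ≡ sum (λ v → 𝟙 (v ∈? x) * ∑ᴰ (λ u → f u * 𝟙 (v ∈? u)))
    ∑ᴰ-∥∩∥ f x = begin
      sum (λ g → δ g * (f (γ g) * ∥ γ g ∩ x ∥))
        ≡⟨ sum-cong-≗ (λ g → trans (cong (λ t → δ g * (f (γ g) * t)) (∥∩∥-sum (γ g) x))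
             (trans (sym (*-assoc (δ g) (f (γ g)) _))
                    (*-distribˡ-sum (δ g * f (γ g)) (λ v → 𝟙 (v ∈? x) * 𝟙 (v ∈? γ g))))) ⟩
      sum (λ g → sum (λ v → δ g * f (γ g) * (𝟙 (v ∈? x) * 𝟙 (v ∈? γ g))))
        ≡⟨ ∑-comm (λ g v → δ g * f (γ g) * (𝟙 (v ∈? x) * 𝟙 (v ∈? γ g))) ⟩
      sum (λ v → sum (λ g → δ g * f (γ g) * (𝟙 (v ∈? x) * 𝟙 (v ∈? γ g))))
        ≡⟨ sum-cong-≗ (λ v → trans
             (sum-cong-≗ (λ g → rearrange (δ g) (f (γ g)) (𝟙 (v ∈? x)) (𝟙 (v ∈? γ g))))
             (sym (*-distribˡ-sum (𝟙 (v ∈? x)) (λ g → δ g * (f (γ g) * 𝟙 (v ∈? γ g)))))) ⟩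
      sum (λ v → 𝟙 (v ∈? x) * ∑ᴰ (λ u → f u * 𝟙 (v ∈? u))) ∎
      where
      open ≡-Reasoning
      δ : Fin s → ℕ
      δ g = 𝟙 (∥ γ g ∥ ≟ q ^ suc d)
      rearrange : ∀ a b c e → a * b * (c * e) ≡ c * (a * (b * e))
      rearrange = solve-∀

    adjacent : Subset V → Subset V → ℕ
    adjacent z u = 𝟙 (∥ u ∩ z ∥ ≟ q ^ d)

    ∑ᴰ-adjacent-⊇ : ∀ z α → ∑ᴰ (λ u → adjacent z u * 𝟙 (α ⊆? u)) ≡ neighbours z α
    ∑ᴰ-adjacent-⊇ z α = sym (sum-cong-≗ (λ g → trans
      (𝟙-× (∥ γ g ∥ ≟ q ^ suc d) ((∥ γ g ∩ z ∥ ≟ q ^ d) ×-dec (α ⊆? γ g)))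
      (cong (𝟙 (∥ γ g ∥ ≟ q ^ suc d) *_) (𝟙-× (∥ γ g ∩ z ∥ ≟ q ^ d) (α ⊆? γ g)))))

    ∑ᴰ-adjacent : ∀ {z} → Dim z (suc d) → ∑ᴰ (adjacent z) ≡ br (suc d) * (q * br l)
    ∑ᴰ-adjacent {z} Z = begin
      ∑ᴰ (adjacent z)                          ≡⟨ sum-cong-≗ (λ g → cong (𝟙 (∥ γ g ∥ ≟ q ^ suc d) *_)
        (trans (sym (*-identityʳ _)) (cong (adjacent z (γ g) *_) (sym (𝟙-yes (𝟎 ⊆? γ g) (𝟎⊆ (γ-flat g))))))) ⟩
      ∑ᴰ (λ u → adjacent z u * 𝟙 (𝟎 ⊆? u))     ≡⟨ ∑ᴰ-adjacent-⊇ z 𝟎 ⟩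
      neighbours z 𝟎                           ≡⟨ neighbours-⊆ Z (suc d) 𝟎-dim refl (𝟎⊆ (flat Z)) ⟩
      br (suc d) * (q * br l)                  ∎
      where open ≡-Reasoning

    -- This is `neighboursThrough` summed over v ∈ x. The term constant in v contributes [D] |x| and
    -- the correction at the zero vector contributes q^D [N - D]; together they form ([D] + [N - D])
    -- q^D.
    ∑ᴰ-adjacent-∥∩∥ : ∀ {z x} → Dim z (suc d) → Dim x (suc d) →
      ∑ᴰ (λ u → adjacent z u * ∥ u ∩ x ∥) + br (suc d) * ∥ z ∩ x ∥
        ≡ q * br d * br l * ∥ z ∩ x ∥ + (br (suc d) + br l) * q ^ suc d
    ∑ᴰ-adjacent-∥∩∥ {z} {x} Z X = begin
      ∑ᴰ (λ u → adjacent z u * ∥ u ∩ x ∥) + b * ∥ z ∩ x ∥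
        ≡⟨ cong₂ _+_ (∑ᴰ-∥∩∥ (adjacent z) x) (cong (b *_) (∥∩∥-sum z x)) ⟩
      sum (λ v → [x] v * A v) + b * sum (λ v → [x] v * [z] v)
        ≡⟨ cong (sum (λ v → [x] v * A v) +_) (*-distribˡ-sum b (λ v → [x] v * [z] v)) ⟩
      sum (λ v → [x] v * A v) + sum (λ v → b * ([x] v * [z] v))
        ≡⟨ ∑-distrib-+ (λ v → [x] v * A v) (λ v → b * ([x] v * [z] v)) ⟨
      sum (λ v → [x] v * A v + b * ([x] v * [z] v))
        ≡⟨ sum-cong-≗ pointwise ⟩
      sum (λ v → a * ([x] v * [z] v) + b * [x] v + c * ([𝟎] v))
        ≡⟨ ∑-distrib-+ (λ v → a * ([x] v * [z] v) + b * [x] v) (λ v → c * ([𝟎] v)) ⟩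
      sum (λ v → a * ([x] v * [z] v) + b * [x] v) + sum (λ v → c * ([𝟎] v))
        ≡⟨ cong₂ _+_ (∑-distrib-+ (λ v → a * ([x] v * [z] v)) (λ v → b * [x] v)) (sym (*-distribˡ-sum c [𝟎])) ⟩
      sum (λ v → a * ([x] v * [z] v)) + sum (λ v → b * [x] v) + c * ∥ 𝟎 ∥
        ≡⟨ cong₂ (λ s t → s + t + c * ∥ 𝟎 ∥) (sym (*-distribˡ-sum a (λ v → [x] v * [z] v))) (sym (*-distribˡ-sum b [x])) ⟩
      a * sum (λ v → [x] v * [z] v) + b * ∥ x ∥ + c * ∥ 𝟎 ∥
        ≡⟨ cong (λ t → a * t + b * ∥ x ∥ + c * ∥ 𝟎 ∥) (∥∩∥-sum z x) ⟨
      a * ∥ z ∩ x ∥ + b * ∥ x ∥ + c * ∥ 𝟎 ∥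
        ≡⟨ cong₂ (λ s t → a * ∥ z ∩ x ∥ + b * s + c * t) (card X) ∥𝟎∥≡1 ⟩
      a * ∥ z ∩ x ∥ + b * q ^ suc d + c * 1
        ≡⟨ rearrange (a * ∥ z ∩ x ∥) b (q ^ suc d) (br l) ⟩
      a * ∥ z ∩ x ∥ + (b + br l) * q ^ suc d ∎
      where
      open ≡-Reasoning
      a b c : ℕ
      a = q * br d * br l
      b = br (suc d)
      c = q ^ suc d * br l
      [x] [z] [𝟎] A : Fin V → ℕ
      [x] v = 𝟙 (v ∈? x)
      [z] v = 𝟙 (v ∈? z)
      [𝟎] v = 𝟙 (v ∈? 𝟎)
      A v = ∑ᴰ (λ u → adjacent z u * 𝟙 (v ∈? u))
      rearrange : ∀ t b e l → t + b * e + e * l * 1 ≡ t + (b + l) * e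
      rearrange = solve-∀
      A≡ : ∀ v → A v ≡ count (neighbourThrough? z v)
      A≡ v = sym (sum-cong-≗ (λ g → trans
        (𝟙-× (∥ γ g ∥ ≟ q ^ suc d) ((∥ γ g ∩ z ∥ ≟ q ^ d) ×-dec (v ∈? γ g)))
        (cong (𝟙 (∥ γ g ∥ ≟ q ^ suc d) *_) (𝟙-× (∥ γ g ∩ z ∥ ≟ q ^ d) (v ∈? γ g)))))
      x𝟎 : ∀ v → [x] v * [𝟎] v ≡ [𝟎] v
      x𝟎 v = trans (sym (𝟙-× (v ∈? x) (v ∈? 𝟎)))
        (𝟙-cong ((v ∈? x) ×-dec (v ∈? 𝟎)) (v ∈? 𝟎) proj₂ (λ v∈𝟎 → 𝟎⊆ (flat X) v∈𝟎 , v∈𝟎))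
      lemma₁ : ∀ x A b z → x * A + b * (x * z) ≡ x * (A + b * z)
      lemma₁ = solve-∀
      lemma₂ : ∀ x a z b c o → x * (a * z + b + c * o) ≡ a * (x * z) + b * x + c * (x * o)
      lemma₂ = solve-∀
      pointwise : ∀ v → [x] v * A v + b * ([x] v * [z] v) ≡ a * ([x] v * [z] v) + b * [x] v + c * ([𝟎] v)
      pointwise v = begin
        [x] v * A v + b * ([x] v * [z] v)                         ≡⟨ lemma₁ ([x] v) (A v) b ([z] v) ⟩
        [x] v * (A v + b * [z] v)                                 ≡⟨ cong (λ t → [x] v * (t + b * [z] v)) (A≡ v) ⟩
        [x] v * (count (neighbourThrough? z v) + b * [z] v)       ≡⟨ cong ([x] v *_) (neighboursThrough Z v) ⟩
        [x] v * (a * [z] v + b + c * [𝟎] v)                       ≡⟨ lemma₂ ([x] v) a ([z] v) b c ([𝟎] v) ⟩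
        a * ([x] v * [z] v) + b * [x] v + c * ([x] v * [𝟎] v)     ≡⟨ cong (λ t → a * ([x] v * [z] v) + b * [x] v + c * t) (x𝟎 v) ⟩
        a * ([x] v * [z] v) + b * [x] v + c * [𝟎] v               ∎

    vertexCount : ℕ
    vertexCount = count (λ g → ∥ γ g ∥ ≟ q ^ suc d)

    private
      N≡₁ : N ≡ 1 + (d + l)
      N≡₁ = trans N≡ (+-suc d l)

      line-count : ∃[ N₁ ] (∀ {α} → Dim α 1 → count-between α ⊤ (suc d) ≡ N₁)
      line-count = containing 1 d (d + l) N≡₁

      plane-count : ∃[ N₂ ] (∀ {α} → Dim α 2 → count-between α ⊤ (suc d) ≡ N₂)
      plane-count with d ≟ 0
      -- For D = 1 no vertex contains a plane.
      ... | yes refl = 0 , λ {α} A → count-none (between? α ⊤ 1) (λ g (⊆g , _ , e) →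
        contradiction (Dim-≤ {b = 1} A (isDim (γ-flat g) e) ⊆g) λ { (s≤s ()) })
      ... | no d≢0 with pred d | suc-pred d {{≢-nonZero d≢0}}
      ... | d′ | refl = containing 2 d′ (d′ + l) (trans N≡ (cong suc (+-suc d′ l)))

    -- The numbers of vertices through a non-zero vector and through two independent vectors.
    N₁ N₂ : ℕ
    N₁ = proj₁ line-count
    N₂ = proj₁ plane-count

    -- The instance α = 𝟎 of `between-step`. The companion `N₁-N₂` is the instance α = `line v`, and
    -- so it asks for a vector v outside 𝟎.
    vertexCount-N₁ : vertexCount * br (suc d) ≡ br N * N₁
    vertexCount-N₁ = trans (cong (_* br (suc d)) (count-cong (λ g → ∥ γ g ∥ ≟ q ^ suc d) (between? 𝟎 ⊤ (suc d))
      (λ { g e → 𝟎⊆ (γ-flat g) , ⊆⊤ , e }) (λ _ b → proj₂ (proj₂ b))))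
      (between-step (suc d) N₁ 𝟎-dim ⊤-dim ⊆⊤ (λ _ B _ → proj₂ line-count B))

    module _ {v} (v∉𝟎 : v ∉ 𝟎) where

      N₁-N₂ : N₁ * br d ≡ br (d + l) * N₂
      N₁-N₂ = trans (cong (_* br d) (sym (proj₂ line-count (line-dim v∉𝟎))))
        (between-step d N₂ (line-dim v∉𝟎) (subst (Dim ⊤) N≡₁ ⊤-dim) ⊆⊤ (λ _ B _ → proj₂ plane-count B))

      ∥line∩∥ : ∀ {y} → Flat y → ∥ line v ∩ y ∥ ≡ 1 + p * 𝟙 (v ∈? y)
      ∥line∩∥ {y} Y with v ∈? y
      ... | yes v∈y = begin
        ∥ line v ∩ y ∥  ≡⟨ cong ∥_∥ (⊆⇒∩≡ (line⊆ Y v∈y)) ⟩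
        ∥ line v ∥      ≡⟨ card (line-dim v∉𝟎) ⟩
        q * 1           ≡⟨ *-identityʳ q ⟩
        1 + p           ≡⟨ cong suc (*-identityʳ p) ⟨
        1 + p * 1       ∎
        where open ≡-Reasoning
      ... | no v∉y with ∩-dim-< (line-dim v∉𝟎) Y (λ ⊆y → v∉y (⊆y (∈-line v)))
      ... | zero , E , _ = trans (card E) (cong suc (sym (*-zeroʳ p)))

      -- Count the pairs of a vertex u and a vector w ∈ u ∩ y with v ∈ u. A vector w of y lies
      -- together with v in N₁ vertices if it is on the line of v, and in N₂ otherwise; `∥line∩∥`
      -- tells how many w are of the first kind.
      ∑ᴰ-∋-∥∩∥ : ∀ {y} → Dim y (suc d) →
        ∑ᴰ (λ u → 𝟙 (v ∈? u) * ∥ u ∩ y ∥) + N₂ * (1 + p * 𝟙 (v ∈? y)) ≡ N₁ * (1 + p * 𝟙 (v ∈? y)) + N₂ * q ^ suc d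
      ∑ᴰ-∋-∥∩∥ {y} Y = begin
        ∑ᴰ (λ u → 𝟙 (v ∈? u) * ∥ u ∩ y ∥) + N₂ * (1 + p * 𝟙 (v ∈? y))
          ≡⟨ cong₂ (λ s t → s + N₂ * t) (∑ᴰ-∥∩∥ (λ u → 𝟙 (v ∈? u)) y) (trans (sym (∥line∩∥ (flat Y))) (∥∩∥-sum (line v) y)) ⟩
        sum (λ w → [y] w * M w) + N₂ * sum (λ w → [y] w * [L] w)
          ≡⟨ cong (sum (λ w → [y] w * M w) +_) (*-distribˡ-sum N₂ (λ w → [y] w * [L] w)) ⟩
        sum (λ w → [y] w * M w) + sum (λ w → N₂ * ([y] w * [L] w))
          ≡⟨ ∑-distrib-+ (λ w → [y] w * M w) (λ w → N₂ * ([y] w * [L] w)) ⟨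
        sum (λ w → [y] w * M w + N₂ * ([y] w * [L] w))
          ≡⟨ sum-cong-≗ (λ w → trans (lemma₁ ([y] w) (M w) N₂ ([L] w))
               (trans (cong ([y] w *_) (pointwise w)) (lemma₂ ([y] w) N₁ ([L] w) N₂))) ⟩
        sum (λ w → N₁ * ([y] w * [L] w) + N₂ * [y] w)
          ≡⟨ ∑-distrib-+ (λ w → N₁ * ([y] w * [L] w)) (λ w → N₂ * [y] w) ⟩
        sum (λ w → N₁ * ([y] w * [L] w)) + sum (λ w → N₂ * [y] w)
          ≡⟨ cong₂ _+_ (*-distribˡ-sum N₁ (λ w → [y] w * [L] w)) (*-distribˡ-sum N₂ [y]) ⟨
        N₁ * sum (λ w → [y] w * [L] w) + N₂ * ∥ y ∥
          ≡⟨ cong₂ (λ s t → N₁ * s + N₂ * t) (trans (sym (∥∩∥-sum (line v) y)) (∥line∩∥ (flat Y))) (card Y) ⟩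
        N₁ * (1 + p * 𝟙 (v ∈? y)) + N₂ * q ^ suc d ∎
        where
        open ≡-Reasoning
        [y] [L] M : Fin V → ℕ
        [y] w = 𝟙 (w ∈? y)
        [L] w = 𝟙 (w ∈? line v)
        M w = ∑ᴰ (λ u → 𝟙 (v ∈? u) * 𝟙 (w ∈? u))
        lemma₁ : ∀ y m n l → y * m + n * (y * l) ≡ y * (m + n * l)
        lemma₁ = solve-∀
        lemma₂ : ∀ y n l m → y * (n * l + m) ≡ n * (y * l) + m * y
        lemma₂ = solve-∀
        through? : ∀ w → Decidable (λ g → ∥ γ g ∥ ≡ q ^ suc d × v ∈ γ g × w ∈ γ g)
        through? w g = (∥ γ g ∥ ≟ q ^ suc d) ×-dec (v ∈? γ g) ×-dec (w ∈? γ g)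
        M≡ : ∀ w → M w ≡ count (through? w)
        M≡ w = sym (sum-cong-≗ (λ g → trans
          (𝟙-× (∥ γ g ∥ ≟ q ^ suc d) ((v ∈? γ g) ×-dec (w ∈? γ g)))
          (cong (𝟙 (∥ γ g ∥ ≟ q ^ suc d) *_) (𝟙-× (v ∈? γ g) (w ∈? γ g)))))
        pointwise : ∀ w → M w + N₂ * [L] w ≡ N₁ * [L] w + N₂
        pointwise w with w ∈? line v
        ... | yes w∈L = begin
          M w + N₂ * 1              ≡⟨ cong₂ _+_ (trans (M≡ w) through≡) (*-identityʳ N₂) ⟩
          N₁ + N₂                   ≡⟨ cong (_+ N₂) (*-identityʳ N₁) ⟨
          N₁ * 1 + N₂               ∎
          where
          through≡ : count (through? w) ≡ N₁
          through≡ = trans (count-cong (through? w) (between? (line v) ⊤ (suc d))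
            (λ { g (e , v∈ , _) → line⊆ (γ-flat g) v∈ , ⊆⊤ , e })
            (λ { g (⊆g , _ , e) → e , ⊆g (∈-line v) , ⊆g w∈L }))
            (proj₂ line-count (line-dim v∉𝟎))
        ... | no w∉L = begin
          M w + N₂ * 0              ≡⟨ cong₂ _+_ (trans (M≡ w) through≡) (*-zeroʳ N₂) ⟩
          N₂ + 0                    ≡⟨ +-identityʳ N₂ ⟩
          N₂                        ≡⟨ cong (_+ N₂) (*-zeroʳ N₁) ⟨
          N₁ * 0 + N₂               ∎
          where
          through≡ : count (through? w) ≡ N₂
          through≡ = trans (count-cong (through? w) (between? (join (line v) w) ⊤ (suc d))
            (λ { g (e , v∈ , w∈) → join-least (γ-flat g) (line⊆ (γ-flat g) v∈) w∈ , ⊆⊤ , e })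
            (λ { g (⊆g , _ , e) → e , ⊆g (⊆-join (flat (line-dim v∉𝟎)) (∈-line v))
                                    , ⊆g (∈-join (flat (line-dim v∉𝟎))) }))
            (proj₂ plane-count (join-dim (line-dim v∉𝟎) w∉L))

  -- Comparison of the numbers μ_k with μ_1

  module Eigenvalues (p d l : ℕ) where
    q : ℕ
    q = suc p

    br : ℕ → ℕ
    br = bracket q

    -- The kth eigenvalue is main k − shift k, and that for k = 1 is θ₁.
    main shift : ℕ → ℕ
    main zero     = q * br (suc d) * br l
    main (suc k)  = q * br (d ∸ k) * br l
    shift zero    = 0
    shift (suc k) = br (suc k) * br (suc (d ∸ k))

    br-mono-< : ∀ {m n} → m < n → br m < br n
    br-mono-< {m} {suc n} (s≤s m≤n) with m≤n⇒m<n∨m≡n m≤n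
    ... | inj₁ m<n    = <-trans (br-mono-< m<n) step
      where
      step : br n < br (suc n)
      step = s≤s (m≤n*m (br n) q)
    ... | inj₂ refl = s≤s (m≤n*m (br n) q)

    -- The product [m][n] is the sum of the powers q^(a + b) with a < m and b < n, and every
    -- exponent below m + n - 1 occurs. Consequently `shift k` for 1 ≤ k ≤ D is smallest at k = 1,
    -- where it is [D].
    br-supermultiplicative : ∀ k i → br (suc (k + i)) ≤ br (suc k) * br (suc i)
    br-supermultiplicative zero    i = m≤n*m (br (suc i)) (br 1)
    br-supermultiplicative (suc k) i = begin
      1 + q * br (suc (k + i))                     ≤⟨ +-mono-≤ (s≤s z≤n) (*-monoʳ-≤ q (br-supermultiplicative k i)) ⟩
      br (suc i) + q * (br (suc k) * br (suc i))     ≡⟨ cong (br (suc i) +_) (*-assoc q (br (suc k)) (br (suc i))) ⟨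
      br (suc (suc k)) * br (suc i)                     ∎
      where open ≤-Reasoning

    shift-1 : shift 1 ≡ br (suc d)
    shift-1 = trans (cong (λ t → suc t * br (suc d)) (*-zeroʳ q)) (*-identityˡ _)

    shift-≥ : ∀ k → k ≤ d → br (suc d) ≤ shift (suc k)
    shift-≥ k k≤d = subst (λ t → br (suc t) ≤ shift (suc k)) (m+[n∸m]≡n k≤d) (br-supermultiplicative k (d ∸ k))

    main-≤ : ∀ k → main (suc k) ≤ main 1
    main-≤ zero    = ≤-refl
    main-≤ (suc k) with suc k ≤? d
    ... | yes k<d = *-monoˡ-≤ (br l) (*-monoʳ-≤ q (<⇒≤ (br-mono-< (∸-monoʳ-< (z<s {k}) k<d))))
    -- Beyond d the truncated subtraction gives `br 0`, so the left side is 0.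
    ... | no k≮d = ≤-trans (≤-reflexive (cong (λ t → q * br t * br l) (m≤n⇒m∸n≡0 (≰⇒≥ k≮d))))
                             (≤-trans (≤-reflexive (cong (_* br l) (*-zeroʳ q))) z≤n)

    main-< : .{{NonZero l}} → ∀ k → suc k ≤ d → main (suc (suc k)) < main 1
    main-< k k<d = *-monoˡ-< (br l) {{br-nonZero l}} (*-monoʳ-< q (br-mono-< (∸-monoʳ-< (z<s {k}) k<d)))
      where
      br-nonZero : ∀ l → .{{NonZero l}} → NonZero (br l)
      br-nonZero (suc l) = _

    -- This is μ_{k+1} ≤ μ_1 with both subtractions moved across. `gap-<` is its strict form from
    -- μ_2 on, where N - D > 0 enters through `l`.
    gap-≤ : ∀ k → k ≤ d → main (suc k) + br (suc d) ≤ main 1 + shift (suc k)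
    gap-≤ k k≤d = +-mono-≤ (main-≤ k) (shift-≥ k k≤d)

    gap-< : .{{NonZero l}} → ∀ k → suc k ≤ d → main (suc (suc k)) + br (suc d) < main 1 + shift (suc (suc k))
    gap-< k k<d = +-mono-<-≤ (main-< k k<d) (shift-≥ (suc k) k<d)

    -- The difference μ_0 - μ_1 is [N]. It separates the two eigenvalues, and it is the origin of
    -- the factor [N] in the projection.
    gap-0 : main 0 + br (suc d) ≡ br (suc d + l) + main 1
    gap-0 = begin
      q * br (suc d) * br l + br (suc d)                          ≡⟨ cong (λ t → q * t * br l + br (suc d)) (bracket-suc q d) ⟩
      q * (br d + q ^ d) * br l + br (suc d)                    ≡⟨ rearrange q (br d) (q ^ d) (br l) (br (suc d)) ⟩
      (br (suc d) + q * q ^ d * br l) + q * br d * br l     ≡⟨ cong (_+ main 1) (bracket-+ q (suc d) l) ⟨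
      br (suc d + l) + main 1                                       ∎
      where
      open ≡-Reasoning
      rearrange : ∀ q a b c e → q * (a + b) * c + e ≡ (e + q * b * c) + q * a * c
      rearrange = solve-∀

  -- The counts as identities between vectors and matrices indexed by vertices

  module Vertices {σ} {p N V} (G : SubspaceGeometry σ (suc p) N V) (d l : ℕ) (N≡ : N ≡ d + suc l)
    {n} (⟦_⟧ : Fin n → Subset V) (vertex-dim : ∀ y → Counts.Dim G ⟦ y ⟧ (suc d))
    (vertex-injective : ∀ {y z} → ⟦ y ⟧ ≡ ⟦ z ⟧ → y ≡ z)
    (vertex-onto : ∀ {u} → Counts.Dim G u (suc d) → ∃[ y ] ⟦ y ⟧ ≡ u) where

    open Points G d l N≡ public
    open Eigenvalues p d l public using (main; shift; shift-1; gap-0; gap-≤; gap-<)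

    -- Each vertex is γ g for exactly one g, and each γ g of dimension D is exactly one vertex.
    -- Inserting the first fact as a factor 1 and interchanging the sums carries counts over `γ` to
    -- the vertices.
    ∑-vertices : ∀ (f : Subset V → ℕ) → sum (λ y → f ⟦ y ⟧) ≡ ∑ᴰ f
    ∑-vertices f = begin
      sum (λ y → f ⟦ y ⟧)
        ≡⟨ sum-cong-≗ (λ y → trans (sym (*-identityˡ (f ⟦ y ⟧))) (trans (cong (_* f ⟦ y ⟧) (sym (count-γ≡ (flat (vertex-dim y)))))
             (*-distribʳ-sum (f ⟦ y ⟧) (λ g → 𝟙 (γ g ≟ˢ ⟦ y ⟧))))) ⟩
      sum (λ y → sum (λ g → 𝟙 (γ g ≟ˢ ⟦ y ⟧) * f ⟦ y ⟧))
        ≡⟨ ∑-comm (λ y g → 𝟙 (γ g ≟ˢ ⟦ y ⟧) * f ⟦ y ⟧) ⟩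
      sum (λ g → sum (λ y → 𝟙 (γ g ≟ˢ ⟦ y ⟧) * f ⟦ y ⟧))
        ≡⟨ sum-cong-≗ (λ g → trans (sum-cong-≗ (same g)) (trans (sym (*-distribʳ-sum (f (γ g)) (λ y → 𝟙 (γ g ≟ˢ ⟦ y ⟧))))
             (cong (_* f (γ g)) (fibre g)))) ⟩
      ∑ᴰ f ∎
      where
      open ≡-Reasoning
      same : ∀ g y → 𝟙 (γ g ≟ˢ ⟦ y ⟧) * f ⟦ y ⟧ ≡ 𝟙 (γ g ≟ˢ ⟦ y ⟧) * f (γ g)
      same g y with γ g ≟ˢ ⟦ y ⟧
      ... | yes eq = cong (λ u → 1 * f u) (sym eq)
      ... | no _   = refl
      fibre : ∀ g → count (λ y → γ g ≟ˢ ⟦ y ⟧) ≡ 𝟙 (∥ γ g ∥ ≟ q ^ suc d)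
      fibre g with ∥ γ g ∥ ≟ q ^ suc d
      ... | yes e = let (y , eq) = vertex-onto (isDim (γ-flat g) e) in trans
        (count-unique (λ y → γ g ≟ˢ ⟦ y ⟧) y (sym eq) (λ z eq′ → vertex-injective (trans (sym eq′) (sym eq))))
        (sym (𝟙-yes (∥ γ g ∥ ≟ q ^ suc d) e))
      ... | no ¬e = trans
        (count-none (λ y → γ g ≟ˢ ⟦ y ⟧) (λ y eq → ¬e (trans (cong ∥_∥ eq) (card (vertex-dim y)))))
        (sym (𝟙-no (∥ γ g ∥ ≟ q ^ suc d) ¬e))

    n≡vertexCount : n ≡ vertexCount
    n≡vertexCount = begin
      n               ≡⟨ count-all n ⟨
      sum {n} (λ _ → 1) ≡⟨ ∑-vertices (λ _ → 1) ⟩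
      ∑ᴰ (λ _ → 1)    ≡⟨ sum-cong-≗ {s} (λ g → *-identityʳ (𝟙 (∥ γ g ∥ ≟ q ^ suc d))) ⟩
      vertexCount     ∎
      where open ≡-Reasoning

    adj gram : Fin n → Fin n → ℕ
    adj y z  = adjacent ⟦ y ⟧ ⟦ z ⟧
    gram y z = ∥ ⟦ y ⟧ ∩ ⟦ z ⟧ ∥

    adj-sym : ∀ y z → adj y z ≡ adj z y
    adj-sym y z = cong (λ u → 𝟙 (∥ u ∥ ≟ q ^ d)) (∩-comm ⟦ z ⟧ ⟦ y ⟧)

    gram-sym : ∀ y z → gram y z ≡ gram z y
    gram-sym y z = cong ∥_∥ (∩-comm ⟦ y ⟧ ⟦ z ⟧)

    gram-diagonal : ∀ y → gram y y ≡ q ^ suc d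
    gram-diagonal y = trans (cong ∥_∥ (∩-idem ⟦ y ⟧)) (card (vertex-dim y))

    contains : Subset V → Fin n → ℕ
    contains α y = 𝟙 (α ⊆? ⟦ y ⟧)

    through : Fin V → Fin n → ℕ
    through v y = 𝟙 (v ∈? ⟦ y ⟧)

    contains-𝟎 : ∀ y → contains 𝟎 y ≡ 1
    contains-𝟎 y = 𝟙-yes (𝟎 ⊆? ⟦ y ⟧) (𝟎⊆ (flat (vertex-dim y)))

    contains-line : ∀ v y → contains (line v) y ≡ through v y
    contains-line v y = 𝟙-cong (line v ⊆? ⟦ y ⟧) (v ∈? ⟦ y ⟧) (λ ⊆y → ⊆y (∈-line v)) (λ v∈y → line⊆ (flat (vertex-dim y)) v∈y)

    contains-vertex : ∀ y z → contains ⟦ y ⟧ z ≡ 𝟙 (y Fin.≟ z)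
    contains-vertex y z = 𝟙-cong (⟦ y ⟧ ⊆? ⟦ z ⟧) (y Fin.≟ z)
      (λ y⊆z → vertex-injective (Dim-≡ (vertex-dim y) (vertex-dim z) y⊆z)) (λ { refl → ⊆-refl })

    degree : ∀ y → sum (adj y) ≡ main 0
    degree y = begin
      sum (adj y)                ≡⟨ ∑-vertices (adjacent ⟦ y ⟧) ⟩
      ∑ᴰ (adjacent ⟦ y ⟧)        ≡⟨ ∑ᴰ-adjacent (vertex-dim y) ⟩
      br (suc d) * (q * br l)    ≡⟨ rearrange (br (suc d)) q (br l) ⟩
      main 0                     ∎
      where
      open ≡-Reasoning
      rearrange : ∀ a b c → a * (b * c) ≡ b * a * c
      rearrange = solve-∀

    contains-adj : ∀ α z → sum (λ y → contains α y * adj y z) ≡ neighbours ⟦ z ⟧ α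
    contains-adj α z = begin
      sum (λ y → contains α y * adj y z)              ≡⟨ sum-cong-≗ (λ y → trans (*-comm (contains α y) (adj y z)) (cong (_* contains α y) (adj-sym y z))) ⟩
      sum (λ y → adj z y * contains α y)              ≡⟨ ∑-vertices (λ u → adjacent ⟦ z ⟧ u * 𝟙 (α ⊆? u)) ⟩
      ∑ᴰ (λ u → adjacent ⟦ z ⟧ u * 𝟙 (α ⊆? u))        ≡⟨ ∑ᴰ-adjacent-⊇ ⟦ z ⟧ α ⟩
      neighbours ⟦ z ⟧ α                              ∎
      where open ≡-Reasoning

    contains-adj-0 : ∀ z → sum (λ y → contains 𝟎 y * adj y z) + shift 0 * contains 𝟎 z ≡ main 0 * contains 𝟎 z + 0
    contains-adj-0 z = begin
      sum (λ y → contains 𝟎 y * adj y z) + 0   ≡⟨ +-identityʳ _ ⟩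
      sum (λ y → contains 𝟎 y * adj y z)       ≡⟨ sum-cong-≗ (λ y → trans (cong (_* adj y z) (contains-𝟎 y)) (trans (*-identityˡ _) (adj-sym y z))) ⟩
      sum (adj z)                              ≡⟨ degree z ⟩
      main 0                                   ≡⟨ *-identityʳ (main 0) ⟨
      main 0 * 1                               ≡⟨ cong (main 0 *_) (contains-𝟎 z) ⟨
      main 0 * contains 𝟎 z                    ≡⟨ +-identityʳ _ ⟨
      main 0 * contains 𝟎 z + 0                ∎
      where open ≡-Reasoning

    facet : Subset V → ℕ → Fin s → ℕ
    facet α k g = 𝟙 ((γ g ⊆? α) ×-dec (∥ γ g ∥ ≟ q ^ k))

    contains-adj-suc : ∀ {α k} → Dim α (suc k) → k ≤ d → ∀ z →
      sum (λ y → contains α y * adj y z) + shift (suc k) * contains α z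
        ≡ main (suc k) * contains α z + br (suc (d ∸ k)) * sum (λ g → facet α k g * contains (γ g) z)
    contains-adj-suc {α} {k} A k≤d z = begin
      sum (λ y → contains α y * adj y z) + shift (suc k) * contains α z
        ≡⟨ cong (_+ shift (suc k) * contains α z) (contains-adj α z) ⟩
      neighbours ⟦ z ⟧ α + shift (suc k) * contains α z
        ≡⟨ neighbours-formula (vertex-dim z) (d ∸ k) A (sym (m+[n∸m]≡n k≤d)) ⟩
      main (suc k) * contains α z + br (suc (d ∸ k)) * count (facet? (vertex-dim z) α k)
        ≡⟨ cong (λ t → main (suc k) * contains α z + br (suc (d ∸ k)) * t) (sum-cong-≗ (λ g → trans
             (𝟙-cong (facet? (vertex-dim z) α k g) (((γ g ⊆? α) ×-dec (∥ γ g ∥ ≟ q ^ k)) ×-dec (γ g ⊆? ⟦ z ⟧))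
               (λ { (⊆α , ⊆z , e) → (⊆α , e) , ⊆z }) (λ { ((⊆α , e) , ⊆z) → ⊆α , ⊆z , e }))
             (𝟙-× ((γ g ⊆? α) ×-dec (∥ γ g ∥ ≟ q ^ k)) (γ g ⊆? ⟦ z ⟧)))) ⟩
      main (suc k) * contains α z + br (suc (d ∸ k)) * sum (λ g → facet α k g * contains (γ g) z) ∎
      where open ≡-Reasoning

    adj-gram : ∀ y x → sum (λ z → adj y z * gram z x) + br (suc d) * gram y x
                       ≡ main 1 * gram y x + (br (suc d) + br l) * q ^ suc d
    adj-gram y x = trans (cong (_+ br (suc d) * gram y x) (∑-vertices (λ u → adjacent ⟦ y ⟧ u * ∥ u ∩ ⟦ x ⟧ ∥)))
                         (∑ᴰ-adjacent-∥∩∥ (vertex-dim y) (vertex-dim x))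

    -- Modulo constant vectors, v^∨ is an eigenvector of the Gram matrix with eigenvalue p (N₁ -
    -- N₂), the number that `normalisation` evaluates.
    through-gram : ∀ {v} → v ∉ 𝟎 → ∀ z →
      sum (λ y → through v y * gram y z) + N₂ * (1 + p * through v z) ≡ N₁ * (1 + p * through v z) + N₂ * q ^ suc d
    through-gram {v} v∉𝟎 z = trans
      (cong (_+ N₂ * (1 + p * through v z)) (∑-vertices (λ u → 𝟙 (v ∈? u) * ∥ u ∩ ⟦ z ⟧ ∥)))
      (∑ᴰ-∋-∥∩∥ v∉𝟎 (vertex-dim z))

    -- The projection onto the eigenspace of θ₁ is numerator / denominator times the
    -- matrix with entries [N] |y ∩ z| − offset.
    numerator denominator offset : ℕ
    numerator   = q * br (d + l)
    denominator = n * (p * (br (suc d) * br l)) * q ^ suc d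
    offset      = (br (suc d) + br l) * q ^ suc d

    -- In other words numerator · [N] · p (N₁ - N₂) = denominator. As [N - 1] = [d] + q^d [l] and
    -- [d] N₁ = [N - 1] N₂, the product [N - 1] (N₁ - N₂) is q^d [l] N₁, and then [N] N₁ = n [D]
    -- applies.
    normalisation : ∀ {v} → v ∉ 𝟎 →
      numerator * (br N * (p * N₁)) ≡ denominator + numerator * (br N * (p * N₂))
    normalisation v∉𝟎 = begin
      q * br (d + l) * (br N * (p * N₁))
        ≡⟨ cong (λ t → q * t * (br N * (p * N₁))) (bracket-+ q d l) ⟩
      q * (br d + q ^ d * br l) * (br N * (p * N₁))
        ≡⟨ lemma₁ q (br d) (q ^ d) (br l) (br N) p N₁ ⟩
      br N * N₁ * (p * br l * (q * q ^ d)) + q * br N * p * (N₁ * br d)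
        ≡⟨ cong₂ (λ s t → s * (p * br l * (q * q ^ d)) + q * br N * p * t)
             (trans (sym vertexCount-N₁) (cong (_* br (suc d)) (sym n≡vertexCount))) (N₁-N₂ v∉𝟎) ⟩
      n * br (suc d) * (p * br l * (q * q ^ d)) + q * br N * p * (br (d + l) * N₂)
        ≡⟨ lemma₂ n (br (suc d)) p (br l) (q * q ^ d) q (br N) (br (d + l)) N₂ ⟩
      denominator + numerator * (br N * (p * N₂)) ∎
      where
      open ≡-Reasoning
      lemma₁ : ∀ q a e b c p m → q * (a + e * b) * (c * (p * m)) ≡ c * m * (p * b * (q * e)) + q * c * p * (m * a)
      lemma₁ = solve-∀
      lemma₂ : ∀ n a p b e q c h m → n * a * (p * b * e) + q * c * p * (h * m) ≡ n * (p * (a * b)) * e + q * h * (c * (p * m))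
      lemma₂ = solve-∀

-- Finite vector spaces as subspace geometries

module FiniteVectorSpaces where

  open import Algebra.Bundles using (CommutativeMonoid)
  open import Algebra.Module.Bundles using (Module)
  import Algebra.Properties.AbelianGroup as AbelianGroupProperties
  import Algebra.Properties.CommutativeMonoid.Sum as CommutativeMonoidSum
  import Algebra.Properties.CommutativeSemigroup as CommutativeSemigroupProperties
  import Algebra.Properties.Ring as RingProperties
  open import Data.Empty using (⊥-elim)
  open import Data.Fin.Base using (Fin; zero; suc; finToFun; funToFin)
  open import Data.Fin.Properties using (any?; funToFin-finToFin)
  open import Data.Fin.Subset using (Subset; inside; outside; _∈_; _∉_; _⊆_; _∩_; ⊤)
  open import Data.Fin.Subset.Properties using (_∈?_; _⊆?_; ∈⊤; ⊆-antisym; ⊆-reflexive; p∩q⊆p; p∩q⊆q; x∈p∩q⁺)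
  open import Data.List.Base using (List; []; _∷_; map; length; lookup)
  open import Data.List.Membership.Propositional using () renaming (_∈_ to _∈ₗ_)
  open import Data.List.Membership.Propositional.Properties using (∈-lookup; ∈-filter⁺; ∈-filter⁻; ∈-map⁺; ∈-map⁻; ∈-++⁺ˡ; ∈-++⁺ʳ)
  import Data.List.Relation.Unary.All as All
  open import Data.List.Relation.Unary.AllPairs using ([]; _∷_)
  import Data.List.Relation.Unary.Any as Any
  open import Data.List.Relation.Unary.Any using (here)
  import Data.List.Relation.Unary.Any.Properties as Any
  open import Data.List.Relation.Unary.Unique.Propositional using (Unique)
  import Data.List.Relation.Unary.Unique.Propositional.Properties as Unique
  open import Data.Nat.Base as ℕ using (ℕ; zero; suc; _≤_; _<_; _^_)
  import Data.Nat.Properties as ℕ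
  open import Data.Product.Base using (∃-syntax; _×_; _,_; proj₂)
  open import Data.Unit.Base using (tt)
  open import Data.Vec.Base using ([]; _∷_; tabulate)
  open import Data.Vec.Properties using (lookup∘tabulate; []=⇒lookup; lookup⇒[]=; ∷-injectiveʳ)
  open import Defs
  open import Function.Base using (_∘_)
  open import Function.Bundles using (Inverse)
  open import Relation.Binary.PropositionalEquality
  open import Relation.Nullary using (¬_; yes; no; does; contradiction)
  open import Relation.Nullary.Decidable using (dec-true)
  open import Relation.Unary using (Pred; Decidable)
  open Counting
  open SubspaceCounts

  comprehension : ∀ {n p} {P : Pred (Fin n) p} → Decidable P → Subset n
  comprehension P? = tabulate (does ∘ P?)

  ∈-comprehension⁺ : ∀ {n p} {P : Pred (Fin n) p} (P? : Decidable P) {k} → P k → k ∈ comprehension P?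
  ∈-comprehension⁺ P? {k} Pk =
    lookup⇒[]= k (comprehension P?) (trans (lookup∘tabulate (does ∘ P?) k) (dec-true (P? k) Pk))

  ∈-comprehension⁻ : ∀ {n p} {P : Pred (Fin n) p} (P? : Decidable P) {k} → k ∈ comprehension P? → P k
  ∈-comprehension⁻ P? {k} k∈
    with P? k | trans (sym (lookup∘tabulate (does ∘ P?) k)) ([]=⇒lookup k∈)
  ... | yes Pk | _  = Pk
  ... | no _   | ()

  lookup-injective : ∀ {a} {A : Set a} {xs : List A} → Unique xs → ∀ {i j} → lookup xs i ≡ lookup xs j → i ≡ j
  lookup-injective (_ ∷ _)      {zero}  {zero}  _  = refl
  lookup-injective {xs = x ∷ xs} (x∉ ∷ _) {zero}  {suc j} eq = contradiction eq (All.lookup x∉ (∈-lookup j))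
  lookup-injective {xs = x ∷ xs} (x∉ ∷ _) {suc i} {zero}  eq = contradiction (sym eq) (All.lookup x∉ (∈-lookup i))
  lookup-injective (_ ∷ unique) {suc i} {suc j} eq = cong suc (lookup-injective unique eq)

  funToFin-cong : ∀ {m n} {f g : Fin m → Fin n} → f ≗ g → funToFin f ≡ funToFin g
  funToFin-cong {zero}  f≗g = refl
  funToFin-cong {suc m} {n} f≗g = cong₂ Data.Fin.Base.combine (f≗g zero) (funToFin-cong (f≗g ∘ suc))

  module VectorGeometry {c ℓ q N m ℓm} (𝔽 : FiniteField c ℓ q) (𝒱 : VectorSpace 𝔽 N m ℓm) where
    open Subspaces 𝔽 𝒱
    open VectorSpace 𝒱
    open Module asModule
      using (≈ᴹ-refl; ≈ᴹ-sym; ≈ᴹ-trans; ≈ᴹ-setoid; +ᴹ-cong; +ᴹ-congˡ; +ᴹ-congʳ; +ᴹ-assoc; +ᴹ-comm; +ᴹ-identityˡ; +ᴹ-identityʳ;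
             *ₗ-cong; *ₗ-zeroˡ; *ₗ-zeroʳ; *ₗ-distribʳ; *ₗ-distribˡ; *ₗ-identityˡ; *ₗ-assoc;
             +ᴹ-commutativeMonoid)
    private
      module F = FiniteField 𝔽
      module ∑ = CommutativeMonoidSum +ᴹ-commutativeMonoid
      open RingProperties F.ring using (-1*x≈-x)

    *ₗ-congˡ : ∀ a {v w} → v ≈ᴹ w → a *ₗ v ≈ᴹ a *ₗ w
    *ₗ-congˡ a = *ₗ-cong F.refl

    +-scaled-cancel : ∀ w a v → (w +ᴹ a *ₗ v) +ᴹ (F.- a) *ₗ v ≈ᴹ w
    +-scaled-cancel w a v = begin
      (w +ᴹ a *ₗ v) +ᴹ (F.- a) *ₗ v   ≈⟨ +ᴹ-assoc _ _ _ ⟩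
      w +ᴹ (a *ₗ v +ᴹ (F.- a) *ₗ v)   ≈⟨ +ᴹ-congˡ (*ₗ-distribʳ v a (F.- a)) ⟨
      w +ᴹ (a F.+ F.- a) *ₗ v         ≈⟨ +ᴹ-congˡ (*ₗ-cong (F.-‿inverseʳ a) ≈ᴹ-refl) ⟩
      w +ᴹ F.0# *ₗ v                  ≈⟨ +ᴹ-congˡ (*ₗ-zeroˡ v) ⟩
      w +ᴹ 0ᴹ                         ≈⟨ +ᴹ-identityʳ w ⟩
      w                               ∎
      where open import Relation.Binary.Reasoning.Setoid ≈ᴹ-setoid

    lc-+ : ∀ {d} (a a′ : Fin d → F.Carrier) b → lc (λ j → a j F.+ a′ j) b ≈ᴹ lc a b +ᴹ lc a′ b
    lc-+ a a′ b = ≈ᴹ-trans (∑.sum-cong-≋ (λ j → *ₗ-distribʳ (b j) (a j) (a′ j)))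
                           (∑.∑-distrib-+ (λ j → a j *ₗ b j) (λ j → a′ j *ₗ b j))

    lc-* : ∀ {d} x (a : Fin d → F.Carrier) b → lc (λ j → x F.* a j) b ≈ᴹ x *ₗ lc a b
    lc-* {zero}  x a b = ≈ᴹ-sym (*ₗ-zeroʳ x)
    lc-* {suc d} x a b = ≈ᴹ-trans (+ᴹ-cong (*ₗ-assoc x (a zero) (b zero)) (lc-* x (a ∘ suc) (b ∘ suc)))
                                 (≈ᴹ-sym (*ₗ-distribˡ x _ _))

    lc-injective : ∀ {d} {b : Fin d → Carrierᴹ} → LinearlyIndependent b → ∀ {a a′} → lc a b ≈ᴹ lc a′ b → ∀ j → a j F.≈ a′ j
    lc-injective {b = b} ind {a} {a′} eq j = x∙y⁻¹≈ε⇒x≈y (a j) (a′ j)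
      (F.trans (F.+-congˡ (F.sym (-1*x≈-x (a′ j)))) (ind (λ j → a j F.+ F.- F.1# F.* a′ j) (begin
        lc (λ j → a j F.+ F.- F.1# F.* a′ j) b          ≈⟨ lc-+ a (λ j → F.- F.1# F.* a′ j) b ⟩
        lc a b +ᴹ lc (λ j → F.- F.1# F.* a′ j) b        ≈⟨ +ᴹ-cong eq (lc-* (F.- F.1#) a′ b) ⟩
        lc a′ b +ᴹ (F.- F.1#) *ₗ lc a′ b                ≈⟨ +ᴹ-congʳ (≈ᴹ-trans (≈ᴹ-sym (*ₗ-identityˡ _)) (≈ᴹ-sym (+ᴹ-identityˡ _))) ⟩
        (0ᴹ +ᴹ F.1# *ₗ lc a′ b) +ᴹ (F.- F.1#) *ₗ lc a′ b ≈⟨ +-scaled-cancel 0ᴹ F.1# (lc a′ b) ⟩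
        0ᴹ                                              ∎) j))
      where
      open import Relation.Binary.Reasoning.Setoid ≈ᴹ-setoid
      open AbelianGroupProperties F.+-abelianGroup using (x∙y⁻¹≈ε⇒x≈y)

    coefficients-injective : ∀ {d} {k l : Fin (q ^ d)} → (∀ j → coefficients {d} k j F.≈ coefficients {d} l j) → k ≡ l
    coefficients-injective {d} {k} {l} eq = begin
      k                             ≡⟨ funToFin-finToFin {d} k ⟨
      funToFin (finToFun {q} {d} k) ≡⟨ funToFin-cong {f = finToFun {q} {d} k} {finToFun {q} {d} l} (λ j → trans (sym (index-elem _)) (trans (Inverse.from-cong F.enumeration (eq j)) (index-elem _))) ⟩
      funToFin (finToFun {q} {d} l) ≡⟨ funToFin-finToFin {d} l ⟩
      l                             ∎
      where
      open ≡-Reasoning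
      index-elem : ∀ i → F.index (F.elem i) ≡ i
      index-elem i = Inverse.inverseʳ F.enumeration F.refl

    vec-injective : ∀ {k l} → vec k ≈ᴹ vec l → k ≡ l
    vec-injective eq = coefficients-injective {N} (lc-injective independent eq)

    ∈⇒∈ᵥ : ∀ {k u} → k ∈ u → vec k ∈ᵥ u
    ∈⇒∈ᵥ {k} k∈u = k , k∈u , ≈ᴹ-refl

    ∈ᵥ⇒∈ : ∀ {k u} → vec k ∈ᵥ u → k ∈ u
    ∈ᵥ⇒∈ {u = u} (l , l∈u , eq) = subst (_∈ u) (vec-injective eq) l∈u

    ∈ᵥ-mono : ∀ {u w v} → u ⊆ w → v ∈ᵥ u → v ∈ᵥ w
    ∈ᵥ-mono u⊆w (k , k∈u , eq) = k , u⊆w k∈u , eq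

    lc-closed : ∀ {u} → IsSubspace u → ∀ {d} a {b : Fin d → Carrierᴹ} → (∀ j → b j ∈ᵥ u) → lc a b ∈ᵥ u
    lc-closed U {zero}  a b∈ = IsSubspace.0∈ U
    lc-closed U {suc d} a b∈ =
      IsSubspace.+-closed U (IsSubspace.*-closed U (a zero) (b∈ zero)) (lc-closed U (a ∘ suc) (b∈ ∘ suc))

    -- Linear combinations of the basis match the q^d coefficient tuples with the members of u:
    -- spanning provides a tuple for each vector, and independence makes it unique.
    HasDim⇒∥∥ : ∀ {u d} → IsSubspace u → HasDim u d → ∥ u ∥ ≡ q ^ d
    HasDim⇒∥∥ {u} {d} U (b , b∈ , ind , span) = sym (trans (sym (count-all (q ^ d)))
      (bijection-count (λ _ → yes tt) (_∈? u) (λ i k → lc (coefficients i) b ≟ᵥ vec k)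
        (λ i k eq → tt , ∈ᵥ⇒∈ (∈ᵥ-resp eq (lc-closed U (coefficients i) b∈)))
        (λ i _ → let (k , eq) = vec-onto (lc (coefficients i) b) in
          count-unique (λ k → lc (coefficients i) b ≟ᵥ vec k) k (≈ᴹ-sym eq)
            (λ l eq′ → vec-injective (≈ᴹ-trans (≈ᴹ-sym eq′) (≈ᴹ-sym eq))))
        (λ k k∈u → let (a , eq) = span (vec k) (∈⇒∈ᵥ k∈u) in
          count-unique (λ i → lc (coefficients i) b ≟ᵥ vec k) (funToFin (F.index ∘ a))
            (≈ᴹ-trans (lc-cong (coefficients-onto a) (λ _ → ≈ᴹ-refl)) eq)
            (λ i eq′ → coefficients-injective {d} (lc-injective ind
              (≈ᴹ-trans eq′ (≈ᴹ-trans (≈ᴹ-sym eq) (≈ᴹ-sym (lc-cong (coefficients-onto a) (λ _ → ≈ᴹ-refl))))))))))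

    -- A vector v belongs to the span of u and `vec k` when v + a `vec k` ∈ u for some scalar a, the
    -- sign being absorbed in a. Searching the q scalars makes this decidable.
    joined? : ∀ u k → Decidable (λ l → ∃[ i ] vec l +ᴹ F.elem i *ₗ vec k ∈ᵥ u)
    joined? u k l = any? (λ i → (vec l +ᴹ F.elem i *ₗ vec k) ∈ᵥ? u)

    join : VectorSet → Fin (q ^ N) → VectorSet
    join u k = comprehension (joined? u k)

    ∈ᵥ-join⁺ : ∀ {u k v} a → v +ᴹ a *ₗ vec k ∈ᵥ u → v ∈ᵥ join u k
    ∈ᵥ-join⁺ {u} {k} {v} a ∈u = let (l , eq) = vec-onto v in l , ∈-comprehension⁺ (joined? u k) (F.index a ,
      ∈ᵥ-resp (+ᴹ-cong (≈ᴹ-sym eq) (*ₗ-cong (F.sym (F.elem-index a)) ≈ᴹ-refl)) ∈u) , eq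

    ∈ᵥ-join⁻ : ∀ {u k v} → v ∈ᵥ join u k → ∃[ a ] v +ᴹ a *ₗ vec k ∈ᵥ u
    ∈ᵥ-join⁻ {u} {k} (l , l∈ , eq) = let (i , ∈u) = ∈-comprehension⁻ (joined? u k) l∈ in F.elem i , ∈ᵥ-resp (+ᴹ-cong eq ≈ᴹ-refl) ∈u

    module _ {u} (U : IsSubspace u) {k : Fin (q ^ N)} where
      open IsSubspace U

      join⊇ : ∀ {v} → v ∈ᵥ u → v ∈ᵥ join u k
      join⊇ {v} v∈u = ∈ᵥ-join⁺ F.0#
        (∈ᵥ-resp (≈ᴹ-sym (≈ᴹ-trans (+ᴹ-congˡ (*ₗ-zeroˡ (vec k))) (+ᴹ-identityʳ v))) v∈u)

      ⊆-join : u ⊆ join u k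
      ⊆-join = ∈ᵥ⇒∈ ∘ join⊇ ∘ ∈⇒∈ᵥ

      vec∈join : vec k ∈ᵥ join u k
      vec∈join = ∈ᵥ-join⁺ (F.- F.1#) (∈ᵥ-resp (≈ᴹ-sym (≈ᴹ-trans
        (+ᴹ-congʳ (≈ᴹ-trans (≈ᴹ-sym (*ₗ-identityˡ _)) (≈ᴹ-sym (+ᴹ-identityˡ _))))
        (+-scaled-cancel 0ᴹ F.1# (vec k)))) 0∈)

      join-isSubspace : IsSubspace (join u k)
      join-isSubspace = record
        { 0∈ = join⊇ 0∈
        ; +-closed = λ {v} {w} v∈ w∈ → let (a , ∈u) = ∈ᵥ-join⁻ v∈; (a′ , ∈u′) = ∈ᵥ-join⁻ w∈ in
            ∈ᵥ-join⁺ (a F.+ a′) (∈ᵥ-resp (≈ᴹ-sym (≈ᴹ-trans (+ᴹ-congˡ (*ₗ-distribʳ (vec k) a a′)) (interchange v w _ _)))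
                                         (+-closed ∈u ∈u′))
        ; *-closed = λ x v∈ → let (a , ∈u) = ∈ᵥ-join⁻ v∈ in
            ∈ᵥ-join⁺ (x F.* a) (∈ᵥ-resp (≈ᴹ-trans (*ₗ-distribˡ x _ _) (+ᴹ-congˡ (≈ᴹ-sym (*ₗ-assoc x a (vec k)))))
                                        (*-closed x ∈u))
        }
        where
        open CommutativeSemigroupProperties (CommutativeMonoid.commutativeSemigroup +ᴹ-commutativeMonoid)
          using (interchange)

      -- A basis of u with `vec k` put in front is a basis of the join.
      join-hasDim : ∀ {d} → HasDim u d → k ∉ u → HasDim (join u k) (suc d)
      join-hasDim {d} (b , b∈ , ind , span) k∉u = b′ , b′∈ , ind′ , span′
        where
        b′ : Fin (suc d) → Carrierᴹ
        b′ zero    = vec k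
        b′ (suc j) = b j
        b′∈ : ∀ j → b′ j ∈ᵥ join u k
        b′∈ zero    = vec∈join
        b′∈ (suc j) = join⊇ (b∈ j)
        ind′ : LinearlyIndependent b′
        ind′ a eq with a zero F.≟ F.0#
        ... | yes a₀≈0 = λ { zero → a₀≈0 ; (suc j) → ind (a ∘ suc) tail≈0 j }
          where
          tail≈0 : lc (a ∘ suc) b ≈ᴹ 0ᴹ
          tail≈0 = ≈ᴹ-trans (≈ᴹ-sym (+ᴹ-identityˡ _))
            (≈ᴹ-trans (+ᴹ-congʳ (≈ᴹ-sym (≈ᴹ-trans (*ₗ-cong a₀≈0 ≈ᴹ-refl) (*ₗ-zeroˡ (vec k))))) eq)
        -- A relation with a non-zero coefficient at `vec k` can be solved for `vec k` inside u,
        -- against k ∉ u.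
        ... | no a₀≉0 with F.inverse (a zero) a₀≉0
        ... | y , a₀y≈1 = contradiction (∈ᵥ⇒∈ (∈ᵥ-resp (begin
            y *ₗ ((F.- F.1#) *ₗ t)    ≈⟨ *ₗ-congˡ y scaled ⟨
            y *ₗ (a zero *ₗ vec k)    ≈⟨ *ₗ-assoc y (a zero) (vec k) ⟨
            (y F.* a zero) *ₗ vec k   ≈⟨ *ₗ-cong (F.trans (F.*-comm y (a zero)) a₀y≈1) ≈ᴹ-refl ⟩
            F.1# *ₗ vec k             ≈⟨ *ₗ-identityˡ (vec k) ⟩
            vec k                     ∎)
            (*-closed y (*-closed (F.- F.1#) (lc-closed U (a ∘ suc) b∈))))) k∉u
          where
          open import Relation.Binary.Reasoning.Setoid ≈ᴹ-setoid
          t : Carrierᴹ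
          t = lc (a ∘ suc) b
          scaled : a zero *ₗ vec k ≈ᴹ (F.- F.1#) *ₗ t
          scaled = begin
            a zero *ₗ vec k                                   ≈⟨ +-scaled-cancel _ F.1# t ⟨
            (a zero *ₗ vec k +ᴹ F.1# *ₗ t) +ᴹ (F.- F.1#) *ₗ t ≈⟨ +ᴹ-congʳ (≈ᴹ-trans (+ᴹ-congˡ (*ₗ-identityˡ t)) eq) ⟩
            0ᴹ +ᴹ (F.- F.1#) *ₗ t                             ≈⟨ +ᴹ-identityˡ _ ⟩
            (F.- F.1#) *ₗ t                                   ∎
        span′ : ∀ v → v ∈ᵥ join u k → InSpan b′ v
        span′ v v∈ = let (a , ∈u) = ∈ᵥ-join⁻ v∈; (e , eq) = span _ ∈u in
          (λ { zero → F.- a ; (suc j) → e j }) ,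
          ≈ᴹ-trans (+ᴹ-comm _ _) (≈ᴹ-trans (+ᴹ-congʳ eq) (+-scaled-cancel v a (vec k)))

    join-minimal : ∀ {u k w} → IsSubspace w → u ⊆ w → k ∈ w → join u k ⊆ w
    join-minimal {k = k} W u⊆w k∈w l∈ = let (a , ∈u) = ∈ᵥ-join⁻ (∈⇒∈ᵥ l∈) in
      ∈ᵥ⇒∈ (∈ᵥ-resp (+-scaled-cancel _ a (vec k))
        (IsSubspace.+-closed W (∈ᵥ-mono u⊆w ∈u) (IsSubspace.*-closed W (F.- a) (∈⇒∈ᵥ k∈w))))

    -- For l ∈ w, the vector `vec l` + a `vec k` that lies in u also lies in w, because k ∈ w. The
    -- same scalar a thus witnesses membership in the join of w ∩ u.
    join-modular : ∀ {u k w} → IsSubspace u → IsSubspace w → k ∈ w → w ⊆ join u k → w ⊆ join (w ∩ u) k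
    join-modular {u} {k} {w} U W k∈w w⊆ {l} l∈w = restrict (∈ᵥ-join⁻ {u} {k} (∈⇒∈ᵥ (w⊆ l∈w)))
      where
      restrict : ∃[ a ] vec l +ᴹ a *ₗ vec k ∈ᵥ u → l ∈ join (w ∩ u) k
      restrict (a , (h , h∈u , eq)) = ∈ᵥ⇒∈ (∈ᵥ-join⁺ a (h , x∈p∩q⁺ (∈ᵥ⇒∈ h∈w , h∈u) , eq))
        where
        h∈w : vec h ∈ᵥ w
        h∈w = ∈ᵥ-resp (≈ᴹ-sym eq) (IsSubspace.+-closed W (∈⇒∈ᵥ l∈w) (IsSubspace.*-closed W a (∈⇒∈ᵥ k∈w)))

    ∩-isSubspace : ∀ {u w} → IsSubspace u → IsSubspace w → IsSubspace (u ∩ w)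
    ∩-isSubspace {u} {w} U W = record
      { 0∈       = both (IsSubspace.0∈ U) (IsSubspace.0∈ W)
      ; +-closed = λ x∈ y∈ → both (IsSubspace.+-closed U (left x∈) (left y∈)) (IsSubspace.+-closed W (right x∈) (right y∈))
      ; *-closed = λ a x∈ → both (IsSubspace.*-closed U a (left x∈)) (IsSubspace.*-closed W a (right x∈))
      }
      where
      both : ∀ {v} → v ∈ᵥ u → v ∈ᵥ w → v ∈ᵥ u ∩ w
      both (k , k∈u , eq) v∈w = k , x∈p∩q⁺ (k∈u , ∈ᵥ⇒∈ (∈ᵥ-resp (≈ᴹ-sym eq) v∈w)) , eq
      left : ∀ {v} → v ∈ᵥ u ∩ w → v ∈ᵥ u
      left = ∈ᵥ-mono (p∩q⊆p u w)
      right : ∀ {v} → v ∈ᵥ u ∩ w → v ∈ᵥ w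
      right = ∈ᵥ-mono (p∩q⊆q u w)

    ⊤-isSubspace : IsSubspace ⊤
    ⊤-isSubspace = record { 0∈ = all 0ᴹ ; +-closed = λ _ _ → all _ ; *-closed = λ _ _ → all _ }
      where
      all : ∀ v → v ∈ᵥ ⊤
      all v = let (k , eq) = vec-onto v in k , ∈⊤ , eq

    ∥⊤∥≡q^N : ∥ ⊤ {q ^ N} ∥ ≡ q ^ N
    ∥⊤∥≡q^N = trans (count-cong {n = q ^ N} (_∈? ⊤) (λ _ → yes tt) (λ _ _ → tt) (λ _ _ → ∈⊤)) (count-all (q ^ N))

    zero? : Decidable (λ k → vec k ≈ᴹ 0ᴹ)
    zero? k = vec k ≟ᵥ 0ᴹ

    zeroSpace : VectorSet
    zeroSpace = comprehension zero?

    ∈ᵥ-zeroSpace⁺ : ∀ {v} → v ≈ᴹ 0ᴹ → v ∈ᵥ zeroSpace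
    ∈ᵥ-zeroSpace⁺ {v} v≈0 = let (k , eq) = vec-onto v in
      k , ∈-comprehension⁺ zero? (≈ᴹ-trans eq v≈0) , eq

    ∈ᵥ-zeroSpace⁻ : ∀ {v} → v ∈ᵥ zeroSpace → v ≈ᴹ 0ᴹ
    ∈ᵥ-zeroSpace⁻ (k , k∈ , eq) = ≈ᴹ-trans (≈ᴹ-sym eq) (∈-comprehension⁻ zero? k∈)

    zeroSpace-isSubspace : IsSubspace zeroSpace
    zeroSpace-isSubspace = record
      { 0∈       = ∈ᵥ-zeroSpace⁺ ≈ᴹ-refl
      ; +-closed = λ v∈ w∈ → ∈ᵥ-zeroSpace⁺ (≈ᴹ-trans (+ᴹ-cong (∈ᵥ-zeroSpace⁻ v∈) (∈ᵥ-zeroSpace⁻ w∈)) (+ᴹ-identityˡ 0ᴹ))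
      ; *-closed = λ a v∈ → ∈ᵥ-zeroSpace⁺ (≈ᴹ-trans (*ₗ-congˡ a (∈ᵥ-zeroSpace⁻ v∈)) (*ₗ-zeroʳ a))
      }

    zeroSpace-hasDim : HasDim zeroSpace 0
    zeroSpace-hasDim = (λ ()) , (λ ()) , (λ _ _ ()) , (λ v v∈ → (λ ()) , ≈ᴹ-sym (∈ᵥ-zeroSpace⁻ v∈))

    zeroSpace⊆ : ∀ {u} → IsSubspace u → zeroSpace ⊆ u
    zeroSpace⊆ U k∈ = ∈ᵥ⇒∈ (∈ᵥ-resp (≈ᴹ-sym (∈-comprehension⁻ zero? k∈)) (IsSubspace.0∈ U))

    -- Starting from the zero space, a subspace w of u is enlarged by one vector of u at a time. The
    -- fuel n bounds |u| - |w|, and each join makes w strictly larger.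
    ∃-dim : ∀ {u} → IsSubspace u → ∃[ d ] HasDim u d
    ∃-dim {u} U = grow ∥ u ∥ zeroSpace-isSubspace zeroSpace-hasDim (zeroSpace⊆ U) (ℕ.m≤n+m ∥ u ∥ _)
      where
      grow : ∀ n {w d} → IsSubspace w → HasDim w d → w ⊆ u → ∥ u ∥ ≤ ∥ w ∥ ℕ.+ n → ∃[ d ] HasDim u d
      grow n {w} {d} W dim w⊆u bound with u ⊆? w
      ... | yes u⊆w = d , subst (λ t → HasDim t d) (⊆-antisym w⊆u u⊆w) dim
      grow zero    {w} {d} W dim w⊆u bound | no u⊈w =
        ⊥-elim (u⊈w (⊆-reflexive (sym (⊆∧∥∥≡⇒≡ w⊆u
          (ℕ.≤-antisym (∥∥-mono-≤ w⊆u) (subst (∥ u ∥ ≤_) (ℕ.+-identityʳ ∥ w ∥) bound))))))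
      grow (suc n) {w} {d} W dim w⊆u bound | no u⊈w with ⊈⇒∃ u⊈w
      ... | k , k∈u , k∉w = grow n (join-isSubspace W) (join-hasDim W dim k∉w) (join-minimal U w⊆u k∈u)
        (ℕ.≤-trans bound (ℕ.≤-trans (ℕ.≤-reflexive (ℕ.+-suc ∥ w ∥ n)) (ℕ.+-monoˡ-≤ n grows)))
        where
        grows : ∥ w ∥ < ∥ join w k ∥
        grows = subst₂ _<_ (sym (HasDim⇒∥∥ W dim)) (sym (HasDim⇒∥∥ (join-isSubspace W) (join-hasDim W dim k∉w)))
          (ℕ.^-monoʳ-< q F.1<q (ℕ.n<1+n d))

    -- By `∃-dim` the space has some dimension d′, and |u| = q^d′ determines d′ because q > 1.
    ∥∥⇒HasDim : ∀ {u d} → IsSubspace u → ∥ u ∥ ≡ q ^ d → HasDim u d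
    ∥∥⇒HasDim {u} U eq with ∃-dim U
    ... | d′ , dim = subst (HasDim u) (^-injectiveʳ F.1<q (trans (sym (HasDim⇒∥∥ U dim)) eq)) dim

    allSubsets-unique : ∀ n → Unique (allSubsets n)
    allSubsets-unique zero    = All.[] ∷ []
    allSubsets-unique (suc n) = Unique.++⁺
      (Unique.map⁺ ∷-injectiveʳ (allSubsets-unique n)) (Unique.map⁺ ∷-injectiveʳ (allSubsets-unique n))
      (λ (x∈ , y∈) → disjoint (∈-map⁻ (outside ∷_) x∈) (∈-map⁻ (inside ∷_) y∈))
      where
      disjoint : ∀ {x} → ∃[ u ] u ∈ₗ allSubsets n × x ≡ outside ∷ u → ¬ (∃[ u ] u ∈ₗ allSubsets n × x ≡ inside ∷ u)
      disjoint (_ , _ , refl) (_ , _ , ())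

    ∈-allSubsets : ∀ {n} (u : Subset n) → u ∈ₗ allSubsets n
    ∈-allSubsets []            = here refl
    ∈-allSubsets (outside ∷ u) = ∈-++⁺ˡ (∈-map⁺ (outside ∷_) (∈-allSubsets u))
    ∈-allSubsets (inside ∷ u)  = ∈-++⁺ʳ (map (outside ∷_) (allSubsets _)) (∈-map⁺ (inside ∷_) (∈-allSubsets u))

    subspaces-unique : Unique subspaces
    subspaces-unique = Unique.filter⁺ isSubspace? (allSubsets-unique (q ^ N))

    ∈-subspaces : ∀ {u} → IsSubspace u → u ∈ₗ subspaces
    ∈-subspaces {u} U = ∈-filter⁺ isSubspace? (∈-allSubsets u) U

    subspaces-isSubspace : ∀ g → IsSubspace (lookup subspaces g)
    subspaces-isSubspace g = proj₂ (∈-filter⁻ isSubspace? {xs = allSubsets (q ^ N)} (∈-lookup g))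

    geometry : SubspaceGeometry _ q N (q ^ N)
    geometry = record
      { 1<q          = F.1<q
      ; Flat         = IsSubspace
      ; 𝟎            = zeroSpace
      ; 𝟎-flat       = zeroSpace-isSubspace
      ; ∥𝟎∥≡1        = HasDim⇒∥∥ zeroSpace-isSubspace zeroSpace-hasDim
      ; 𝟎⊆           = zeroSpace⊆
      ; ⊤-flat       = ⊤-isSubspace
      ; ∥⊤∥          = ∥⊤∥≡q^N
      ; ∩-flat       = ∩-isSubspace
      ; cardinality  = λ U → let (d , dim) = ∃-dim U in d , HasDim⇒∥∥ U dim
      ; join         = join
      ; join-flat    = λ U → join-isSubspace U
      ; ⊆-join       = λ U → ⊆-join U
      ; ∈-join       = λ U → ∈ᵥ⇒∈ (vec∈join U)
      ; join-least   = λ {u} {k} {w} W u⊆w k∈w {l} l∈ → join-minimal W u⊆w k∈w l∈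
      ; ∥join∥       = λ U k∉u → let (d , dim) = ∃-dim U in
          trans (HasDim⇒∥∥ (join-isSubspace U) (join-hasDim U dim k∉u)) (cong (q ℕ.*_) (sym (HasDim⇒∥∥ U dim)))
      ; join-modular = join-modular
      ; s            = length subspaces
      ; γ            = lookup subspaces
      ; γ-flat       = subspaces-isSubspace
      ; γ-injective  = lookup-injective subspaces-unique
      ; γ-onto       = λ U → Any.index (∈-subspaces U) , sym (Any.lookup-index (∈-subspaces U))
      }

-- Eigenvectors tested against integer vectors, over a ring with invertible positive integers

module Spectra where

  open import Algebra.Bundles using (CommutativeRing)
  import Algebra.Properties.AbelianGroup as AbelianGroupProperties
  import Algebra.Properties.Ring as RingProperties
  import Algebra.Properties.Semiring.Sum as SemiringSum
  import Algebra.Solver.Ring.NaturalCoefficients.Default as NaturalSolver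
  open import Data.Bool.Base using (if_then_else_)
  open import Data.Fin.Base using (Fin; zero; suc)
  import Data.Fin.Properties as Fin
  open import Data.Fin.Subset using (Subset; _∉_)
  open import Data.Fin.Subset.Properties using (_⊆?_)
  open import Data.Nat.Base as ℕ using (ℕ; zero; suc; NonZero; _≤_; _<_; _^_; _∸_; s≤s; z≤n)
  import Data.Nat.Properties as ℕ
  open import Data.Nat.Tactic.RingSolver using (solve-∀)
  open import Data.Product.Base using (∃-syntax; _,_)
  open import Data.Sum.Base using (_⊎_; inj₁; inj₂)
  open import Function.Base using (_∘_)
  open import Level using (_⊔_)
  open import Relation.Binary.PropositionalEquality as ≡ using (_≡_; _≗_)
  import Relation.Binary.Reasoning.Setoid as SetoidReasoning
  open import Relation.Nullary using (Dec; yes; no; does; contradiction)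
  open import Relation.Nullary.Decidable using (_×-dec_)
  open Counting
  open SubspaceCounts

  -- This is what the eigenvector argument uses of ℂ: a ring in which positive integers are
  -- invertible. Order and conjugation come in only with the concrete numbers.
  record NaturalScalars {a ℓ} (K : CommutativeRing a ℓ) : Set (a ⊔ ℓ) where
    open CommutativeRing K
    field
      nat     : ℕ → Carrier
      nat-0   : nat 0 ≈ 0#
      nat-1   : nat 1 ≈ 1#
      nat-+   : ∀ m n → nat (m ℕ.+ n) ≈ nat m + nat n
      nat-*   : ∀ m n → nat (m ℕ.* n) ≈ nat m * nat n
      inv     : (n : ℕ) → .{{NonZero n}} → Carrier
      nat-inv : ∀ n .{{_ : NonZero n}} → nat n * inv n ≈ 1#

  module Scalars {a ℓ} (K : CommutativeRing a ℓ) (S : NaturalScalars K) where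
    open CommutativeRing K public hiding (zero)
    open NaturalScalars S public
    open SemiringSum semiring public using () renaming
      (sum to Σ; sum-cong-≋ to Σ-cong; ∑-distrib-+ to Σ-+; ∑-comm to Σ-comm; *-distribˡ-sum to *-distribˡ-Σ; *-distribʳ-sum to *-distribʳ-Σ;
       sum-replicate-zero to Σ-zero)
    open RingProperties ring public using (-‿distribˡ-*; -‿distribʳ-*; -0#≈0#; -‿+-comm)
    open AbelianGroupProperties +-abelianGroup public using () renaming (x∙y⁻¹≈ε⇒x≈y to x-y≈0⇒x≈y; ∙-cancelʳ to +-cancelʳ)
    open NaturalSolver commutativeSemiring public using (solve; _:=_; _:+_; _:*_)
    open SetoidReasoning setoid public

    nat-≡ : ∀ {m n} → m ≡ n → nat m ≈ nat n
    nat-≡ m≡n = reflexive (≡.cong nat m≡n)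

    nat-𝟙 : ∀ {p} {A : Set p} (A? : Dec A) → nat (𝟙 A?) ≈ (if does A? then 1# else 0#)
    nat-𝟙 (yes _) = nat-1
    nat-𝟙 (no _)  = nat-0

    nat-sum : ∀ {n} (t : Fin n → ℕ) → nat (sum t) ≈ Σ (nat ∘ t)
    nat-sum {zero}  t = nat-0
    nat-sum {suc n} t = trans (nat-+ (t zero) _) (+-congˡ (nat-sum (t ∘ suc)))

    nat-cancel : ∀ n .{{_ : NonZero n}} {w} → nat n * w ≈ 0# → w ≈ 0#
    nat-cancel n {w} eq = begin
      w                      ≈⟨ *-identityˡ w ⟨
      1# * w                 ≈⟨ *-congʳ (trans (*-comm (inv n) (nat n)) (nat-inv n)) ⟨
      (inv n * nat n) * w    ≈⟨ *-assoc (inv n) (nat n) w ⟩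
      inv n * (nat n * w)    ≈⟨ *-congˡ eq ⟩
      inv n * 0#             ≈⟨ zeroʳ (inv n) ⟩
      0#                     ∎

    nat-cancelˡ : ∀ n .{{_ : NonZero n}} {v w} → nat n * v ≈ nat n * w → v ≈ w
    nat-cancelˡ n {v} {w} eq = x-y≈0⇒x≈y v w (nat-cancel n (begin
      nat n * (v - w)               ≈⟨ distribˡ (nat n) v (- w) ⟩
      nat n * v + nat n * - w       ≈⟨ +-cong eq (sym (-‿distribʳ-* (nat n) w)) ⟩
      nat n * w - nat n * w         ≈⟨ -‿inverseʳ _ ⟩
      0#                            ∎))

    Σ-≈0 : ∀ {n} (f : Fin n → Carrier) → (∀ i → f i ≈ 0#) → Σ f ≈ 0#
    Σ-≈0 {n} f f≈0 = trans (Σ-cong f≈0) (Σ-zero n)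

    if-* : ∀ {p} {A : Set p} (A? : Dec A) w → (if does A? then w else 0#) ≈ nat (𝟙 A?) * w
    if-* (yes _) w = sym (trans (*-congʳ nat-1) (*-identityˡ w))
    if-* (no _)  w = sym (trans (*-congʳ nat-0) (zeroˡ w))

    Σ-neg : ∀ {n} (f : Fin n → Carrier) → Σ (λ i → - f i) ≈ - Σ f
    Σ-neg {zero}  f = sym -0#≈0#
    Σ-neg {suc n} f = trans (+-congˡ (Σ-neg (f ∘ suc))) (-‿+-comm (f zero) (Σ (f ∘ suc)))

    -- Converts orthogonality of c to u - e into an equality of two pairings. The vector c is kept
    -- apart from w so that it can be the conjugate of a real vector w.
    Σ-*-sub : ∀ {n} {c w u e : Fin n → Carrier} → (∀ z → c z ≈ w z) → Σ (λ z → c z * (u z - e z)) ≈ 0# →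
              Σ (λ z → w z * u z) ≈ Σ (λ z → w z * e z)
    Σ-*-sub {n} {c} {w} {u} {e} c≈w eq = x-y≈0⇒x≈y _ _ (begin
      Σ (λ z → w z * u z) - Σ (λ z → w z * e z)           ≈⟨ +-congˡ (Σ-neg (λ z → w z * e z)) ⟨
      Σ (λ z → w z * u z) + Σ (λ z → - (w z * e z))       ≈⟨ Σ-+ (λ z → w z * u z) (λ z → - (w z * e z)) ⟨
      Σ (λ z → w z * u z + - (w z * e z))                 ≈⟨ Σ-cong {n} (λ z → trans (+-congˡ (-‿distribʳ-* (w z) (e z)))
        (trans (sym (distribˡ (w z) (u z) (- e z))) (*-congʳ (sym (c≈w z))))) ⟩
      Σ (λ z → c z * (u z - e z))                         ≈⟨ eq ⟩
      0#                                                  ∎)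

    infix 5 ⟪_,_⟫
    -- The pairing is without conjugation and its left argument is integer valued, so that
    -- identities between counts can be applied to it directly.
    ⟪_,_⟫ : ∀ {n} → (Fin n → ℕ) → (Fin n → Carrier) → Carrier
    ⟪ t , f ⟫ = Σ (λ y → nat (t y) * f y)

    module _ {n} {f : Fin n → Carrier} where

      ⟪⟫-cong : ∀ {t u : Fin n → ℕ} → t ≗ u → ⟪ t , f ⟫ ≈ ⟪ u , f ⟫
      ⟪⟫-cong t≗u = Σ-cong (λ y → *-congʳ (nat-≡ (t≗u y)))

      ⟪⟫-+ : ∀ (t u : Fin n → ℕ) → ⟪ (λ y → t y ℕ.+ u y) , f ⟫ ≈ ⟪ t , f ⟫ + ⟪ u , f ⟫
      ⟪⟫-+ t u = trans (Σ-cong (λ y → trans (*-congʳ (nat-+ (t y) (u y))) (distribʳ (f y) _ _)))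
                       (Σ-+ (λ y → nat (t y) * f y) (λ y → nat (u y) * f y))

      ⟪⟫-* : ∀ c (t : Fin n → ℕ) → ⟪ (λ y → c ℕ.* t y) , f ⟫ ≈ nat c * ⟪ t , f ⟫
      ⟪⟫-* c t = trans (Σ-cong (λ y → trans (*-congʳ (nat-* c (t y))) (*-assoc _ _ _)))
                       (sym (*-distribˡ-Σ (nat c) (λ y → nat (t y) * f y)))

      ⟪⟫-sum : ∀ {m} (t : Fin m → Fin n → ℕ) → ⟪ (λ y → sum (λ g → t g y)) , f ⟫ ≈ Σ (λ g → ⟪ t g , f ⟫)
      ⟪⟫-sum t = trans
        (Σ-cong (λ y → trans (*-congʳ (nat-sum (λ g → t g y))) (*-distribʳ-Σ (f y) (λ g → nat (t g y)))))
        (Σ-comm (λ y g → nat (t g y) * f y))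

      ⟪⟫-combination≈0 : ∀ {m} (c : Fin m → ℕ) (t : Fin m → Fin n → ℕ) →
        (∀ g → c g ≡ 0 ⊎ ⟪ t g , f ⟫ ≈ 0#) → ⟪ (λ y → sum (λ g → c g ℕ.* t g y)) , f ⟫ ≈ 0#
      ⟪⟫-combination≈0 c t zeros = trans (⟪⟫-sum (λ g y → c g ℕ.* t g y)) (Σ-≈0 _ (λ g →
        trans (⟪⟫-* (c g) (t g)) (vanish (zeros g))))
        where
        vanish : ∀ {g} → c g ≡ 0 ⊎ ⟪ t g , f ⟫ ≈ 0# → nat (c g) * ⟪ t g , f ⟫ ≈ 0#
        vanish (inj₁ eq) = trans (*-congʳ (trans (nat-≡ eq) nat-0)) (zeroˡ _)
        vanish (inj₂ eq) = trans (*-congˡ eq) (zeroʳ _)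

    Eigenvector : ∀ {n} → (Fin n → Fin n → ℕ) → Carrier → (Fin n → Carrier) → Set ℓ
    Eigenvector A θ f = ∀ y → ⟪ A y , f ⟫ ≈ θ * f y

    module _ {n} (A : Fin n → Fin n → ℕ) {θ : Carrier} where

      -- Associativity: the row vector t A paired with f is t paired with A f.
      eigenvector-transpose : ∀ {f} → Eigenvector A θ f → ∀ t →
        ⟪ (λ z → sum (λ y → t y ℕ.* A y z)) , f ⟫ ≈ θ * ⟪ t , f ⟫
      eigenvector-transpose {f} eigen t = begin
        ⟪ (λ z → sum (λ y → t y ℕ.* A y z)) , f ⟫      ≈⟨ ⟪⟫-sum (λ y z → t y ℕ.* A y z) ⟩
        Σ (λ y → ⟪ (λ z → t y ℕ.* A y z) , f ⟫)         ≈⟨ Σ-cong (λ y → trans (⟪⟫-* (t y) (A y)) (*-congˡ (eigen y))) ⟩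
        Σ (λ y → nat (t y) * (θ * f y))                 ≈⟨ Σ-cong (λ y → solve 3 (λ t θ f → t :* (θ :* f) := θ :* (t :* f)) refl (nat (t y)) θ (f y)) ⟩
        Σ (λ y → θ * (nat (t y) * f y))                 ≈⟨ *-distribˡ-Σ θ (λ y → nat (t y) * f y) ⟨
        θ * ⟪ t , f ⟫                                   ∎

      -- The identity says t A = (e - c) t + u. Pairing it with f removes u, so t is orthogonal to f
      -- unless θ = e - c.
      eigenvector-test : ∀ {f} → Eigenvector A θ f → ∀ {t u} c e →
        (∀ z → sum (λ y → t y ℕ.* A y z) ℕ.+ c ℕ.* t z ≡ e ℕ.* t z ℕ.+ u z) → ⟪ u , f ⟫ ≈ 0# →
        (θ + nat c) * ⟪ t , f ⟫ ≈ nat e * ⟪ t , f ⟫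
      eigenvector-test {f} eigen {t} {u} c e identity u⟂f = begin
        (θ + nat c) * ⟪ t , f ⟫                              ≈⟨ distribʳ _ θ (nat c) ⟩
        θ * ⟪ t , f ⟫ + nat c * ⟪ t , f ⟫                    ≈⟨ +-cong (eigenvector-transpose eigen t) (⟪⟫-* c t) ⟨
        ⟪ tA , f ⟫ + ⟪ (λ z → c ℕ.* t z) , f ⟫               ≈⟨ ⟪⟫-+ tA (λ z → c ℕ.* t z) ⟨
        ⟪ (λ z → tA z ℕ.+ c ℕ.* t z) , f ⟫                   ≈⟨ ⟪⟫-cong identity ⟩
        ⟪ (λ z → e ℕ.* t z ℕ.+ u z) , f ⟫                    ≈⟨ ⟪⟫-+ (λ z → e ℕ.* t z) u ⟩
        ⟪ (λ z → e ℕ.* t z) , f ⟫ + ⟪ u , f ⟫                ≈⟨ +-cong (⟪⟫-* e t) u⟂f ⟩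
        nat e * ⟪ t , f ⟫ + 0#                               ≈⟨ +-identityʳ _ ⟩
        nat e * ⟪ t , f ⟫                                    ∎
        where
        tA : Fin n → ℕ
        tA z = sum (λ y → t y ℕ.* A y z)

      eigenvector-combination : ∀ {m} (F : Fin m → Fin n → Carrier) (c : Fin m → Carrier) →
        (∀ z → Eigenvector A θ (F z)) → Eigenvector A θ (λ y → Σ (λ z → F z y * c z))
      eigenvector-combination F c eigen y = begin
        Σ (λ w → nat (A y w) * Σ (λ z → F z w * c z))         ≈⟨ Σ-cong (λ w → *-distribˡ-Σ (nat (A y w)) (λ z → F z w * c z)) ⟩
        Σ (λ w → Σ (λ z → nat (A y w) * (F z w * c z)))       ≈⟨ Σ-comm (λ w z → nat (A y w) * (F z w * c z)) ⟩
        Σ (λ z → Σ (λ w → nat (A y w) * (F z w * c z)))       ≈⟨ Σ-cong (λ z → Σ-cong (λ w → *-assoc (nat (A y w)) (F z w) (c z))) ⟨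
        Σ (λ z → Σ (λ w → nat (A y w) * F z w * c z))         ≈⟨ Σ-cong (λ z → *-distribʳ-Σ (c z) (λ w → nat (A y w) * F z w)) ⟨
        Σ (λ z → ⟪ A y , F z ⟫ * c z)                         ≈⟨ Σ-cong (λ z → trans (*-congʳ (eigen z y)) (*-assoc θ (F z y) (c z))) ⟩
        Σ (λ z → θ * (F z y * c z))                           ≈⟨ *-distribˡ-Σ θ (λ z → F z y * c z) ⟨
        θ * Σ (λ z → F z y * c z)                             ∎

      eigenvector-scale : ∀ {f} k → Eigenvector A θ f → Eigenvector A θ (λ y → k * f y)
      eigenvector-scale {f} k eigen y = begin
        Σ (λ z → nat (A y z) * (k * f z))    ≈⟨ Σ-cong (λ z → solve 3 (λ a k f → a :* (k :* f) := k :* (a :* f)) refl (nat (A y z)) k (f z)) ⟩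
        Σ (λ z → k * (nat (A y z) * f z))    ≈⟨ *-distribˡ-Σ k (λ z → nat (A y z) * f z) ⟨
        k * ⟪ A y , f ⟫                      ≈⟨ *-congˡ (eigen y) ⟩
        k * (θ * f y)                        ≈⟨ solve 3 (λ k t f → k :* (t :* f) := t :* (k :* f)) refl k θ (f y) ⟩
        θ * (k * f y)                        ∎

      eigenvector-sub : ∀ {f h} → Eigenvector A θ f → Eigenvector A θ h → Eigenvector A θ (λ y → f y - h y)
      eigenvector-sub {f} {h} eigen-f eigen-h y = begin
        Σ (λ z → nat (A y z) * (f z - h z))              ≈⟨ Σ-cong {n} (λ z → trans (distribˡ (nat (A y z)) (f z) (- h z)) (+-congˡ (sym (-‿distribʳ-* (nat (A y z)) (h z))))) ⟩
        Σ (λ z → nat (A y z) * f z + - (nat (A y z) * h z)) ≈⟨ Σ-+ (λ z → nat (A y z) * f z) (λ z → - (nat (A y z) * h z)) ⟩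
        ⟪ A y , f ⟫ + Σ (λ z → - (nat (A y z) * h z))    ≈⟨ +-cong (eigen-f y) (trans (Σ-neg (λ z → nat (A y z) * h z)) (-‿cong (eigen-h y))) ⟩
        θ * f y - θ * h y                                ≈⟨ +-congˡ (-‿distribʳ-* θ (h y)) ⟩
        θ * f y + θ * - h y                              ≈⟨ distribˡ θ (f y) (- h y) ⟨
        θ * (f y - h y)                                  ∎

  -- Spectrum of the Grassmann graph and the projection for μ_1

  module GrassmannSpectrum {a ℓ σ} (K : CommutativeRing a ℓ) (S : NaturalScalars K)
    {p N V} (G : SubspaceGeometry σ (suc p) N V) (d l : ℕ) (N≡ : N ≡ d ℕ.+ suc l)
    {n} (⟦_⟧ : Fin n → Subset V) (vertex-dim : ∀ y → Counts.Dim G ⟦ y ⟧ (suc d))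
    (vertex-injective : ∀ {y z} → ⟦ y ⟧ ≡ ⟦ z ⟧ → y ≡ z)
    (vertex-onto : ∀ {u} → Counts.Dim G u (suc d) → ∃[ y ] ⟦ y ⟧ ≡ u) where

    open Scalars K S public
    open Vertices G d l N≡ ⟦_⟧ vertex-dim vertex-injective vertex-onto public

    br-nonZero : ∀ k → .{{NonZero k}} → NonZero (br k)
    br-nonZero (suc k) = _

    -- The positive form of θ ≠ μ_k: multiplication by θ - μ_k can be cancelled. It follows from
    -- apartness of reals as well as from strict inequalities between naturals.
    Separated : Carrier → ℕ → Set _
    Separated θ k = ∀ {w} → (θ + nat (shift k)) * w ≈ nat (main k) * w → w ≈ 0#

    Annihilates : ℕ → (Fin n → Carrier) → Set _
    Annihilates k f = ∀ {α} → Dim α k → ⟪ contains α , f ⟫ ≈ 0#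

    module _ {θ f} (eigen : Eigenvector adj θ f) where

      annihilates-0 : Separated θ 0 → Annihilates 0 f
      annihilates-0 separated {α} A = trans
        (⟪⟫-cong (λ y → ≡.cong (λ u → contains u y) (≡.sym (Dim-≡ 𝟎-dim A (𝟎⊆ (flat A))))))
        (separated (eigenvector-test adj eigen {t = contains 𝟎} {u = λ _ → 0} (shift 0) (main 0) contains-adj-0
          (Σ-≈0 (λ y → nat 0 * f y) (λ y → trans (*-congʳ nat-0) (zeroˡ (f y))))))

      annihilates-suc : ∀ {k} → k ≤ d → Separated θ (suc k) → Annihilates k f → Annihilates (suc k) f
      annihilates-suc {k} k≤d separated lower {α} A = separated
        (eigenvector-test adj eigen {t = contains α} (shift (suc k)) (main (suc k)) (contains-adj-suc A k≤d)
          (trans (⟪⟫-* (br (suc (d ∸ k))) facets) (trans (*-congˡ facets⟂f) (zeroʳ _))))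
        where
        facets : Fin n → ℕ
        facets z = sum (λ g → facet α k g ℕ.* contains (γ g) z)
        facets⟂f : ⟪ facets , f ⟫ ≈ 0#
        facets⟂f = ⟪⟫-combination≈0 (facet α k) (λ g → contains (γ g)) zeros
          where
          zeros : ∀ g → facet α k g ≡ 0 ⊎ ⟪ contains (γ g) , f ⟫ ≈ 0#
          zeros g with ∥ γ g ∥ ℕ.≟ q ^ k
          ... | yes e = inj₂ (lower (isDim (γ-flat g) e))
          ... | no ¬e = inj₁ (𝟙-no ((γ g ⊆? α) ×-dec (∥ γ g ∥ ℕ.≟ q ^ k)) (λ (_ , e) → ¬e e))

      annihilates-all : ∀ {k} → Annihilates k f → (∀ i → k ≤ i → i ≤ d → Separated θ (suc i)) →
                        ∀ i → k ≤ i → i ≤ suc d → Annihilates i f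
      annihilates-all {k} start separated i k≤i i≤ with ℕ.m≤n⇒m<n∨m≡n k≤i
      ... | inj₂ ≡.refl = start
      annihilates-all start separated (suc i) k≤i i≤ | inj₁ (s≤s k≤i′) = annihilates-suc (ℕ.s≤s⁻¹ i≤) (separated i k≤i′ (ℕ.s≤s⁻¹ i≤))
        (annihilates-all start separated i k≤i′ (ℕ.≤-trans (ℕ.n≤1+n i) i≤))

    unit-test : ∀ (f : Fin n → Carrier) y → ⟪ (λ z → 𝟙 (y Fin.≟ z)) , f ⟫ ≈ f y
    unit-test f y = Σ-unit y
      where
      Σ-unit : ∀ {n} {f : Fin n → Carrier} y → ⟪ (λ z → 𝟙 (y Fin.≟ z)) , f ⟫ ≈ f y
      Σ-unit {suc n} {f} Fin.zero = trans (+-cong (trans (*-congʳ nat-1) (*-identityˡ _))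
        (Σ-≈0 {n} _ (λ z → trans (*-congʳ nat-0) (zeroˡ (f (Fin.suc z)))))) (+-identityʳ _)
      Σ-unit {suc n} {f} (Fin.suc y) = trans (+-cong (trans (*-congʳ nat-0) (zeroˡ _))
        (trans (⟪⟫-cong {f = f ∘ Fin.suc} (λ z → 𝟙-cong (Fin.suc y Fin.≟ Fin.suc z) (y Fin.≟ z) Fin.suc-injective (≡.cong Fin.suc)))
               (Σ-unit {f = f ∘ Fin.suc} y))) (+-identityˡ _)

    -- The only vertex containing ⟦ y ⟧ is y, so the test vector of ⟦ y ⟧ is the unit vector at y.
    annihilates-top : ∀ {f} → Annihilates (suc d) f → ∀ y → f y ≈ 0#
    annihilates-top {f} top y = trans (sym (unit-test f y))
      (trans (⟪⟫-cong (λ z → ≡.sym (contains-vertex y z))) (top (vertex-dim y)))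

    eigenvector≈0 : ∀ {θ f} → Eigenvector adj θ f → Separated θ 0 →
                    (∀ i → i ≤ d → Separated θ (suc i)) → ∀ y → f y ≈ 0#
    eigenvector≈0 eigen separated₀ separated = annihilates-top
      (annihilates-all eigen (annihilates-0 eigen separated₀) (λ i _ → separated i) (suc d) z≤n ℕ.≤-refl)

    ones : Fin n → ℕ
    ones _ = 1

    ⟪⟫-const : ∀ {f : Fin n → Carrier} c → ⟪ ones , f ⟫ ≈ 0# → ⟪ (λ (_ : Fin n) → c) , f ⟫ ≈ 0#
    ⟪⟫-const {f} c ones⟂f = begin
      ⟪ (λ (_ : Fin n) → c) , f ⟫            ≈⟨ ⟪⟫-cong {n} {f} {λ _ → c} (λ _ → ≡.sym (ℕ.*-identityʳ c)) ⟩
      ⟪ (λ (_ : Fin n) → c ℕ.* 1) , f ⟫      ≈⟨ ⟪⟫-* {n} {f} c ones ⟩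
      nat c * ⟪ ones , f ⟫                   ≈⟨ *-congˡ ones⟂f ⟩
      nat c * 0#                             ≈⟨ zeroʳ (nat c) ⟩
      0#                                     ∎

    ⟪⟫-nat : ∀ (t u : Fin n → ℕ) → ⟪ t , nat ∘ u ⟫ ≈ nat (sum (λ y → t y ℕ.* u y))
    ⟪⟫-nat t u = trans (Σ-cong (λ y → sym (nat-* (t y) (u y)))) (sym (nat-sum (λ y → t y ℕ.* u y)))

    ones-eigenvector : Eigenvector adj (nat (main 0)) (λ _ → 1#)
    ones-eigenvector y = begin
      ⟪ adj y , (λ _ → 1#) ⟫       ≈⟨ Σ-cong (λ z → *-identityʳ (nat (adj y z))) ⟩
      Σ (nat ∘ adj y)              ≈⟨ nat-sum (adj y) ⟨
      nat (sum (adj y))            ≈⟨ nat-≡ (degree y) ⟩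
      nat (main 0)                 ≈⟨ *-identityʳ _ ⟨
      nat (main 0) * 1#            ∎

    Q : Fin n → Fin n → Carrier
    Q y z = nat (br N ℕ.* gram y z) - nat offset

    Q-sym : ∀ y z → Q y z ≈ Q z y
    Q-sym y z = +-congʳ (nat-≡ (≡.cong (br N ℕ.*_) (gram-sym y z)))

    module FirstEigenvalue (θ : Carrier) (θ≈ : θ + nat (br (suc d)) ≈ nat (main 1)) where

      -- Let G be the Gram matrix and J the all-ones matrix. `adj-gram` reads A G = μ_1 G + offset
      -- J, and `degree` gives A J = μ_0 J. Since μ_0 - μ_1 = [N], the J-part of A ([N] G - offset
      -- J) is ([N] - μ_0) offset J = -μ_1 offset J. This is where both coefficients of Q come from.
      Q-eigenvector : ∀ x → Eigenvector adj θ (λ y → Q y x)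
      Q-eigenvector x y = begin
        Σ (λ z → nat (adj y z) * (nat (bN ℕ.* gram z x) - o))
          ≈⟨ Σ-cong {n} (λ z → trans (distribˡ (nat (adj y z)) (nat (bN ℕ.* gram z x)) (- o)) (+-congˡ (sym (-‿distribʳ-* (nat (adj y z)) o)))) ⟩
        Σ (λ z → nat (adj y z) * nat (bN ℕ.* gram z x) + - (nat (adj y z) * o))
          ≈⟨ Σ-+ (λ z → nat (adj y z) * nat (bN ℕ.* gram z x)) (λ z → - (nat (adj y z) * o)) ⟩
        ⟪ adj y , (λ z → nat (bN ℕ.* gram z x)) ⟫ + Σ (λ z → - (nat (adj y z) * o))
          ≈⟨ +-cong gram-part (trans (Σ-neg (λ z → nat (adj y z) * o)) (-‿cong offset-part)) ⟩
        nat bN * h - m * o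
          ≈⟨ +-cong (trans (*-congˡ s≈) (distribˡ (nat bN) (θ * g) o)) (-‿cong (trans (*-congʳ m≈) (distribʳ o (nat bN) θ))) ⟩
        (nat bN * (θ * g) + nat bN * o) - (nat bN * o + θ * o)
          ≈⟨ cancel (nat bN * (θ * g)) (nat bN * o) (θ * o) ⟩
        nat bN * (θ * g) - θ * o
          ≈⟨ +-cong (solve 3 (λ b t g → b :* (t :* g) := t :* (b :* g)) refl (nat bN) θ g) (-‿distribʳ-* θ o) ⟩
        θ * (nat bN * g) + θ * - o
          ≈⟨ distribˡ θ (nat bN * g) (- o) ⟨
        θ * (nat bN * g - o)
          ≈⟨ *-congˡ (+-congʳ (nat-* bN (gram y x))) ⟨
        θ * Q y x ∎
        where
        bN sℕ : ℕ
        bN = br N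
        sℕ = sum (λ z → adj y z ℕ.* gram z x)
        o g h m b : Carrier
        o = nat offset
        g = nat (gram y x)
        h = nat sℕ
        m = nat (main 0)
        b = nat (br (suc d))
        cancel : ∀ a b c → (a + b) - (b + c) ≈ a - c
        cancel a b c = begin
          (a + b) - (b + c)       ≈⟨ +-congˡ (-‿+-comm b c) ⟨
          (a + b) + (- b + - c)   ≈⟨ +-assoc (a + b) (- b) (- c) ⟨
          ((a + b) + - b) + - c   ≈⟨ +-congʳ (trans (+-assoc a b (- b)) (trans (+-congˡ (-‿inverseʳ b)) (+-identityʳ a))) ⟩
          a - c                   ∎
        gram-part : ⟪ adj y , (λ z → nat (bN ℕ.* gram z x)) ⟫ ≈ nat bN * h
        gram-part = begin
          ⟪ adj y , (λ z → nat (bN ℕ.* gram z x)) ⟫              ≈⟨ ⟪⟫-nat (adj y) (λ z → bN ℕ.* gram z x) ⟩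
          nat (sum (λ z → adj y z ℕ.* (bN ℕ.* gram z x)))        ≈⟨ nat-≡ (sum-cong-≗ (λ z → lemma (adj y z) bN (gram z x))) ⟩
          nat (sum (λ z → bN ℕ.* (adj y z ℕ.* gram z x)))        ≈⟨ nat-≡ (*-distribˡ-sum bN (λ z → adj y z ℕ.* gram z x)) ⟨
          nat (bN ℕ.* sℕ)                                        ≈⟨ nat-* bN sℕ ⟩
          nat bN * h                                             ∎
          where
          lemma : ∀ a b c → a ℕ.* (b ℕ.* c) ≡ b ℕ.* (a ℕ.* c)
          lemma = solve-∀
        offset-part : Σ (λ z → nat (adj y z) * o) ≈ m * o
        offset-part = trans (sym (*-distribʳ-Σ o (λ z → nat (adj y z))))
          (*-congʳ (trans (sym (nat-sum (adj y))) (nat-≡ (degree y))))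
        s≈ : h ≈ θ * g + o
        s≈ = +-cancelʳ (b * g) h (θ * g + o) (begin
          h + b * g                                     ≈⟨ +-congˡ (nat-* (br (suc d)) (gram y x)) ⟨
          h + nat (br (suc d) ℕ.* gram y x)             ≈⟨ nat-+ sℕ (br (suc d) ℕ.* gram y x) ⟨
          nat (sℕ ℕ.+ br (suc d) ℕ.* gram y x)          ≈⟨ nat-≡ (adj-gram y x) ⟩
          nat (main 1 ℕ.* gram y x ℕ.+ offset)          ≈⟨ nat-+ (main 1 ℕ.* gram y x) offset ⟩
          nat (main 1 ℕ.* gram y x) + o                 ≈⟨ +-congʳ (nat-* (main 1) (gram y x)) ⟩
          nat (main 1) * g + o                          ≈⟨ +-congʳ (*-congʳ θ≈) ⟨
          (θ + b) * g + o                               ≈⟨ solve 4 (λ t b g o → (t :+ b) :* g :+ o := (t :* g :+ o) :+ b :* g) refl θ b g o ⟩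
          (θ * g + o) + b * g                           ∎)
        m≈ : m ≈ nat bN + θ
        m≈ = +-cancelʳ b m (nat bN + θ) (begin
          m + b                                         ≈⟨ nat-+ (main 0) (br (suc d)) ⟨
          nat (main 0 ℕ.+ br (suc d))                   ≈⟨ nat-≡ (≡.trans gap-0 (≡.cong (λ t → br t ℕ.+ main 1) (≡.sym (≡.trans N≡ (ℕ.+-suc d l))))) ⟩
          nat (bN ℕ.+ main 1)                           ≈⟨ nat-+ bN (main 1) ⟩
          nat bN + nat (main 1)                         ≈⟨ +-congˡ θ≈ ⟨
          nat bN + (θ + b)                              ≈⟨ +-assoc (nat bN) θ b ⟨
          (nat bN + θ) + b                              ∎)

      private
        -- Adding `br (suc d)` times w to both sides turns θ into `main 1`, so that only natural
        -- coefficients remain.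
        scaled : ∀ k {w} → (θ + nat (shift k)) * w ≈ nat (main k) * w →
                 nat (main 1 ℕ.+ shift k) * w ≈ nat (main k ℕ.+ br (suc d)) * w
        scaled k {w} eq = begin
          nat (main 1 ℕ.+ shift k) * w                           ≈⟨ *-congʳ (trans (nat-+ (main 1) (shift k)) (+-congʳ (sym θ≈))) ⟩
          (θ + nat (br (suc d)) + nat (shift k)) * w             ≈⟨ solve 4 (λ t b c w → (t :+ b :+ c) :* w := (t :+ c) :* w :+ b :* w) refl θ (nat (br (suc d))) (nat (shift k)) w ⟩
          (θ + nat (shift k)) * w + nat (br (suc d)) * w         ≈⟨ +-congʳ eq ⟩
          nat (main k) * w + nat (br (suc d)) * w                ≈⟨ distribʳ w _ _ ⟨
          (nat (main k) + nat (br (suc d))) * w                  ≈⟨ *-congʳ (nat-+ (main k) (br (suc d))) ⟨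
          nat (main k ℕ.+ br (suc d)) * w                        ∎

        -- The difference j - i is a positive integer, hence invertible.
        nat-separated : ∀ {i j} → i < j → ∀ {w} → nat j * w ≈ nat i * w → w ≈ 0#
        nat-separated {i} {j} i<j {w} eq = nat-cancel (j ∸ i) {{ℕ.>-nonZero (ℕ.m<n⇒0<n∸m i<j)}}
          (+-cancelʳ (nat i * w) _ _ (begin
            nat (j ∸ i) * w + nat i * w          ≈⟨ distribʳ w _ _ ⟨
            (nat (j ∸ i) + nat i) * w            ≈⟨ *-congʳ (nat-+ (j ∸ i) i) ⟨
            nat (j ∸ i ℕ.+ i) * w                ≈⟨ *-congʳ (nat-≡ (ℕ.m∸n+n≡m (ℕ.<⇒≤ i<j))) ⟩
            nat j * w                            ≈⟨ eq ⟩
            nat i * w                            ≈⟨ +-identityˡ _ ⟨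
            0# + nat i * w                       ∎))

      separated-0 : Separated θ 0
      separated-0 eq = nat-separated main₁<main₀ (sym (scaled 0 eq))
        where
        main₁<main₀ : main 1 ℕ.+ 0 < main 0 ℕ.+ br (suc d)
        main₁<main₀ = ≡.subst₂ _<_ (≡.sym (ℕ.+-identityʳ (main 1))) (≡.sym gap-0)
          (ℕ.m<n+m (main 1) {br (suc d ℕ.+ l)} (s≤s z≤n))

      separated-suc : .{{NonZero l}} → ∀ k → suc k ≤ d → Separated θ (suc (suc k))
      separated-suc k k<d eq = nat-separated (gap-< k k<d) (scaled (suc (suc k)) eq)

      module Projection .{{_ : NonZero denominator}} .{{_ : NonZero l}} where

        κ : Carrier
        κ = nat numerator * inv denominator

        denominator*κ : nat denominator * κ ≈ nat numerator
        denominator*κ = begin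
          nat denominator * (nat numerator * inv denominator)  ≈⟨ solve 3 (λ d n i → d :* (n :* i) := n :* (d :* i)) refl (nat denominator) (nat numerator) (inv denominator) ⟩
          nat numerator * (nat denominator * inv denominator)  ≈⟨ *-congˡ (nat-inv denominator) ⟩
          nat numerator * 1#                                   ≈⟨ *-identityʳ _ ⟩
          nat numerator                                        ∎

        -- Both sides are multiplied by p [D] [N − D] q ^ D to clear the denominators of a, b, c, r and t.
        entry-identity : ∀ {x y i j} → gram x y ≡ q ^ (i ℕ.+ j) → ∀ {a b c r t} →
          a * nat (p ℕ.* (br (suc d) ℕ.* br l)) ≈ nat (q ℕ.* br (d ℕ.+ l) ℕ.* (br (suc d) ℕ.+ br l)) →
          b * nat (p ℕ.* (br (suc d) ℕ.* br l)) ≈ nat (q ℕ.* br N ℕ.* br (d ℕ.+ l)) →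
          c * nat (br (suc d) ℕ.* br l) ≈ nat (br N ℕ.* br (d ℕ.+ l)) →
          r * nat (q ^ suc d) ≈ nat (q ^ i) → t * nat (q ^ suc d) ≈ nat (q ^ suc i) →
          nat n * (κ * Q x y) ≈ (- a + b * r) + (t * c) * nat (br j)
        entry-identity {x} {y} {i} {j} gram≡ {a} {b} {c} {r} {t} a≈ b≈ c≈ r≈ t≈ = nat-cancelˡ δ {{δ≢0}} (nat-cancelˡ e {{e≢0}} (begin
          nat e * (nat δ * (nat n * (κ * Q x y)))
            ≈⟨ solve 5 (λ e d n k u → e :* (d :* (n :* (k :* u))) := n :* d :* e :* k :* u) refl (nat e) (nat δ) (nat n) κ (Q x y) ⟩
          nat n * nat δ * nat e * κ * Q x y
            ≈⟨ *-congʳ (*-congʳ (trans (nat-* (n ℕ.* δ) e) (*-congʳ (nat-* n δ)))) ⟨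
          nat denominator * κ * Q x y
            ≈⟨ *-congʳ denominator*κ ⟩
          nat numerator * (nat (br N ℕ.* gram x y) - nat offset)
            ≈⟨ trans (distribˡ _ _ _) (+-congˡ (sym (-‿distribʳ-* (nat numerator) (nat offset)))) ⟩
          nat numerator * nat (br N ℕ.* gram x y) - nat numerator * nat offset
            ≈⟨ +-cong gram-part (-‿cong offset-part) ⟩
          (nat B * nat (q ^ i) + nat (q ^ suc i) * (nat p * nat C) * nat (br j)) - nat A * nat e
            ≈⟨ +-comm _ _ ⟩
          - (nat A * nat e) + (nat B * nat (q ^ i) + nat (q ^ suc i) * (nat p * nat C) * nat (br j))
            ≈⟨ +-cong (-‿cong (*-congʳ a≈)) (+-cong (*-cong b≈ r≈) (*-congʳ (*-cong t≈ (*-congˡ c≈)))) ⟨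
          - (a * nat δ * nat e) + (b * nat δ * (r * nat e) + (t * nat e) * (nat p * (c * nat (br (suc d) ℕ.* br l))) * nat (br j))
            ≈⟨ +-cong (trans (-‿distribˡ-* (a * nat δ) (nat e)) (*-congʳ (-‿distribˡ-* a (nat δ))))
                 (+-congˡ (*-congʳ (*-congˡ (trans (solve 3 (λ p c w → p :* (c :* w) := c :* (p :* w)) refl (nat p) c (nat (br (suc d) ℕ.* br l)))
                   (*-congˡ (sym (nat-* p (br (suc d) ℕ.* br l)))))))) ⟩
          - a * nat δ * nat e + (b * nat δ * (r * nat e) + (t * nat e) * (c * nat δ) * nat (br j))
            ≈⟨ solve 8 (λ m d e b r t c j → m :* d :* e :+ (b :* d :* (r :* e) :+ (t :* e) :* (c :* d) :* j) := e :* (d :* ((m :+ b :* r) :+ t :* c :* j)))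
                 refl (- a) (nat δ) (nat e) b r t c (nat (br j)) ⟩
          nat e * (nat δ * ((- a + b * r) + (t * c) * nat (br j))) ∎))
          where
          δ e A B C : ℕ
          δ = p ℕ.* (br (suc d) ℕ.* br l)
          e = q ^ suc d
          A = q ℕ.* br (d ℕ.+ l) ℕ.* (br (suc d) ℕ.+ br l)
          B = q ℕ.* br N ℕ.* br (d ℕ.+ l)
          C = br N ℕ.* br (d ℕ.+ l)
          e≢0 : NonZero e
          e≢0 = ℕ.m^n≢0 q (suc d)
          δ≢0 : NonZero δ
          δ≢0 = ℕ.m*n≢0 p _ {{p≢0}} {{ℕ.m*n≢0 (br (suc d)) (br l) {{_}} {{br-nonZero l}}}}
          offset-part : nat numerator * nat offset ≈ nat A * nat e
          offset-part = trans (sym (nat-* numerator offset)) (trans (nat-≡ (lemma q (br (d ℕ.+ l)) (br (suc d) ℕ.+ br l) e)) (nat-* A e))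
            where
            lemma : ∀ q b s e → q ℕ.* b ℕ.* (s ℕ.* e) ≡ q ℕ.* b ℕ.* s ℕ.* e
            lemma = solve-∀
          gram-part : nat numerator * nat (br N ℕ.* gram x y) ≈ nat B * nat (q ^ i) + nat (q ^ suc i) * (nat p * nat C) * nat (br j)
          gram-part = begin
            nat numerator * nat (br N ℕ.* gram x y)                         ≈⟨ nat-* numerator (br N ℕ.* gram x y) ⟨
            nat (numerator ℕ.* (br N ℕ.* gram x y))                         ≈⟨ nat-≡ identity ⟩
            nat (B ℕ.* q ^ i ℕ.+ q ^ suc i ℕ.* (p ℕ.* C) ℕ.* br j)          ≈⟨ nat-+ (B ℕ.* q ^ i) (q ^ suc i ℕ.* (p ℕ.* C) ℕ.* br j) ⟩
            nat (B ℕ.* q ^ i) + nat (q ^ suc i ℕ.* (p ℕ.* C) ℕ.* br j)      ≈⟨ +-cong (nat-* B (q ^ i)) (trans (nat-* (q ^ suc i ℕ.* (p ℕ.* C)) (br j))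
              (*-congʳ (trans (nat-* (q ^ suc i) (p ℕ.* C)) (*-congˡ (nat-* p C))))) ⟩
            nat B * nat (q ^ i) + nat (q ^ suc i) * (nat p * nat C) * nat (br j) ∎
            where
            lemma : ∀ q b n g p j → q ℕ.* b ℕ.* (n ℕ.* (g ℕ.* (p ℕ.* j ℕ.+ 1))) ≡ q ℕ.* n ℕ.* b ℕ.* g ℕ.+ q ℕ.* g ℕ.* (p ℕ.* (n ℕ.* b)) ℕ.* j
            lemma = solve-∀
            -- Here q^j = p [j] + 1 splits |x ∩ y| = q^(i + j) into q^i, which gives the power of q
            -- in the dual eigenvalue, and q^i p [j], which gives the cover term.
            identity : numerator ℕ.* (br N ℕ.* gram x y) ≡ B ℕ.* q ^ i ℕ.+ q ^ suc i ℕ.* (p ℕ.* C) ℕ.* br j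
            identity = ≡.trans
              (≡.cong (λ t → numerator ℕ.* (br N ℕ.* t))
                (≡.trans gram≡ (≡.trans (ℕ.^-distribˡ-+-* q i j) (≡.cong (q ^ i ℕ.*_) (≡.sym ([q-1]*bracket p j))))))
              (lemma q (br (d ℕ.+ l)) (br N) (q ^ i) p (br j))

        module _ {e : Fin n → Carrier} (eigen : Eigenvector adj θ e) where

          Pe : Fin n → Carrier
          Pe y = Σ (λ z → κ * Q y z * e z)

          ones⟂e : ⟪ ones , e ⟫ ≈ 0#
          ones⟂e = trans (⟪⟫-cong (λ y → ≡.sym (contains-𝟎 y))) (annihilates-0 eigen separated-0 𝟎-dim)

          -- The constant part of Q drops out: e is orthogonal to the all-ones vector, because θ is
          -- separated from μ_0.
          Pe≈ : ∀ y → Pe y ≈ κ * nat (br N) * ⟪ gram y , e ⟫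
          Pe≈ y = begin
            Σ (λ z → κ * Q y z * e z)
              ≈⟨ Σ-cong {n} (λ z → expand (nat (br N ℕ.* gram y z)) (e z)) ⟩
            Σ (λ z → κ * (nat (br N ℕ.* gram y z) * e z) + κ * - o * e z)
              ≈⟨ Σ-+ (λ z → κ * (nat (br N ℕ.* gram y z) * e z)) (λ z → κ * - o * e z) ⟩
            Σ (λ z → κ * (nat (br N ℕ.* gram y z) * e z)) + Σ (λ z → κ * - o * e z)
              ≈⟨ +-cong (trans (sym (*-distribˡ-Σ κ (λ z → nat (br N ℕ.* gram y z) * e z))) (*-congˡ (⟪⟫-* (br N) (gram y))))
                        (trans (sym (*-distribˡ-Σ (κ * - o) e)) (trans (*-congˡ Σe≈0) (zeroʳ (κ * - o)))) ⟩
            κ * (nat (br N) * ⟪ gram y , e ⟫) + 0#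
              ≈⟨ trans (+-identityʳ _) (sym (*-assoc κ (nat (br N)) _)) ⟩
            κ * nat (br N) * ⟪ gram y , e ⟫ ∎
            where
            o : Carrier
            o = nat offset
            expand : ∀ a w → κ * (a - o) * w ≈ κ * (a * w) + κ * - o * w
            expand a w = solve 4 (λ k a o w → k :* (a :+ o) :* w := k :* (a :* w) :+ k :* o :* w) refl κ a (- o) w
            Σe≈0 : Σ e ≈ 0#
            Σe≈0 = trans (Σ-cong (λ z → trans (sym (*-identityˡ (e z))) (*-congʳ (sym nat-1)))) ones⟂e

          -- By `Pe≈` the left side is κ [N] times the pairing of v^∨ G with e, for the Gram matrix
          -- G. Modulo constants v^∨ G is p (N₁ - N₂) v^∨, constants pair to 0 with e, and
          -- `normalisation` makes the total factor 1.
          through-Pe : ∀ {v} → v ∉ 𝟎 → ⟪ through v , Pe ⟫ ≈ ⟪ through v , e ⟫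
          through-Pe {v} v∉𝟎 = nat-cancelˡ denominator (begin
            nat denominator * ⟪ through v , Pe ⟫           ≈⟨ *-congˡ Pe-part ⟩
            nat denominator * (κ * nat bN * M)             ≈⟨ solve 4 (λ d k b m → d :* (k :* b :* m) := (d :* k) :* (b :* m)) refl (nat denominator) κ (nat bN) M ⟩
            (nat denominator * κ) * (nat bN * M)           ≈⟨ *-congʳ denominator*κ ⟩
            nat numerator * (nat bN * M)                   ≈⟨ M-part ⟩
            nat denominator * F                            ∎)
            where
            bN : ℕ
            bN = br N
            W : Fin n → ℕ
            W z = sum (λ y → through v y ℕ.* gram y z)
            M F : Carrier
            M = ⟪ W , e ⟫
            F = ⟪ through v , e ⟫
            Pe-part : ⟪ through v , Pe ⟫ ≈ κ * nat bN * M
            Pe-part = begin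
              Σ (λ y → nat (through v y) * Pe y)
                ≈⟨ Σ-cong (λ y → trans (*-congˡ (Pe≈ y))
                     (solve 3 (λ t k g → t :* (k :* g) := k :* (t :* g)) refl (nat (through v y)) (κ * nat bN) ⟪ gram y , e ⟫)) ⟩
              Σ (λ y → κ * nat bN * (nat (through v y) * ⟪ gram y , e ⟫))
                ≈⟨ *-distribˡ-Σ (κ * nat bN) (λ y → nat (through v y) * ⟪ gram y , e ⟫) ⟨
              κ * nat bN * Σ (λ y → nat (through v y) * ⟪ gram y , e ⟫)
                ≈⟨ *-congˡ (Σ-cong (λ y → ⟪⟫-* (through v y) (gram y))) ⟨
              κ * nat bN * Σ (λ y → ⟪ (λ z → through v y ℕ.* gram y z) , e ⟫)
                ≈⟨ *-congˡ (⟪⟫-sum (λ y z → through v y ℕ.* gram y z)) ⟨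
              κ * nat bN * M ∎
            W-identity : ∀ z → W z ℕ.+ (p ℕ.* N₂ ℕ.* through v z ℕ.+ N₂) ≡ p ℕ.* N₁ ℕ.* through v z ℕ.+ (N₁ ℕ.+ N₂ ℕ.* q ^ suc d)
            W-identity z = ≡.trans (lemma₁ (W z) p N₂ (through v z))
              (≡.trans (through-gram v∉𝟎 z) (lemma₂ p N₁ (through v z) (N₂ ℕ.* q ^ suc d)))
              where
              lemma₁ : ∀ w p m t → w ℕ.+ (p ℕ.* m ℕ.* t ℕ.+ m) ≡ w ℕ.+ m ℕ.* (1 ℕ.+ p ℕ.* t)
              lemma₁ = solve-∀
              lemma₂ : ∀ p m t c → m ℕ.* (1 ℕ.+ p ℕ.* t) ℕ.+ c ≡ p ℕ.* m ℕ.* t ℕ.+ (m ℕ.+ c)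
              lemma₂ = solve-∀
            affine : ∀ a c → ⟪ (λ z → a ℕ.* through v z ℕ.+ c) , e ⟫ ≈ nat a * F
            affine a c = trans (⟪⟫-+ (λ z → a ℕ.* through v z) (λ _ → c))
              (trans (+-cong (⟪⟫-* a (through v)) (⟪⟫-const c ones⟂e)) (+-identityʳ _))
            M≈ : M + nat (p ℕ.* N₂) * F ≈ nat (p ℕ.* N₁) * F
            M≈ = begin
              M + nat (p ℕ.* N₂) * F                                            ≈⟨ +-congˡ (affine (p ℕ.* N₂) N₂) ⟨
              M + ⟪ (λ z → p ℕ.* N₂ ℕ.* through v z ℕ.+ N₂) , e ⟫               ≈⟨ ⟪⟫-+ W (λ z → p ℕ.* N₂ ℕ.* through v z ℕ.+ N₂) ⟨
              ⟪ (λ z → W z ℕ.+ (p ℕ.* N₂ ℕ.* through v z ℕ.+ N₂)) , e ⟫         ≈⟨ ⟪⟫-cong W-identity ⟩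
              ⟪ (λ z → p ℕ.* N₁ ℕ.* through v z ℕ.+ (N₁ ℕ.+ N₂ ℕ.* q ^ suc d)) , e ⟫ ≈⟨ affine (p ℕ.* N₁) (N₁ ℕ.+ N₂ ℕ.* q ^ suc d) ⟩
              nat (p ℕ.* N₁) * F                                                ∎
            product : ∀ m → nat (numerator ℕ.* (bN ℕ.* m)) ≈ nat numerator * (nat bN * nat m)
            product m = trans (nat-* numerator (bN ℕ.* m)) (*-congˡ (nat-* bN m))
            M-part : nat numerator * (nat bN * M) ≈ nat denominator * F
            M-part = +-cancelʳ (nat numerator * (nat bN * nat (p ℕ.* N₂)) * F) _ _ (begin
              nat numerator * (nat bN * M) + nat numerator * (nat bN * nat (p ℕ.* N₂)) * F
                ≈⟨ solve 5 (λ x b m c f → x :* (b :* m) :+ x :* (b :* c) :* f := x :* (b :* (m :+ c :* f))) refl (nat numerator) (nat bN) M (nat (p ℕ.* N₂)) F ⟩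
              nat numerator * (nat bN * (M + nat (p ℕ.* N₂) * F))
                ≈⟨ *-congˡ (*-congˡ M≈) ⟩
              nat numerator * (nat bN * (nat (p ℕ.* N₁) * F))
                ≈⟨ solve 4 (λ x b c f → x :* (b :* (c :* f)) := x :* (b :* c) :* f) refl (nat numerator) (nat bN) (nat (p ℕ.* N₁)) F ⟩
              nat numerator * (nat bN * nat (p ℕ.* N₁)) * F
                ≈⟨ *-congʳ (product (p ℕ.* N₁)) ⟨
              nat (numerator ℕ.* (bN ℕ.* (p ℕ.* N₁))) * F
                ≈⟨ *-congʳ (nat-≡ (normalisation v∉𝟎)) ⟩
              nat (denominator ℕ.+ numerator ℕ.* (bN ℕ.* (p ℕ.* N₂))) * F
                ≈⟨ *-congʳ (trans (nat-+ denominator _) (+-congˡ (product (p ℕ.* N₂)))) ⟩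
              (nat denominator + nat numerator * (nat bN * nat (p ℕ.* N₂))) * F
                ≈⟨ distribʳ F _ _ ⟩
              nat denominator * F + nat numerator * (nat bN * nat (p ℕ.* N₂)) * F ∎)

          -- e − P e lies in the eigenspace and is orthogonal to the characteristic vector of
          -- every subspace of dimension 1, so it vanishes.
          P-fixes : ∀ y → Pe y ≈ e y
          P-fixes y = sym (x-y≈0⇒x≈y (e y) (Pe y) (annihilates-top
            -- Separation fails at level 1, where θ = μ_1. There `annihilates-1` takes over, and the
            -- induction calls for separation from level 2 on.
            (annihilates-all residual-eigen annihilates-1 (λ { (suc i) _ i<d → separated-suc i i<d }) (suc d) (s≤s z≤n) ℕ.≤-refl) y))
            where
            residual-eigen : Eigenvector adj θ (λ y → e y - Pe y)
            residual-eigen = eigenvector-sub adj eigen λ y → begin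
              ⟪ adj y , Pe ⟫                                          ≈⟨ Σ-cong (λ z → *-congˡ (Σ-cong (λ w → swap (Q z w) (e w)))) ⟩
              ⟪ adj y , (λ z → Σ (λ w → Q z w * (κ * e w))) ⟫         ≈⟨ eigenvector-combination adj (λ w z → Q z w) (λ w → κ * e w) Q-eigenvector y ⟩
              θ * Σ (λ w → Q y w * (κ * e w))                         ≈⟨ *-congˡ (Σ-cong (λ w → swap (Q y w) (e w))) ⟨
              θ * Pe y                                                ∎
              where
              swap : ∀ a w → κ * a * w ≈ a * (κ * w)
              swap = solve 3 (λ k a w → k :* a :* w := a :* (k :* w)) refl κ
            annihilates-1 : Annihilates 1 (λ y → e y - Pe y)
            annihilates-1 {α} A with ⊈⇒∃ {u = α} {𝟎} (λ α⊆𝟎 → contradiction (Dim-≤ A 𝟎-dim α⊆𝟎) λ ())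
            ... | v , v∈α , v∉𝟎 = begin
              ⟪ contains α , (λ y → e y - Pe y) ⟫
                ≈⟨ ⟪⟫-cong (λ y → ≡.trans (≡.cong (λ u → contains u y) (≡.sym (Dim-≡ (line-dim v∉𝟎) A (line⊆ (flat A) v∈α)))) (contains-line v y)) ⟩
              Σ (λ y → nat (through v y) * (e y - Pe y))
                ≈⟨ Σ-cong {n} (λ y → trans (distribˡ (nat (through v y)) (e y) (- Pe y)) (+-congˡ (sym (-‿distribʳ-* (nat (through v y)) (Pe y))))) ⟩
              Σ (λ y → nat (through v y) * e y + - (nat (through v y) * Pe y))
                ≈⟨ Σ-+ (λ y → nat (through v y) * e y) (λ y → - (nat (through v y) * Pe y)) ⟩
              ⟪ through v , e ⟫ + Σ (λ y → - (nat (through v y) * Pe y))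
                ≈⟨ +-congˡ (trans (Σ-neg (λ y → nat (through v y) * Pe y)) (-‿cong (through-Pe v∉𝟎))) ⟩
              ⟪ through v , e ⟫ - ⟪ through v , e ⟫
                ≈⟨ -‿inverseʳ _ ⟩
              0# ∎

-- Natural numbers, order and apartness in ℝ and ℂ

module ComplexNumbersOverReals where

  open import Algebra.Bundles using (CommutativeRing)
  import Algebra.Properties.AbelianGroup as AbelianGroupProperties
  import Algebra.Properties.Monoid.Mult as MonoidMult
  import Algebra.Properties.Ring as RingProperties
  import Algebra.Properties.Semiring.Mult as SemiringMult
  open import Data.Nat.Base as ℕ using (ℕ; zero; suc; NonZero)
  import Data.Nat.Properties as ℕ
  open import Data.Product.Base using (_,_; proj₂)
  open import Defs
  open import Relation.Binary.PropositionalEquality as ≡ using (_≡_)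
  import Relation.Binary.Reasoning.Setoid as SetoidReasoning
  open Spectra

  module RealNumbers {r ℓ₁ ℓ₂ ℓ₃} (ℝ : RealField r ℓ₁ ℓ₂ ℓ₃) where
    open RealField ℝ
    open CommutativeRing commutativeRing using (ring; semiring; +-monoid)
    open RingProperties ring using (-0#≈0#)

    open AbelianGroupProperties (CommutativeRing.+-abelianGroup commutativeRing) public
      using () renaming (∙-cancelʳ to ℝ-+-cancelʳ)

    ℝ-+-swapʳ : ∀ x y z → x + y + z ≈ x + z + y
    ℝ-+-swapʳ x y z = trans (+-assoc x y z) (trans (+-congˡ (+-comm y z)) (sym (+-assoc x z y)))

    fromℕ-+ : ∀ m n → fromℕ (m ℕ.+ n) ≈ fromℕ m + fromℕ n
    fromℕ-+ = MonoidMult.×-homo-+ +-monoid 1#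

    fromℕ-* : ∀ m n → fromℕ (m ℕ.* n) ≈ fromℕ m * fromℕ n
    fromℕ-* = SemiringMult.×1-homo-* semiring

    x-0≈x : ∀ x → x - 0# ≈ x
    x-0≈x x = trans (+-congˡ -0#≈0#) (+-identityʳ x)

    -- Apartness of n from 0 yields an inverse of n - 0, hence the correction by `x-0≈x`.
    fromℕ-inverse : ∀ n .{{_ : NonZero n}} → fromℕ n * fromℕ⁻¹ n ≈ 1#
    fromℕ-inverse n = trans (*-congʳ (sym (x-0≈x (fromℕ n)))) (proj₂ (proj₂ (#⇒invertible (fromℕ-# n))))

    +-monoˡ-< : ∀ z {x y} → x < y → x + z < y + z
    +-monoˡ-< z {x} {y} x<y = <-respˡ (+-comm z x) (<-respʳ (+-comm z y) (+-monoʳ-< z x<y))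

    x<x+fromℕ : ∀ x n → x < x + fromℕ (suc n)
    x<x+fromℕ x n = <-respˡ (+-identityʳ x) (+-monoʳ-< x (0<fromℕ n))

    <-+fromℕ : ∀ {x y} n → x + fromℕ n < y → x < y
    <-+fromℕ {x} zero    lt = <-respˡ (+-identityʳ x) lt
    <-+fromℕ {x} (suc n) lt = <-trans (x<x+fromℕ x n) lt

    fromℕ-≡ : ∀ {m n} → m ≡ n → fromℕ m ≈ fromℕ n
    fromℕ-≡ m≡n = reflexive (≡.cong fromℕ m≡n)

    fromℕ-mono-< : ∀ {m n} → m ℕ.< n → fromℕ m < fromℕ n
    fromℕ-mono-< {m} {suc n} m<n = <-respʳ
      (trans (sym (fromℕ-+ m (suc (n ℕ.∸ m)))) (fromℕ-≡ (≡.trans (ℕ.+-suc m (n ℕ.∸ m)) (≡.cong suc (ℕ.m+[n∸m]≡n (ℕ.s≤s⁻¹ m<n))))))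
      (x<x+fromℕ (fromℕ m) (n ℕ.∸ m))

    <⇒0<- : ∀ {x y} → x < y → 0# < y - x
    <⇒0<- {x} {y} x<y = <-respˡ (-‿inverseʳ x) (+-monoˡ-< (- x) x<y)

    <-sub : ∀ {x y z} → x < y + z → x - z < y
    <-sub {x} {y} {z} lt = <-respʳ
      (trans (+-assoc y z (- z)) (trans (+-congˡ (-‿inverseʳ z)) (+-identityʳ y))) (+-monoˡ-< (- z) lt)

    >⇒# : ∀ {x y} → y < x → x # y
    >⇒# y<x = #-sym (<⇒# y<x)

  module ComplexScalars {r ℓ₁ ℓ₂ ℓ₃} (ℝ : RealField r ℓ₁ ℓ₂ ℓ₃) where
    open ComplexNumbers ℝ
    open RealNumbers ℝ public
    private
      module R = RealField ℝ
      module C = CommutativeRing complexRing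
      open RingProperties (CommutativeRing.ring R.commutativeRing) using (-0#≈0#)

    real-cong : ∀ {a b} → a R.≈ b → real a ≈ real b
    real-cong a≈b = a≈b , R.refl

    real-+ : ∀ a b → real (a R.+ b) ≈ real a + real b
    real-+ a b = R.refl , R.sym (R.+-identityˡ R.0#)

    real-neg : ∀ a → real (R.- a) ≈ - real a
    real-neg a = R.refl , R.sym -0#≈0#

    real-* : ∀ a b → real (a R.* b) ≈ real a * real b
    real-* a b = R.sym (R.trans (R.+-congˡ (R.-‿cong (R.zeroˡ R.0#))) (x-0≈x (a R.* b)))
               , R.sym (R.trans (R.+-cong (R.zeroʳ a) (R.zeroˡ b)) (R.+-identityˡ R.0#))

    naturalScalars : NaturalScalars complexRing
    naturalScalars = record
      { nat     = ⌜_⌝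
      ; nat-0   = C.refl
      ; nat-1   = real-cong (R.+-identityʳ R.1#)
      ; nat-+   = λ m n → C.trans (real-cong (fromℕ-+ m n)) (real-+ (R.fromℕ m) (R.fromℕ n))
      ; nat-*   = λ m n → C.trans (real-cong (fromℕ-* m n)) (real-* (R.fromℕ m) (R.fromℕ n))
      ; inv     = λ n → real (R.fromℕ⁻¹ n)
      ; nat-inv = λ n → C.trans (C.sym (real-* (R.fromℕ n) (R.fromℕ⁻¹ n))) (real-cong (fromℕ-inverse n))
      }

    -- Apart reals have an invertible difference, and its real inverse cancels in ℂ as well.
    #⇒separated : ∀ {a b w} → a R.# b → real a * w ≈ real b * w → w ≈ 0#
    #⇒separated {a} {b} {w} a#b eq with R.#⇒invertible a#b
    ... | c , c*[a-b]≈1 , _ = begin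
      w                                      ≈⟨ C.*-identityˡ w ⟨
      1# * w                                 ≈⟨ C.*-congʳ (real-cong c*[a-b]≈1) ⟨
      real (c R.* (a R.- b)) * w             ≈⟨ C.*-congʳ (real-* c (a R.- b)) ⟩
      (real c * real (a R.- b)) * w          ≈⟨ C.*-assoc (real c) (real (a R.- b)) w ⟩
      real c * (real (a R.- b) * w)          ≈⟨ C.*-congˡ (C.*-congʳ (C.trans (real-+ a (R.- b)) (C.+-congˡ (real-neg b)))) ⟩
      real c * ((real a - real b) * w)       ≈⟨ C.*-congˡ (C.distribʳ w (real a) (- real b)) ⟩
      real c * (real a * w + - real b * w)   ≈⟨ C.*-congˡ (C.+-cong eq (C.sym (-‿distribˡ-* (real b) w))) ⟩
      real c * (real b * w - real b * w)     ≈⟨ C.*-congˡ (C.-‿inverseʳ (real b * w)) ⟩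
      real c * 0#                            ≈⟨ C.zeroʳ (real c) ⟩
      0#                                     ∎
      where
      open SetoidReasoning C.setoid
      open RingProperties C.ring using (-‿distribˡ-*)

    IsReal : ℂ → Set ℓ₁
    IsReal z = proj₂ z R.≈ R.0#

    IsReal-* : ∀ {z w} → IsReal z → IsReal w → IsReal (z * w)
    IsReal-* {a , _} {c , _} b≈0 d≈0 = R.trans
      (R.+-cong (R.trans (R.*-congˡ d≈0) (R.zeroʳ a)) (R.trans (R.*-congʳ b≈0) (R.zeroˡ c))) (R.+-identityˡ R.0#)

    IsReal-- : ∀ {z w} → IsReal z → IsReal w → IsReal (z - w)
    IsReal-- b≈0 d≈0 = R.trans (R.+-cong b≈0 (R.trans (R.-‿cong d≈0) -0#≈0#)) (R.+-identityˡ R.0#)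

    conj-real : ∀ {z} → IsReal z → conj z ≈ z
    conj-real b≈0 = R.refl , R.trans (R.trans (R.-‿cong b≈0) -0#≈0#) (R.sym b≈0)

    ÷-* : ∀ a b .{{_ : NonZero b}} → (a ÷ b) * ⌜ b ⌝ ≈ ⌜ a ⌝
    ÷-* a b = C.trans (C.sym (real-* _ (R.fromℕ b))) (real-cong (R.trans (R.*-assoc (R.fromℕ a) _ _)
      (R.trans (R.*-congˡ (R.trans (R.*-comm _ (R.fromℕ b)) (fromℕ-inverse b))) (R.*-identityʳ (R.fromℕ a)))))

-- The first eigenvalue, the entries of E₁, and the action of the dual adjacency matrix

module DualAdjacencyMatrices where

  open import Data.Fin.Base as Fin using (Fin; zero; suc; toℕ; fromℕ<)
  import Data.Fin.Properties as Fin
  open import Data.Fin.Subset using (_⊆_; _∩_)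
  open import Data.Fin.Subset.Properties using (_⊆?_; ⊆-trans; ∩-comm; p∩q⊆p; p∩q⊆q)
  import Data.Integer.Base as ℤ
  import Data.Integer.Properties as ℤ
  open import Data.List.Base using (length)
  open import Data.List.Membership.Propositional using () renaming (_∈_ to _∈ₗ_)
  open import Data.List.Membership.Propositional.Properties using (∈-lookup; ∈-filter⁺; ∈-filter⁻)
  import Data.List.Relation.Unary.Any as Any
  import Data.List.Relation.Unary.Any.Properties as Any
  import Data.List.Relation.Unary.Unique.Propositional.Properties as Unique
  open import Data.Nat.Base as ℕ using (ℕ; zero; suc; _≤_; _<_; _^_; _∸_; NonZero; s≤s; z≤n)
  import Data.Nat.DivMod as ℕ
  import Data.Nat.Properties as ℕ
  open import Data.Product.Base using (∃-syntax; _×_; _,_; proj₁; proj₂)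
  open import Data.Sum.Base using (_⊎_; inj₁; inj₂)
  open import Defs
  open import Function.Base using (_∘_)
  open import Relation.Binary.PropositionalEquality as ≡ using (_≡_)
  open import Relation.Nullary using (¬_; Dec; yes; no; contradiction)
  open import Relation.Nullary.Decidable using (_×-dec_)
  open Counting
  open SubspaceCounts
  open FiniteVectorSpaces
  open Spectra
  open ComplexNumbersOverReals

  module DualAdjacency {c ℓ m ℓm r ℓ₁ ℓ₂ ℓ₃} (ℝ : RealField r ℓ₁ ℓ₂ ℓ₃) {p N} (𝔽 : FiniteField c ℓ (suc p))
    (𝒱 : VectorSpace 𝔽 N m ℓm) (d : ℕ) (1≤D : 1 ≤ suc d) (2D<N : 2 ℕ.* suc d < N) where

    open GrassmannGraph ℝ 𝔽 𝒱 (suc d) 1≤D 2D<N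
      hiding (_≈_; _+_; _*_; _-_; -_; 0#; 1#; sum)
    open VectorGeometry 𝔽 𝒱 using (geometry; HasDim⇒∥∥; ∥∥⇒HasDim; subspaces-isSubspace; subspaces-unique; ∈-subspaces; ∩-isSubspace)
    open ComplexScalars ℝ
    private
      module R = RealField ℝ

    l : ℕ
    l = N ∸ suc d

    N≡ : N ≡ d ℕ.+ suc l
    N≡ = ≡.sym (≡.trans (ℕ.+-suc d l) (ℕ.m+[n∸m]≡n (ℕ.<⇒≤ D<N)))

    vertex-member : ∀ y → ⟦ y ⟧ ∈ₗ subspaces × HasDim ⟦ y ⟧ (suc d)
    vertex-member y = ∈-filter⁻ (λ u → hasDim? u (suc d)) {xs = subspaces} (∈-lookup y)

    vertex-isSubspace : ∀ y → IsSubspace ⟦ y ⟧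
    vertex-isSubspace y = proj₂ (∈-filter⁻ isSubspace? {xs = allSubsets (suc p ^ N)} (proj₁ (vertex-member y)))

    vertex-dim : ∀ y → Counts.Dim geometry ⟦ y ⟧ (suc d)
    vertex-dim y = Counts.isDim (vertex-isSubspace y) (HasDim⇒∥∥ (vertex-isSubspace y) (proj₂ (vertex-member y)))

    vertex-injective : ∀ {y z} → ⟦ y ⟧ ≡ ⟦ z ⟧ → y ≡ z
    vertex-injective = lookup-injective (Unique.filter⁺ (λ u → hasDim? u (suc d)) subspaces-unique)

    vertex-onto : ∀ {u} → Counts.Dim geometry u (suc d) → ∃[ y ] ⟦ y ⟧ ≡ u
    vertex-onto {u} (Counts.isDim U e) = Any.index u∈ , ≡.sym (Any.lookup-index u∈)
      where
      u∈ : u ∈ₗ vertices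
      u∈ = ∈-filter⁺ (λ u → hasDim? u (suc d)) (∈-subspaces U) (∥∥⇒HasDim U e)

    open GrassmannSpectrum complexRing naturalScalars geometry d l N≡ ⟦_⟧ vertex-dim vertex-injective vertex-onto
      hiding (q)

    private
      q : ℕ
      q = suc p

    instance
      l≢0 : NonZero l
      l≢0 = ℕ.>-nonZero (ℕ.m<n⇒0<n∸m D<N)

    adjacent≡ : ∀ y z → adj y z ≡ 𝟙 (adjacent? y z)
    adjacent≡ y z = 𝟙-cong (∥ ⟦ z ⟧ ∩ ⟦ y ⟧ ∥ ℕ.≟ q ^ d) (adjacent? y z)
      (λ e → ∥∥⇒HasDim y∩z (≡.trans (≡.cong ∥_∥ (∩-comm ⟦ y ⟧ ⟦ z ⟧)) e))
      (λ dim → ≡.trans (≡.cong ∥_∥ (∩-comm ⟦ z ⟧ ⟦ y ⟧)) (HasDim⇒∥∥ y∩z dim))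
      where
      y∩z : IsSubspace (⟦ y ⟧ ∩ ⟦ z ⟧)
      y∩z = ∩-isSubspace (vertex-isSubspace y) (vertex-isSubspace z)

    adjacency-· : ∀ v y → (adjacencyMatrix · v) y ≈ ⟪ adj y , v ⟫
    adjacency-· v y = Σ-cong (λ z → *-congʳ {v z} (sym (trans (nat-≡ (adjacent≡ y z)) (nat-𝟙 (adjacent? y z)))))

    eigenspace⇒ : ∀ {θ v} → Eigenspace adjacencyMatrix θ v → Eigenvector adj θ v
    eigenspace⇒ {v = v} eigen y = trans (sym (adjacency-· v y)) (eigen y)

    ⇒eigenspace : ∀ {θ v} → Eigenvector adj θ v → Eigenspace adjacencyMatrix θ v
    ⇒eigenspace {v = v} eigen y = trans (adjacency-· v y) (eigen y)

    μ₁ : R.Carrier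
    μ₁ = R.fromℕ (main 1) R.- R.fromℕ (br (suc d))

    μ₁+≈ : μ₁ R.+ R.fromℕ (br (suc d)) R.≈ R.fromℕ (main 1)
    μ₁+≈ = R.trans (R.+-assoc _ _ _) (R.trans (R.+-congˡ (R.-‿inverseˡ _)) (R.+-identityʳ _))

    real-+-nat : ∀ a k → real a + nat k ≈ real (a R.+ R.fromℕ k)
    real-+-nat a k = sym (real-+ a (R.fromℕ k))

    #⇒Separated : ∀ {a} k → (a R.+ R.fromℕ (shift k)) R.# R.fromℕ (main k) → Separated (real a) k
    #⇒Separated {a} k a# {w} eq = #⇒separated a# (trans (*-congʳ {w} (sym (real-+-nat a (shift k)))) eq)

    -- Write k for `suc i`. By `gap-≤`, μ₁ + `shift k` equals `main k` plus a natural number `gap`.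
    -- So a > μ₁ gives a + `shift k` > `main k`, and apartness follows.
    >μ₁⇒Separated : ∀ {a} i → i ≤ d → μ₁ R.< a → Separated (real a) (suc i)
    >μ₁⇒Separated {a} i i≤d μ₁<a = #⇒Separated (suc i) (>⇒# (<-+fromℕ gap
      (R.<-respˡ gap≈ (+-monoˡ-< (R.fromℕ (shift (suc i))) μ₁<a))))
      where
      b gap : ℕ
      b   = br (suc d)
      gap = main 1 ℕ.+ shift (suc i) ∸ (main (suc i) ℕ.+ b)
      gap≈ : μ₁ R.+ R.fromℕ (shift (suc i)) R.≈ R.fromℕ (main (suc i)) R.+ R.fromℕ gap
      gap≈ = ℝ-+-cancelʳ (R.fromℕ b) _ _ (R.trans (ℝ-+-swapʳ μ₁ (R.fromℕ (shift (suc i))) (R.fromℕ b)) (R.trans (R.+-congʳ μ₁+≈)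
        (R.trans (R.sym (fromℕ-+ (main 1) (shift (suc i)))) (R.trans
          (fromℕ-≡ (≡.sym (ℕ.m+[n∸m]≡n (gap-≤ i i≤d))))
          (R.trans (fromℕ-+ (main (suc i) ℕ.+ b) gap) (R.trans (R.+-congʳ (fromℕ-+ (main (suc i)) b))
            (ℝ-+-swapʳ (R.fromℕ (main (suc i))) (R.fromℕ b) (R.fromℕ gap))))))))

    θ≈main₁ : ∀ {a} → a R.≈ μ₁ → real a + nat (br (suc d)) ≈ nat (main 1)
    θ≈main₁ {a} a≈μ₁ = trans (real-+-nat a (br (suc d))) (real-cong (R.trans (R.+-congʳ a≈μ₁) μ₁+≈))

    -- After division by q^D this is [D] + [N - D] < [N] = [D] + q^D [N - D]. It makes the diagonal
    -- of Q positive, so the columns of Q are non-zero eigenvectors.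
    offset<gram : ∀ x → offset < br N ℕ.* gram x x
    offset<gram x = ≡.subst (λ t → offset < br N ℕ.* t) (≡.sym (gram-diagonal x))
      (ℕ.*-monoˡ-< (q ^ suc d) {{ℕ.m^n≢0 q (suc d)}} (≡.subst (br (suc d) ℕ.+ br l <_) (≡.sym brN≡)
        (ℕ.+-monoʳ-< (br (suc d)) (≡.subst (br l <_) (ℕ.*-comm (br l) (q ^ suc d))
          (ℕ.m<m*n (br l) (q ^ suc d) {{br-nonZero l {{l≢0}}}} 1<q^D)))))
      where
      brN≡ : br N ≡ br (suc d) ℕ.+ q ^ suc d ℕ.* br l
      brN≡ = ≡.trans (≡.cong br (≡.sym (ℕ.m+[n∸m]≡n (ℕ.<⇒≤ D<N)))) (bracket-+ q (suc d) l)
      1<q^D : 1 < q ^ suc d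
      1<q^D = ℕ.^-monoʳ-< q 1<q {0} {suc d} (s≤s z≤n)

    [_]≡br : ∀ k → [ k ] ≡ br k
    [ k ]≡br = ≡.trans
      (≡.cong (λ t → (t ∸ 1) ℕ./ p) (≡.sym (≡.trans (ℕ.+-comm 1 (p ℕ.* br k)) ([q-1]*bracket p k))))
      (≡.trans (≡.cong (ℕ._/ p) (ℕ.*-comm p (br k))) (ℕ.m*n/n≡m (br k) p))

    N∸1≡ : N ∸ 1 ≡ d ℕ.+ l
    N∸1≡ = ≡.cong (_∸ 1) (≡.trans N≡ (ℕ.+-suc d l))

    -- Multiplication by q^b clears the denominator for either sign of a - b. Taking b = D covers
    -- both the exponent -(D - i) of the dual eigenvalue and the exponent -D + i + 1 of the cover
    -- coefficient.
    q^-⊖ : ∀ a b → q^ (a ℤ.⊖ b) * nat (q ^ b) ≈ nat (q ^ a)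
    q^-⊖ a b = split (a ℕ.<? b)
      where
      split : Dec (a < b) → q^ (a ℤ.⊖ b) * nat (q ^ b) ≈ nat (q ^ a)
      split (no a≮b) = trans (*-congʳ {nat (q ^ b)} (reflexive (≡.cong q^_ (ℤ.⊖-≥ (ℕ.≮⇒≥ a≮b)))))
        (trans (sym (nat-* (q ^ (a ∸ b)) (q ^ b)))
          (nat-≡ (≡.trans (≡.sym (ℕ.^-distribˡ-+-* q (a ∸ b) b)) (≡.cong (q ^_) (ℕ.m∸n+n≡m (ℕ.≮⇒≥ a≮b))))))
      split (yes a<b) = trans (*-congʳ {nat (q ^ b)} (reflexive (≡.cong q^_ (ℤ.⊖-< a<b))))
        (negative (b ∸ a) {{ℕ.>-nonZero (ℕ.m<n⇒0<n∸m a<b)}} (≡.sym (ℕ.m∸n+n≡m (ℕ.<⇒≤ a<b))))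
        where
        negative : ∀ t → .{{NonZero t}} → b ≡ t ℕ.+ a → q^ (ℤ.- (ℤ.+ t)) * nat (q ^ b) ≈ nat (q ^ a)
        negative (suc t) b≡ = begin
          q^ ℤ.-[1+ t ] * nat (q ^ b)                           ≈⟨ *-congˡ {q^ ℤ.-[1+ t ]} (trans (nat-≡ (≡.trans (≡.cong (q ^_) b≡) (ℕ.^-distribˡ-+-* q (suc t) a))) (nat-* (q ^ suc t) (q ^ a))) ⟩
          q^ ℤ.-[1+ t ] * (nat (q ^ suc t) * nat (q ^ a))       ≈⟨ *-assoc (q^ ℤ.-[1+ t ]) (nat (q ^ suc t)) (nat (q ^ a)) ⟨
          (q^ ℤ.-[1+ t ] * nat (q ^ suc t)) * nat (q ^ a)       ≈⟨ *-congʳ {nat (q ^ a)} (÷-* 1 (q ^ suc t) {{ℕ.m^n≢0 q (suc t)}}) ⟩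
          nat 1 * nat (q ^ a)                                   ≈⟨ *-congʳ {nat (q ^ a)} nat-1 ⟩
          1# * nat (q ^ a)                                      ≈⟨ *-identityˡ (nat (q ^ a)) ⟩
          nat (q ^ a)                                           ∎

    q^-dual : ∀ {i} → i ≤ suc d → q^ (ℤ.- (ℤ.+ (suc d ∸ i))) * nat (q ^ suc d) ≈ nat (q ^ i)
    q^-dual {i} i≤D = trans (*-congʳ {nat (q ^ suc d)} (reflexive (≡.cong q^_ (≡.sym (ℤ.⊖-≤ i≤D))))) (q^-⊖ i (suc d))

    q^-cover : ∀ i → q^ (ℤ.- (ℤ.+ suc d) ℤ.+ ℤ.+ i ℤ.+ ℤ.+ 1) * nat (q ^ suc d) ≈ nat (q ^ suc i)
    q^-cover i = trans (*-congʳ {nat (q ^ suc d)} (reflexive (≡.cong q^_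
      (≡.trans (ℤ.+-assoc (ℤ.- (ℤ.+ suc d)) (ℤ.+ i) (ℤ.+ 1))
        (≡.trans (ℤ.-m+n≡n⊖m (suc d) (i ℕ.+ 1)) (≡.cong (ℤ._⊖ suc d) (ℕ.+-comm i 1)))))))
      (q^-⊖ (suc i) (suc d))

    ^∨≈ : ∀ α y → (α ^∨) y ≈ nat (contains α y)
    ^∨≈ α y = begin
      (α ^∨) y                                                 ≈⟨ Σ-cong (λ i → trans (if-* (α ⊆? ⟦ i ⟧) (unit i y))
        (trans (*-congˡ {nat (contains α i)} (trans (sym (nat-𝟙 (i Fin.≟ y))) (nat-≡ (𝟙-cong (i Fin.≟ y) (y Fin.≟ i) ≡.sym ≡.sym))))
               (*-comm (nat (contains α i)) (nat (𝟙 (y Fin.≟ i)))))) ⟩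
      ⟪ (λ i → 𝟙 (y Fin.≟ i)) , nat ∘ contains α ⟫              ≈⟨ unit-test (nat ∘ contains α) y ⟩
      nat (contains α y)                                       ∎

    cover? : ∀ x α g → Dec (γ g ⊆ ⟦ x ⟧ × γ g Covers α)
    cover? x α g = (γ g ⊆? ⟦ x ⟧) ×-dec (γ g covers? α)

    coverCount : X → VectorSet → X → ℕ
    coverCount x α y = sum (λ g → 𝟙 (cover? x α g) ℕ.* contains (γ g) y)

    coverSum≈ : ∀ x α y → coverSum x α y ≈ nat (coverCount x α y)
    coverSum≈ x α y = begin
      coverSum x α y                                                      ≈⟨ Σ-cong (λ g → trans (if-* (cover? x α g) ((γ g ^∨) y))
        (trans (*-congˡ {nat (𝟙 (cover? x α g))} (^∨≈ (γ g) y)) (sym (nat-* (𝟙 (cover? x α g)) (contains (γ g) y))))) ⟩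
      Σ (λ g → nat (𝟙 (cover? x α g) ℕ.* contains (γ g) y))               ≈⟨ nat-sum (λ g → 𝟙 (cover? x α g) ℕ.* contains (γ g) y) ⟨
      nat (coverCount x α y)                                              ∎

    coverCount-⊈ : ∀ x {α y} → ¬ α ⊆ ⟦ y ⟧ → coverCount x α y ≡ 0
    coverCount-⊈ x {α} {y} α⊈y = ∑0≡0 (λ g → 𝟙 (cover? x α g) ℕ.* contains (γ g) y) (λ g → ≡.trans (≡.sym (𝟙-× (cover? x α g) (γ g ⊆? ⟦ y ⟧)))
      (𝟙-no (cover? x α g ×-dec (γ g ⊆? ⟦ y ⟧)) (λ ((_ , α⊆ , _) , ⊆y) → α⊈y (⊆-trans α⊆ ⊆y))))

    -- The covers of α inside x that also lie in y are those inside x ∩ y. The bound i < N is there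
    -- because `Covers` stores dim α as an element of `Fin N`.
    coverCount-⊆ : ∀ x {α y i j} → Dim α i → i < N → Dim (⟦ x ⟧ ∩ ⟦ y ⟧) (i ℕ.+ j) → α ⊆ ⟦ x ⟧ → α ⊆ ⟦ y ⟧ →
      coverCount x α y ≡ br j
    coverCount-⊆ x {α} {y} {i} {j} A i<N XY α⊆x α⊆y = ≡.trans
      (sum-cong-≗ {length subspaces} (λ g → ≡.trans (≡.sym (𝟙-× (cover? x α g) (γ g ⊆? ⟦ y ⟧)))
        (𝟙-cong (cover? x α g ×-dec (γ g ⊆? ⟦ y ⟧)) (between? α (⟦ x ⟧ ∩ ⟦ y ⟧) (suc i) g) (to g) (from g))))
      (count-covers A XY (∩-greatest α⊆x α⊆y))
      where
      to : ∀ g → (γ g ⊆ ⟦ x ⟧ × γ g Covers α) × γ g ⊆ ⟦ y ⟧ → Between α (⟦ x ⟧ ∩ ⟦ y ⟧) (suc i) g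
      to g ((⊆x , α⊆ , k , dim , dim′) , ⊆y) = α⊆ , ∩-greatest ⊆x ⊆y ,
        ≡.trans (HasDim⇒∥∥ (subspaces-isSubspace g) dim′)
          (≡.cong (λ t → q ^ suc t) (^-injectiveʳ {q} {toℕ k} {i} 1<q (≡.trans (≡.sym (HasDim⇒∥∥ (flat A) dim)) (card A))))
      from : ∀ g → Between α (⟦ x ⟧ ∩ ⟦ y ⟧) (suc i) g → (γ g ⊆ ⟦ x ⟧ × γ g Covers α) × γ g ⊆ ⟦ y ⟧
      from g (α⊆ , ⊆x∩y , e) =
        (⊆-trans ⊆x∩y (p∩q⊆p ⟦ x ⟧ ⟦ y ⟧) , α⊆ , fromℕ< i<N ,
          ≡.subst (HasDim α) (≡.sym (Fin.toℕ-fromℕ< i<N)) (∥∥⇒HasDim (flat A) (card A)) ,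
          ≡.subst (λ t → HasDim (γ g) (suc t)) (≡.sym (Fin.toℕ-fromℕ< i<N)) (∥∥⇒HasDim (subspaces-isSubspace g) e)) ,
        ⊆-trans ⊆x∩y (p∩q⊆q ⟦ x ⟧ ⟦ y ⟧)

    module _ (x : X) where

      -- Both μ_0 and μ_1 are eigenvalues, with the all-ones vector and column x of Q as
      -- eigenvectors, so they occur in the list as θ_a and θ_b. No eigenvalue above μ_1 is apart
      -- from μ_0, which forces b = 1.
      first-eigenvalue : ∀ {θ} → DistinctEigenvalues adjacencyMatrix θ → θ first R.≈ μ₁
      first-eigenvalue {θ} distinct = locate (exhaustive (nat (main 0)) ones-isEigenvalue)
                                             (exhaustive (real μ₁) Q-isEigenvalue)
        where
        open DistinctEigenvalues distinct
        ones-isEigenvalue : IsEigenvalue adjacencyMatrix (nat (main 0))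
        ones-isEigenvalue = (λ _ → 1#) , (x , inj₁ R.1#0) , ⇒eigenspace {nat (main 0)} {λ _ → 1#} ones-eigenvector
        Q-isEigenvalue : IsEigenvalue adjacencyMatrix (real μ₁)
        Q-isEigenvalue = (λ y → Q y x) , (x , inj₁ (>⇒# (<⇒0<- (fromℕ-mono-< (offset<gram x))))) ,
          ⇒eigenspace {real μ₁} {λ y → Q y x} (FirstEigenvalue.Q-eigenvector (real μ₁) (θ≈main₁ R.refl) x)
        μ₁<μ₀ : μ₁ R.< R.fromℕ (main 0)
        μ₁<μ₀ = <-sub (R.<-respʳ (fromℕ-+ (main 0) (br (suc d))) (fromℕ-mono-<
          (≡.subst (main 1 <_) (≡.sym gap-0) (ℕ.m<n+m (main 1) {br (suc d ℕ.+ l)} (s≤s z≤n)))))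
        ¬#0 : ∀ {z} → z ≈ 0# → ¬ z # 0#
        ¬#0 (a≈0 , _) (inj₁ a#0) = R.#-irrefl a≈0 a#0
        ¬#0 (_ , b≈0) (inj₂ b#0) = R.#-irrefl b≈0 b#0
        impossible : ∀ j → μ₁ R.< θ j → ¬ (θ j R.< R.fromℕ (main 0) ⊎ R.fromℕ (main 0) R.< θ j)
        impossible j μ₁<θj θj≠μ₀ = refute (eigenvalue j)
          where
          apart : θ j R.< R.fromℕ (main 0) ⊎ R.fromℕ (main 0) R.< θ j → (θ j R.+ R.0#) R.# R.fromℕ (main 0)
          apart (inj₁ lt) = R.<⇒# (R.<-respˡ (R.sym (R.+-identityʳ (θ j))) lt)
          apart (inj₂ gt) = >⇒# (R.<-respʳ (R.sym (R.+-identityʳ (θ j))) gt)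
          refute : ¬ IsEigenvalue adjacencyMatrix (real (θ j))
          refute (v , (y , vy#0) , eigen) = ¬#0 {v y} (eigenvector≈0 {real (θ j)} {v} (eigenspace⇒ {real (θ j)} {v} eigen)
            (#⇒Separated {θ j} 0 (apart θj≠μ₀)) (λ i i≤d → >μ₁⇒Separated {θ j} i i≤d μ₁<θj) y) vy#0
        locate : ∃[ a ] nat (main 0) ≈ real (θ a) → ∃[ b ] real μ₁ ≈ real (θ b) → θ first R.≈ μ₁
        -- For b = 0 the eigenvalue μ_0 = θ_a would lie above θ_0.
        locate (a , (μ₀≈ , _)) (zero , (μ₁≈ , _)) = contradiction (R.<-respˡ μ₁≈ (R.<-respʳ μ₀≈ μ₁<μ₀)) (maximal a)
          where
          maximal : ∀ a → ¬ θ zero R.< θ a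
          maximal zero    lt = R.<-irrefl R.refl lt
          maximal (suc a) lt = R.<-irrefl R.refl (R.<-trans lt (decreasing (s≤s z≤n)))
        locate _ (suc zero , (μ₁≈ , _)) = R.sym μ₁≈
        -- For b ≥ 2 both θ_0 and θ_1 exceed μ_1, and one of them is apart from μ_0: θ_1 < θ_0 = μ_0
        -- if a = 0, and θ_0 > θ_a = μ_0 otherwise.
        locate (zero , (μ₀≈ , _)) (suc (suc b) , (μ₁≈ , _)) = contradiction
          (inj₁ (R.<-respʳ (R.sym μ₀≈) (decreasing {zero} {suc zero} (s≤s z≤n))))
          (impossible (suc zero) (R.<-respˡ (R.sym μ₁≈) (decreasing {suc zero} {suc (suc b)} (s≤s (s≤s z≤n)))))
        locate (suc a , (μ₀≈ , _)) (suc (suc b) , (μ₁≈ , _)) = contradiction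
          (inj₂ (R.<-respˡ (R.sym μ₀≈) (decreasing {zero} {suc a} (s≤s z≤n))))
          (impossible zero (R.<-respˡ (R.sym μ₁≈) (decreasing {zero} {suc (suc b)} (s≤s z≤n))))

      denominator-nonZero : NonZero denominator
      denominator-nonZero = ℕ.m*n≢0 _ (q ^ suc d) {{ℕ.m*n≢0 ∣X∣ _ {{Fin.nonZeroIndex x}}
        {{ℕ.m*n≢0 p _ {{p≢0}} {{ℕ.m*n≢0 (br (suc d)) (br l) {{_}} {{br-nonZero l {{l≢0}}}}}}}}}} {{ℕ.m^n≢0 q (suc d)}}

      module Entries {ϑ : R.Carrier} (ϑ≈μ₁ : ϑ R.≈ μ₁) (E₁ : Matrix ∣X∣)
        (projection : IsOrthogonalProjection E₁ (Eigenspace adjacencyMatrix (real ϑ))) where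
        open IsOrthogonalProjection projection
        open FirstEigenvalue (real ϑ) (θ≈main₁ ϑ≈μ₁)
        open Projection {{denominator-nonZero}} {{l≢0}} public

        column : X → Vector ∣X∣
        column y = E₁ · unit y

        column≈ : ∀ y z → column y z ≈ E₁ z y
        column≈ y z = trans (Σ-cong (λ u → trans (*-comm (E₁ z u) (unit y u)) (*-congʳ {E₁ z u} (sym (nat-𝟙 (y Fin.≟ u))))))
                            (unit-test (E₁ z) y)

        P-column : X → Vector ∣X∣
        P-column x z = κ * Q z x

        P-column-real : ∀ x z → conj (P-column x z) ≈ P-column x z
        P-column-real x z = conj-real (IsReal-* {κ} {Q z x} (IsReal-* {nat numerator} R.refl R.refl)
          (IsReal-- {nat (br N ℕ.* gram z x)} {nat offset} R.refl R.refl))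

        -- Orthogonality is tested against the columns of P only, so no definiteness of the
        -- inner product is needed.
        entry : ∀ y → E₁ x y ≈ κ * Q x y
        entry y = sym (begin
          κ * Q x y                                     ≈⟨ *-congˡ {κ} (Q-sym x y) ⟩
          P-column x y                                  ≈⟨ unit-test (P-column x) y ⟨
          ⟪ (λ z → 𝟙 (y Fin.≟ z)) , P-column x ⟫        ≈⟨ Σ-cong (λ z → trans (*-congʳ {P-column x z} (nat-𝟙 (y Fin.≟ z))) (*-comm (unit y z) (P-column x z))) ⟩
          Σ (λ z → P-column x z * unit y z)             ≈⟨ Σ-*-sub (P-column-real x) (orthogonal (unit y) (P-column x)
            (⇒eigenspace {real ϑ} {P-column x} (eigenvector-scale adj {real ϑ} {λ z → Q z x} κ (Q-eigenvector x)))) ⟩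
          Σ (λ z → P-column x z * column y z)           ≈⟨ Σ-cong (λ z → *-congʳ {column y z} (*-congˡ {κ} (Q-sym z x))) ⟩
          -- Column y of E₁ lies in the eigenspace by the range condition, and P is the identity
          -- there.
          Σ (λ z → κ * Q x z * column y z)              ≈⟨ P-fixes {column y} (eigenspace⇒ {real ϑ} {column y} (range (unit y))) x ⟩
          column y x                                    ≈⟨ column≈ y x ⟩
          E₁ x y                                        ∎)

        -- With dim (x ∩ y) = i + j, the factor [j] produced by `entry-identity` is the number of
        -- covers of α inside x ∩ y.
        diagonal-entry : ∀ {α i} → Dim α i → i ≤ suc d → α ⊆ ⟦ x ⟧ → ∀ y → α ⊆ ⟦ y ⟧ →
          nat ∣X∣ * E₁ x y ≈ dualEigenvalue (suc d ∸ i) + coverCoefficient i * nat (coverCount x α y)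
        diagonal-entry {α} {i} A i≤D α⊆x y α⊆y = meet (∩-dim (vertex-isSubspace x) (vertex-isSubspace y))
          where
          N-1 : [ N ∸ 1 ] ≡ br (d ℕ.+ l)
          N-1 = ≡.trans [ N ∸ 1 ]≡br (≡.cong br N∸1≡)
          [D][N-D] : [ suc d ] ℕ.* [ l ] ≡ br (suc d) ℕ.* br l
          [D][N-D] = ≡.cong₂ ℕ._*_ [ suc d ]≡br [ l ]≡br
          ÷≈ : ∀ {a a′ b b′} .{{_ : NonZero b}} → a ≡ a′ → b ≡ b′ → (a ÷ b) * nat b′ ≈ nat a′
          ÷≈ {a} {b = b} ≡.refl ≡.refl = ÷-* a b
          value : ∀ j → gram x y ≡ q ^ (i ℕ.+ j) →
            nat ∣X∣ * E₁ x y ≈ dualEigenvalue (suc d ∸ i) + coverCoefficient i * nat (br j)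
          value j gram≡ = trans (*-congˡ {nat ∣X∣} (entry y))
            (entry-identity {x} {y} {i} {j} gram≡
              {a = (q ℕ.* [ N ∸ 1 ] ℕ.* ([ suc d ] ℕ.+ [ l ])) ÷ (p ℕ.* ([ suc d ] ℕ.* [ l ]))}
              {b = (q ℕ.* [ N ] ℕ.* [ N ∸ 1 ]) ÷ (p ℕ.* ([ suc d ] ℕ.* [ l ]))}
              {c = ([ N ] ℕ.* [ N ∸ 1 ]) ÷ ([ suc d ] ℕ.* [ l ])}
              {r = q^ (ℤ.- (ℤ.+ (suc d ∸ i)))} {t = q^ (ℤ.- (ℤ.+ suc d) ℤ.+ ℤ.+ i ℤ.+ ℤ.+ 1)}
              (÷≈ (≡.cong₂ (λ s t → q ℕ.* s ℕ.* t) N-1 (≡.cong₂ ℕ._+_ [ suc d ]≡br [ l ]≡br)) (≡.cong (p ℕ.*_) [D][N-D]))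
              (÷≈ (≡.cong₂ (λ s t → q ℕ.* s ℕ.* t) [ N ]≡br N-1) (≡.cong (p ℕ.*_) [D][N-D]))
              (÷≈ (≡.cong₂ ℕ._*_ [ N ]≡br N-1) [D][N-D])
              (q^-dual i≤D) (q^-cover i))
          meet : ∃[ e ] Dim (⟦ x ⟧ ∩ ⟦ y ⟧) e →
            nat ∣X∣ * E₁ x y ≈ dualEigenvalue (suc d ∸ i) + coverCoefficient i * nat (coverCount x α y)
          meet (e , XY) = trans (value j (≡.trans (card XY) (≡.cong (q ^_) e≡)))
            (+-congˡ {dualEigenvalue (suc d ∸ i)} (*-congˡ {coverCoefficient i} (nat-≡ (≡.sym
              (coverCount-⊆ x A (ℕ.≤-<-trans i≤D D<N) (≡.subst (Dim (⟦ x ⟧ ∩ ⟦ y ⟧)) e≡ XY) α⊆x α⊆y)))))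
            where
            j : ℕ
            j = e ∸ i
            e≡ : e ≡ i ℕ.+ j
            e≡ = ≡.sym (ℕ.m+[n∸m]≡n (Dim-≤ A XY (∩-greatest α⊆x α⊆y)))

        dualAdjacency-· : ∀ v y → (dualAdjacencyMatrix E₁ x · v) y ≈ nat ∣X∣ * E₁ x y * v y
        dualAdjacency-· v y = trans (Σ-cong (λ z → trans (*-congʳ {v z} (if-* (y Fin.≟ z) (nat ∣X∣ * E₁ x y)))
            (*-assoc (nat (𝟙 (y Fin.≟ z))) (nat ∣X∣ * E₁ x y) (v z))))
          (unit-test (λ z → nat ∣X∣ * E₁ x y * v z) y)

        dualAdjacency-^∨ : ∀ {α i} → Dim α i → i ≤ suc d → α ⊆ ⟦ x ⟧ →
          dualAdjacencyMatrix E₁ x · α ^∨ ≋ dualEigenvalue (suc d ∸ i) ∙ α ^∨ ⊞ coverCoefficient i ∙ coverSum x α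
        dualAdjacency-^∨ {α} {i} A i≤D α⊆x y = begin
          (dualAdjacencyMatrix E₁ x · α ^∨) y            ≈⟨ dualAdjacency-· (α ^∨) y ⟩
          nat ∣X∣ * E₁ x y * (α ^∨) y                    ≈⟨ *-congˡ {nat ∣X∣ * E₁ x y} (^∨≈ α y) ⟩
          nat ∣X∣ * E₁ x y * nat (contains α y)          ≈⟨ split (α ⊆? ⟦ y ⟧) ⟩
          μ * nat (contains α y) + ν * nat (coverCount x α y) ≈⟨ +-cong (*-congˡ {μ} (^∨≈ α y)) (*-congˡ {ν} (coverSum≈ x α y)) ⟨
          μ * (α ^∨) y + ν * coverSum x α y              ∎
          where
          μ ν : ℂ
          μ = dualEigenvalue (suc d ∸ i)
          ν = coverCoefficient i
          split : Dec (α ⊆ ⟦ y ⟧) →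
            nat ∣X∣ * E₁ x y * nat (contains α y) ≈ μ * nat (contains α y) + ν * nat (coverCount x α y)
          split (yes α⊆y) = begin
            nat ∣X∣ * E₁ x y * nat (contains α y)                ≈⟨ times-1 (nat ∣X∣ * E₁ x y) ⟩
            nat ∣X∣ * E₁ x y                                     ≈⟨ diagonal-entry A i≤D α⊆x y α⊆y ⟩
            μ + ν * nat (coverCount x α y)                       ≈⟨ +-congʳ {ν * nat (coverCount x α y)} (times-1 μ) ⟨
            μ * nat (contains α y) + ν * nat (coverCount x α y)  ∎
            where
            times-1 : ∀ w → w * nat (contains α y) ≈ w
            times-1 w = trans (*-congˡ {w} (trans (nat-≡ (𝟙-yes (α ⊆? ⟦ y ⟧) α⊆y)) nat-1)) (*-identityʳ w)
          -- Outside the support of α^∨ the cover sum vanishes too: a cover of α inside y would put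
          -- α inside y.
          split (no α⊈y) = begin
            nat ∣X∣ * E₁ x y * nat (contains α y)                ≈⟨ times-0 (nat ∣X∣ * E₁ x y) (𝟙-no (α ⊆? ⟦ y ⟧) α⊈y) ⟩
            0#                                                   ≈⟨ +-identityˡ 0# ⟨
            0# + 0#                                              ≈⟨ +-cong (times-0 μ (𝟙-no (α ⊆? ⟦ y ⟧) α⊈y)) (times-0 ν (coverCount-⊈ x α⊈y)) ⟨
            μ * nat (contains α y) + ν * nat (coverCount x α y)  ∎
            where
            times-0 : ∀ w {k} → k ≡ 0 → w * nat k ≈ 0#
            times-0 w k≡0 = trans (*-congˡ {w} (trans (nat-≡ k≡0) nat-0)) (zeroʳ w)

    dualAdjacency-action : ∀ θ → DistinctEigenvalues adjacencyMatrix θ →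
      (E₁ : Matrix ∣X∣) → IsOrthogonalProjection E₁ (Eigenspace adjacencyMatrix (real (θ first))) →
      (x : X) (α : VectorSet) → IsSubspace α → α ⊆ ⟦ x ⟧ → (i : ℕ) → HasDim α i →
      dualAdjacencyMatrix E₁ x · α ^∨ ≋ dualEigenvalue (suc d ∸ i) ∙ α ^∨ ⊞ coverCoefficient i ∙ coverSum x α
    dualAdjacency-action θ distinct E₁ projection x α U α⊆x i dim =
      Entries.dualAdjacency-^∨ x (first-eigenvalue x distinct) E₁ projection A (Dim-≤ A (vertex-dim x) α⊆x) α⊆x
      where
      A : Dim α i
      A = isDim U (HasDim⇒∥∥ U dim)

open import Data.Empty using (⊥-elim)
open import Data.Fin.Base using (Fin)
open import Data.Fin.Subset using (_⊆_)
open import Data.Nat.Base using (ℕ; suc; _≤_; _<_; _*_; _∸_)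
open import Data.Nat.Properties using (n≮0)
open import Defs

theorem8p4 : ∀ {c ℓ m ℓm r ℓ₁ ℓ₂ ℓ₃} (ℝ : RealField r ℓ₁ ℓ₂ ℓ₃) {q N : ℕ} (𝔽 : FiniteField c ℓ q) (𝒱 : VectorSpace 𝔽 N m ℓm) (D : ℕ) (1≤D : 1 ≤ D) (2D<N : 2 * D < N) →
    let open GrassmannGraph ℝ 𝔽 𝒱 D 1≤D 2D<N in
    (θ : Fin (suc D) → RealField.Carrier ℝ) → DistinctEigenvalues adjacencyMatrix θ →
    (E₁ : Matrix ∣X∣) → IsOrthogonalProjection E₁ (Eigenspace adjacencyMatrix (real (θ first))) →
    (x : X) (α : VectorSet) → IsSubspace α → α ⊆ ⟦ x ⟧ → (i : ℕ) → HasDim α i →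
    dualAdjacencyMatrix E₁ x · α ^∨ ≋ dualEigenvalue (D ∸ i) ∙ α ^∨ ⊞ coverCoefficient i ∙ coverSum x α
-- The case q = 0 contradicts 1 < q. Matching q as `suc p` gives q - 1 the name p used in all
-- counts, and `1≤D` leaves only D = `suc d`.
theorem8p4 ℝ {0}     𝔽 𝒱 D       1≤D 2D<N = ⊥-elim (n≮0 (FiniteField.1<q 𝔽))
theorem8p4 ℝ {suc p} 𝔽 𝒱 (suc d) 1≤D 2D<N = DualAdjacencyMatrices.DualAdjacency.dualAdjacency-action ℝ 𝔽 𝒱 d 1≤D 2D<N
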